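{- Let $q$ be a prime power and $e$ a positive integer with $\gcd(e,q)=1$; set $k=\mathrm{ord}_e q$ and $l=\varphi(e)/k$. Let $n$ be a positive integer such that every prime divisor of $n$ divides $q-1$, $\gcd(n,ke)=1$, and $q\equiv1\pmod 4$ if $8$ divides $n$. Let $d=\gcd(n,q-1)$, $m=n/d$, and let $\theta\in\mathbb F_q$ be any element of multiplicative order $d$. If $\Phi_e(x)=\prod_{i=1}^{l}f_i(x)$ is the factorization of the $e$-th cyclotomic polynomial into monic irreducible polynomials over $\mathbb F_q$, then the factorization of $\Phi_e(x^n)$ into irreducible polynomials over $\mathbb F_q$ is $$\Phi_e(x^n)=\prod_{i=1}^{l}\prod_{t\mid m}\ \prod_{\substack{1\le u\le d\\ \gcd(u,t)=1}}\theta^{ -uk}f_i(\theta^{u}x^{t}).$$ Moreover, if $x^e-1=\prod_{i=1}^{N}F_i(x)$ is the factorization of $x^e-1$ into monic irreducible polynomials over $\mathbb F_q$, then the factorization of $x^{en}-1$ into irreducible polynomials over $\mathbb F_q$ is $$x^{en}-1=\prod_{i=1}^{N}\prod_{t\mid m}\ \prod_{\substack{1\le u\le d\\ \gcd(u,t)=1}}\theta^{ -u\deg(F_i)}F_i(\theta^{u}x^{t}).$$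
   Context: $\mathrm{ord}_e q$ is the multiplicative order of $q$ modulo $e$, $\varphi$ is Euler's totient function, and $\Phi_e(x)\in\mathbb F_q[x]$ is the $e$-th cyclotomic polynomial, defined recursively by $x^e-1=\prod_{j\mid e}\Phi_j(x)$. -}

module Defs where

open import Level using (Level; _⊔_)
open import Data.Nat as ℕ using (ℕ; zero; suc; _∸_; _≤_; _<_)
open import Data.Nat.Divisibility using (_∣_; _∣?_)
open import Data.Nat.GCD using (gcd)
open import Data.Nat.Primality using (Prime)
open import Data.Fin using (Fin)
import Data.Fin.Properties as FinP
open import Data.List using (List; []; _∷_; [_]; _++_; replicate; map; foldr; concatMap; filter; length; upTo)
open import Data.List.Relation.Unary.All using (All)
open import Data.Product using (Σ; _×_; _,_; proj₁; proj₂; ∃)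
open import Data.Sum using (_⊎_)
open import Relation.Nullary using (¬_; Dec; yes; no)
open import Relation.Binary.PropositionalEquality using (_≡_)
open import Algebra.Bundles using (CommutativeRing)

IsPrimePower : ℕ → Set
IsPrimePower q = Σ ℕ λ p → Σ ℕ λ a → Prime p × q ≡ p ℕ.^ suc a

-- k is the multiplicative order of q modulo e:
-- k ≥ 1, q^k ≡ 1 (mod e), and no smaller positive exponent works.
-- (Only used when q ≥ 1, so q^j ∸ 1 is the honest q^j - 1.)
IsMultOrderMod : (e q k : ℕ) → Set
IsMultOrderMod e q k =
  1 ≤ k × e ∣ (q ℕ.^ k ∸ 1) × (∀ j → 1 ≤ j → j < k → ¬ (e ∣ (q ℕ.^ j ∸ 1)))

oneTo : ℕ → List ℕ
oneTo n = map suc (upTo n)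

divisors : ℕ → List ℕ
divisors m = filter (λ t → t ∣? m) (oneTo m)

coprimeUpTo : ℕ → ℕ → List ℕ
coprimeUpTo d t = filter (λ u → gcd u t ℕ.≟ 1) (oneTo d)

record Field c ℓ : Set (Level.suc (c ⊔ ℓ)) where
  field
    commutativeRing : CommutativeRing c ℓ
  open CommutativeRing commutativeRing public
  field
    _⁻¹      : Carrier → Carrier
    0≉1      : ¬ (0# ≈ 1#)
    ⁻¹-inverse : ∀ x → ¬ (x ≈ 0#) → (x * (x ⁻¹)) ≈ 1#

record HasCardinality {c ℓ} (F : Field c ℓ) (q : ℕ) : Set (c ⊔ ℓ) where
  open Field F
  field
    enum       : Fin q → Carrier
    enum-surj  : ∀ x → Σ (Fin q) λ i → enum i ≈ x
    enum-inj   : ∀ i j → enum i ≈ enum j → i ≡ j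

-- Polynomials over a field, as coefficient lists (constant term first)

module Poly {c ℓ} (F : Field c ℓ) (q : ℕ) (card : HasCardinality F q) where
  open Field F
  open HasCardinality card

  _≈?_ : ∀ x y → Dec (x ≈ y)
  x ≈? y with enum-surj x | enum-surj y
  ... | i , ei≈x | j , ej≈y with i FinP.≟ j
  ...   | yes _≡_.refl = yes (trans (sym ei≈x) ej≈y)
  ...   | no i≢j = no λ x≈y → i≢j (enum-inj i j (trans ei≈x (trans x≈y (sym ej≈y))))

  pow : Carrier → ℕ → Carrier
  pow a zero    = 1#
  pow a (suc n) = a * pow a n

  HasMultOrder : Carrier → ℕ → Set ℓ
  HasMultOrder θ d = 1 ≤ d × pow θ d ≈ 1# × (∀ j → 1 ≤ j → j < d → ¬ (pow θ j ≈ 1#))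

  Pol : Set c
  Pol = List Carrier

  coeff : Pol → ℕ → Carrier
  coeff []      _       = 0#
  coeff (a ∷ p) zero    = a
  coeff (a ∷ p) (suc i) = coeff p i

  infix 4 _≈ₚ_
  _≈ₚ_ : Pol → Pol → Set ℓ
  p ≈ₚ r = ∀ i → coeff p i ≈ coeff r i

  infixl 6 _+ₚ_
  _+ₚ_ : Pol → Pol → Pol
  []      +ₚ r       = r
  (a ∷ p) +ₚ []      = a ∷ p
  (a ∷ p) +ₚ (b ∷ r) = (a + b) ∷ (p +ₚ r)

  scale : Carrier → Pol → Pol
  scale a p = map (a *_) p

  infixl 7 _*ₚ_
  _*ₚ_ : Pol → Pol → Pol
  []      *ₚ r = []
  (a ∷ p) *ₚ r = scale a r +ₚ (0# ∷ (p *ₚ r))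

  constP : Carrier → Pol
  constP a = [ a ]

  oneP : Pol
  oneP = [ 1# ]

  prodₚ : List Pol → Pol
  prodₚ = foldr _*ₚ_ oneP

  xPowMinusOne : ℕ → Pol
  xPowMinusOne n = (replicate n 0# ++ [ 1# ]) +ₚ [ - 1# ]

  substMono : Carrier → ℕ → Pol → Pol
  substMono a t []      = []
  substMono a t (b ∷ p) = [ b ] +ₚ (replicate t 0# ++ scale a (substMono a t p))

  substPow : ℕ → Pol → Pol
  substPow n f = substMono 1# n f

  strip : Pol → Pol
  strip []      = []
  strip (a ∷ p) with strip p
  ... | b ∷ r = a ∷ b ∷ r
  ... | []    with a ≈? 0#
  ...   | yes _ = []
  ...   | no  _ = [ a ]

  -- degree (the zero polynomial is given degree 0 by convention; never used)
  deg : Pol → ℕ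
  deg p = length (strip p) ∸ 1

  Monic : Pol → Set ℓ
  Monic p = Σ ℕ λ n → coeff p n ≈ 1# × (∀ i → n < i → coeff p i ≈ 0#)

  IsUnitP : Pol → Set (c ⊔ ℓ)
  IsUnitP g = Σ Carrier λ a → ¬ (a ≈ 0#) × g ≈ₚ constP a

  Irreducible : Pol → Set (c ⊔ ℓ)
  Irreducible p =
    ¬ (p ≈ₚ []) × ¬ IsUnitP p ×
    (∀ g h → p ≈ₚ g *ₚ h → IsUnitP g ⊎ IsUnitP h)

  MonicIrreducible : Pol → Set (c ⊔ ℓ)
  MonicIrreducible p = Monic p × Irreducible p

  -- Φ is the family of cyclotomic polynomials: each Φ j is monic and
  -- x^e - 1 = ∏_{j ∣ e} Φ_j(x) for every e ≥ 1.  (This recursion determines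
  -- Φ uniquely, since F[x] is an integral domain.)
  IsCyclotomicFamily : (ℕ → Pol) → Set ℓ
  IsCyclotomicFamily Φ =
    (∀ j → 1 ≤ j → Monic (Φ j)) ×
    (∀ e → 1 ≤ e → xPowMinusOne e ≈ₚ prodₚ (map Φ (divisors e)))

  liftFactors : (w : Pol → ℕ) → Carrier → (d m : ℕ) → List Pol → List Pol
  liftFactors w θ d m fs =
    concatMap (λ f →
      concatMap (λ t →
        map (λ u → scale (pow θ (u ℕ.* w f) ⁻¹) (substMono (pow θ u) t f))
            (coprimeUpTo d t))
        (divisors m))
      fs

{-# OPTIONS --safe #-}
-- No field extension is constructed.  Product: for y in a domain and θ of order d, if every prime divisor
-- of m divides d, then y^(dm) − 1 is the product of the y^t − θ^u over t ∣ m and u ≤ d prime to t (peel off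
-- the primes of m one at a time).  Taking y = x^e settles x^(en) − 1, and Φ_e(x^n) follows by induction on e,
-- cancelling the factors of the proper divisors of e.
--
-- Irreducibility: let g be irreducible of degree D, p a prime and ω ∈ F of order p.  If g(x^p) = a b properly,
-- then multiplying over the substitutions x ↦ ω^j x gives N(a) N(b) = g^p, so N(a) is a constant times g^i
-- with 0 < i < p, and comparing leading and constant coefficients shows that the i-th power of the norm
-- ± g(0) of a root is a p-th power.  For g(x) = f(θ^u x) with f ∣ x^e − 1 this norm is θ^(−uD) times an
-- e-th root of unity up to sign, hence not a p-th power, because p divides neither u, D, e nor (q − 1)/d.
--
-- That p ∤ D and that (± f(0))^e = 1 come from Frobenius on F[x]/f: counting roots of Y^(q^r) − Y and of f
-- shows that the conjugates x^(q^i) of x are exactly D in number, so D ∣ k and f(Y) = ∏ (Y − x^(q^i)).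
-- Frobenius also gives squarefreeness of x^e − 1, whence D = k if f ∣ Φ_e.
module Submission where

open import Level using (Level; _⊔_)
open import Algebra.Bundles using (CommutativeRing)
open import Algebra.Structures using (IsCommutativeRing)
import Algebra.Properties.CommutativeMonoid.Sum as CommutativeMonoidSum
import Algebra.Properties.Ring as RingProperties
import Algebra.Properties.Semiring.Mult.TCOptimised as SemiringMult
import Algebra.Solver.Ring as RingSolver
open import Algebra.Solver.Ring.AlmostCommutativeRing using (fromCommutativeRing; _-Raw-AlmostCommutative⟶_)
open import Data.Nat as ℕ using (ℕ; zero; suc; _∸_; _≤_; _<_; z≤n; s≤s)
import Data.Nat.Properties as ℕP
open import Data.Nat.Induction using (<-rec)
open import Data.Integer as ℤ using (ℤ; +_; -[1+_]; _⊖_)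
import Data.Integer.Properties as ℤP
open import Data.Maybe as Maybe using (Maybe)
open import Data.Vec as Vec using (Vec; []; _∷_; _∷ʳ_)
open import Data.Nat.Divisibility using (_∣_; _∣?_; divides; ∣-refl; ∣-trans; ∣⇒≤; ∣m+n∣m⇒∣n; m%n≡0⇒n∣m; n∣m*n; m∣m*n; 0∣⇒≡0; ∣1⇒≡1; *-cancelˡ-∣; *-monoʳ-∣; *-monoˡ-∣; ∣m⇒∣m*n; ∣n⇒∣m*n)
open import Data.Nat.DivMod using (_%_; _/_; m≡m%n+[m/n]*n; m%n<n)
open import Data.Nat.GCD using (gcd; gcd[m,n]∣m; gcd[m,n]∣n; gcd-greatest; gcd[m,n]≡0⇒m≡0; gcd-GCD; module Bézout)
open import Data.Nat.Coprimality as Coprimality using (Coprime; coprime-divisor; coprime⇒gcd≡1; gcd≡1⇒coprime)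
open import Data.Nat.Primality.Factorisation using (factorise; PrimeFactorisation)
open import Data.Nat.Tactic.RingSolver using (solve-∀)
open import Data.Nat.Primality using (Prime; ¬prime[0]; ¬prime[1]; prime[2]; prime⇒nonZero; prime⇒nonTrivial; prime⇒irreducible; euclidsLemma)
open import Data.Nat.ListAction using (product; sum)
open import Data.Nat.ListAction.Properties using (product≢0)
open import Data.List.Relation.Unary.All as All using (All; []; _∷_)
open import Data.Fin as Fin using (Fin; zero; suc)
import Data.Fin.Properties as FinP
open import Data.Fin.Permutation using (permutation; _⟨$⟩ʳ_)
open import Data.List using (List; []; _∷_; [_]; _++_; replicate; map; foldr; concatMap; filter; length; upTo; drop)
import Data.List.Properties as ListP
import Data.List.Relation.Unary.All.Properties as AllP
open import Data.List.Relation.Unary.Any using (here; there)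
open import Data.List.Membership.Propositional using (_∈_)
open import Data.List.Membership.Propositional.Properties using (∈-filter⁺; ∈-filter⁻; ∈-map⁺; ∈-map⁻; ∈-upTo⁺; ∈-upTo⁻)
open import Data.Product using (Σ; ∃; ∃-syntax; _×_; _,_; proj₁; proj₂)
open import Data.Sum using (_⊎_; inj₁; inj₂)
open import Data.Empty using (⊥; ⊥-elim)
open import Relation.Nullary using (¬_; Dec; yes; no)
open import Relation.Binary.Consequences using (dec⇒weaklyDec)
open import Relation.Binary.Definitions using (tri<; tri≈; tri>)
open import Relation.Binary.PropositionalEquality as ≡ using (_≡_)
open import Function using (case_of_)
open import Defs

-- Powers, products and a ring solver in a commutative ring

-- The usual criterion, that x^p - α is irreducible over F(α) unless α is a p-th power, lives in an
-- extension of F. Its substitute is an equation between elements of F,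
-- `x^p l^i = y^p (σ^D f(0))^i`, read off from the two end coefficients of N(a); σ is the product of
-- the p-th roots of unity, that is (-1)^(p-1). Replacing x by x^s keeps both end coefficients of f
-- and multiplies the degree by s. Hence a composite exponent t can be reached one prime at a time,
-- and only the sign σ^(Ds) changes on the way. That sign is where the condition on 8 ∣ n enters. It
-- can spoil the argument only for p = 2 and even s. Then 2s ∣ m gives 4 ∣ m, hence 2 ∣ d and 8 ∣ dm
-- = n, hence 4 ∣ q - 1 and 4 ∣ d, and θ^(d/4) is a square root of -1. Root counting is done over an
-- arbitrary domain, because it is needed over F[x] (additivity of Frobenius) as well as over F[x]/f
-- (conjugates). The quotient is F[x] itself under a coarser equality, so identities of F[x] carry
-- over without conversion.

module IntegerCoefficientSolver {c ℓ} (R : CommutativeRing c ℓ) where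
  open CommutativeRing R
  open SemiringMult semiring using (1+×; ×-homo-+; ×1-homo-*) renaming (_×_ to _×ₙ_)
  open RingProperties ring
  open import Relation.Binary.Reasoning.Setoid setoid

  private
    ⟦_⟧ : ℤ → Carrier
    ⟦ + n ⟧ = n ×ₙ 1#
    ⟦ -[1+ n ] ⟧ = - (suc n ×ₙ 1#)

    homo-neg : ∀ i → ⟦ ℤ.- i ⟧ ≈ - ⟦ i ⟧
    homo-neg (+ zero)  = sym -0#≈0#
    homo-neg (+ suc n) = refl
    homo-neg -[1+ n ]  = sym (-‿involutive _)

    homo-⊖ : ∀ m n → ⟦ m ⊖ n ⟧ ≈ m ×ₙ 1# + - (n ×ₙ 1#)
    homo-⊖ m zero = sym (trans (+-congˡ -0#≈0#) (+-identityʳ _))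
    homo-⊖ zero n@(suc _) = sym (+-identityˡ _)
    homo-⊖ (suc m) (suc n) = begin
      ⟦ suc m ⊖ suc n ⟧  ≡⟨ ≡.cong ⟦_⟧ (ℤP.[1+m]⊖[1+n]≡m⊖n m n) ⟩
      ⟦ m ⊖ n ⟧  ≈⟨ homo-⊖ m n ⟩
      a + - b  ≈⟨ +-congˡ (+-identityˡ _) ⟨
      a + (0# + - b)  ≈⟨ +-congˡ (+-congʳ (-‿inverseʳ 1#)) ⟨
      a + ((1# + - 1#) + - b)  ≈⟨ +-congˡ (+-assoc _ _ _) ⟩
      a + (1# + (- 1# + - b))  ≈⟨ +-assoc _ _ _ ⟨
      (a + 1#) + (- 1# + - b)  ≈⟨ +-cong (+-comm _ _) (-‿+-comm 1# b) ⟩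
      (1# + a) + - (1# + b)  ≈⟨ +-cong (1+× m 1#) (-‿cong (1+× n 1#)) ⟨
      suc m ×ₙ 1# + - (suc n ×ₙ 1#)  ∎
      where a = m ×ₙ 1#
            b = n ×ₙ 1#

    homo-+ : ∀ i j → ⟦ i ℤ.+ j ⟧ ≈ ⟦ i ⟧ + ⟦ j ⟧
    homo-+ (+ m) (+ n)       = ×-homo-+ 1# m n
    homo-+ (+ m) -[1+ n ]    = homo-⊖ m (suc n)
    homo-+ -[1+ m ] (+ n)    = trans (homo-⊖ n (suc m)) (+-comm _ _)
    homo-+ -[1+ m ] -[1+ n ] = trans (-‿cong (trans (reflexive (≡.cong (λ z → suc z ×ₙ 1#) (≡.sym (ℕP.+-suc m n)))) (×-homo-+ 1# (suc m) (suc n)))) (sym (-‿+-comm _ _))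
  
    homo-*-pos : ∀ m n → ⟦ + m ℤ.* + n ⟧ ≈ ⟦ + m ⟧ * ⟦ + n ⟧
    homo-*-pos m n = trans (reflexive (≡.cong ⟦_⟧ (≡.sym (ℤP.pos-* m n)))) (×1-homo-* m n)

    homo-*-posˡ : ∀ m j → ⟦ + m ℤ.* j ⟧ ≈ ⟦ + m ⟧ * ⟦ j ⟧
    homo-*-posˡ m (+ n) = homo-*-pos m n
    homo-*-posˡ m -[1+ n ] = begin
      ⟦ + m ℤ.* -[1+ n ] ⟧       ≡⟨ ≡.cong ⟦_⟧ (≡.sym (ℤP.neg-distribʳ-* (+ m) (+ suc n))) ⟩
      ⟦ ℤ.- (+ m ℤ.* + suc n) ⟧  ≈⟨ homo-neg (+ m ℤ.* + suc n) ⟩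
      - ⟦ + m ℤ.* + suc n ⟧      ≈⟨ -‿cong (homo-*-pos m (suc n)) ⟩
      - (⟦ + m ⟧ * ⟦ + suc n ⟧)  ≈⟨ -‿distribʳ-* _ _ ⟩
      ⟦ + m ⟧ * ⟦ -[1+ n ] ⟧     ∎

    homo-* : ∀ i j → ⟦ i ℤ.* j ⟧ ≈ ⟦ i ⟧ * ⟦ j ⟧
    homo-* (+ m) j = homo-*-posˡ m j
    homo-* -[1+ m ] j = begin
      ⟦ -[1+ m ] ℤ.* j ⟧         ≡⟨ ≡.cong ⟦_⟧ (≡.sym (ℤP.neg-distribˡ-* (+ suc m) j)) ⟩
      ⟦ ℤ.- (+ suc m ℤ.* j) ⟧    ≈⟨ homo-neg (+ suc m ℤ.* j) ⟩
      - ⟦ + suc m ℤ.* j ⟧        ≈⟨ -‿cong (homo-*-posˡ (suc m) j) ⟩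
      - (⟦ + suc m ⟧ * ⟦ j ⟧)    ≈⟨ -‿distribˡ-* _ _ ⟩
      ⟦ -[1+ m ] ⟧ * ⟦ j ⟧       ∎

    -- Every commutative ring receives a homomorphism from the integers. Normal forms with integer
    -- coefficients let opposite terms cancel by a decidable test, although equality in the ring
    -- itself need not be decidable.
    morphism : CommutativeRing.rawRing ℤP.+-*-commutativeRing -Raw-AlmostCommutative⟶ fromCommutativeRing R
    morphism = record
      { ⟦_⟧ = ⟦_⟧ ; +-homo = homo-+ ; *-homo = homo-* ; -‿homo = homo-neg
      ; 0-homo = refl ; 1-homo = refl }

    _≟′_ : ∀ i j → Maybe (⟦ i ⟧ ≈ ⟦ j ⟧)
    i ≟′ j = Maybe.map (λ i≡j → reflexive (≡.cong ⟦_⟧ i≡j)) (dec⇒weaklyDec ℤ._≟_ i j)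

  open RingSolver (CommutativeRing.rawRing ℤP.+-*-commutativeRing) (fromCommutativeRing R) morphism _≟′_ public
    using (solve; con; _:+_; _:*_; _:-_; :-_; _:=_)

-- Depends only on the multiplication and the unit, not on a ring bundle: powers in a ring and in
-- its quotient, which share both, are then definitionally equal. The same holds for `rawProd`.
rawPow : ∀ {a} {A : Set a} → (A → A → A) → A → A → ℕ → A
rawPow _·_ ε x zero    = ε
rawPow _·_ ε x (suc n) = x · rawPow _·_ ε x n

-- ∏_{i=1}^{n} g i
rawProd : ∀ {a} {A : Set a} → (A → A → A) → A → ℕ → (ℕ → A) → A
rawProd _·_ ε zero    g = ε
rawProd _·_ ε (suc n) g = rawProd _·_ ε n g · g (suc n)

module RingKit {c ℓ} (R : CommutativeRing c ℓ) where
  open CommutativeRing R public hiding (zero)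
  open RingProperties ring public
  open IntegerCoefficientSolver R public
  open import Relation.Binary.Reasoning.Setoid setoid

  infixr 8 _^_
  _^_ : Carrier → ℕ → Carrier
  _^_ = rawPow _*_ 1#

  ^-congˡ : ∀ n {x y} → x ≈ y → x ^ n ≈ y ^ n
  ^-congˡ zero    eq = refl
  ^-congˡ (suc n) eq = *-cong eq (^-congˡ n eq)

  ^-congʳ : ∀ x {m n} → m ≡ n → x ^ m ≈ x ^ n
  ^-congʳ x ≡.refl = refl

  x^1≈x : ∀ x → x ^ 1 ≈ x
  x^1≈x x = *-identityʳ x

  1^n≈1 : ∀ n → 1# ^ n ≈ 1#
  1^n≈1 zero    = refl
  1^n≈1 (suc n) = trans (*-identityˡ _) (1^n≈1 n)

  ^-homo-* : ∀ x m n → x ^ (m ℕ.+ n) ≈ x ^ m * x ^ n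
  ^-homo-* x zero    n = sym (*-identityˡ _)
  ^-homo-* x (suc m) n = trans (*-congˡ (^-homo-* x m n)) (sym (*-assoc _ _ _))

  *-interchange : ∀ a b x y → (a * b) * (x * y) ≈ (a * x) * (b * y)
  *-interchange = solve 4 (λ a b x y → (a :* b) :* (x :* y) := (a :* x) :* (b :* y)) refl

  ^-distrib-* : ∀ x y n → (x * y) ^ n ≈ x ^ n * y ^ n
  ^-distrib-* x y zero    = sym (*-identityˡ _)
  ^-distrib-* x y (suc n) = trans (*-congˡ (^-distrib-* x y n)) (*-interchange _ _ _ _)

  ^-assocʳ : ∀ x m n → (x ^ m) ^ n ≈ x ^ (m ℕ.* n)
  ^-assocʳ x zero    n = 1^n≈1 n
  ^-assocʳ x (suc m) n = begin
    (x * x ^ m) ^ n        ≈⟨ ^-distrib-* x (x ^ m) n ⟩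
    x ^ n * (x ^ m) ^ n    ≈⟨ *-congˡ (^-assocʳ x m n) ⟩
    x ^ n * x ^ (m ℕ.* n)  ≈⟨ ^-homo-* x n (m ℕ.* n) ⟨
    x ^ (n ℕ.+ m ℕ.* n)    ∎

  ^-comm : ∀ x m n → (x ^ m) ^ n ≈ (x ^ n) ^ m
  ^-comm x m n = trans (^-assocʳ x m n) (trans (^-congʳ x (ℕP.*-comm m n)) (sym (^-assocʳ x n m)))

  x≈0⇒x^n≈0 : ∀ {x n} → 1 ≤ n → x ≈ 0# → x ^ n ≈ 0#
  x≈0⇒x^n≈0 (s≤s _) x≈0 = trans (*-congʳ x≈0) (zeroˡ _)

  prod : ℕ → (ℕ → Carrier) → Carrier
  prod = rawProd _*_ 1#

  prod-cong : ∀ n {g h : ℕ → Carrier} → (∀ i → 1 ≤ i → i ≤ n → g i ≈ h i) → prod n g ≈ prod n h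
  prod-cong zero    eq = refl
  prod-cong (suc n) eq = *-cong (prod-cong n λ i 1≤i i≤n → eq i 1≤i (ℕP.m≤n⇒m≤1+n i≤n)) (eq (suc n) (s≤s z≤n) ℕP.≤-refl)

  prod-* : ∀ n (g h : ℕ → Carrier) → prod n (λ i → g i * h i) ≈ prod n g * prod n h
  prod-* zero    g h = sym (*-identityˡ _)
  prod-* (suc n) g h = trans (*-congʳ (prod-* n g h)) (*-interchange _ _ _ _)

  prod-^ : ∀ n (g : ℕ → Carrier) e → prod n g ^ e ≈ prod n (λ i → g i ^ e)
  prod-^ zero    g e = 1^n≈1 e
  prod-^ (suc n) g e = trans (^-distrib-* _ _ e) (*-congʳ (prod-^ n g e))

  prod-const : ∀ n x → prod n (λ _ → x) ≈ x ^ n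
  prod-const zero    x = refl
  prod-const (suc n) x = trans (*-congʳ (prod-const n x)) (*-comm _ _)

  prod-1 : ∀ n {g : ℕ → Carrier} → (∀ i → 1 ≤ i → i ≤ n → g i ≈ 1#) → prod n g ≈ 1#
  prod-1 n eq = trans (prod-cong n eq) (trans (prod-const n 1#) (1^n≈1 n))

  prod-+ : ∀ m n (g : ℕ → Carrier) → prod (m ℕ.+ n) g ≈ prod m g * prod n (λ i → g (m ℕ.+ i))
  prod-+ m zero    g = trans (reflexive (≡.cong (λ z → prod z g) (ℕP.+-identityʳ m))) (sym (*-identityʳ _))
  prod-+ m (suc n) g = begin
    prod (m ℕ.+ suc n) g  ≡⟨ ≡.cong (λ z → prod z g) (ℕP.+-suc m n) ⟩
    prod (m ℕ.+ n) g * g (suc (m ℕ.+ n))  ≈⟨ *-cong (prod-+ m n g) (reflexive (≡.cong g (≡.sym (ℕP.+-suc m n)))) ⟩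
    (prod m g * prod n (λ i → g (m ℕ.+ i))) * g (m ℕ.+ suc n) ≈⟨ *-assoc _ _ _ ⟩
    prod m g * (prod n (λ i → g (m ℕ.+ i)) * g (m ℕ.+ suc n)) ∎

  prod-suc : ∀ n (g : ℕ → Carrier) → prod (suc n) g ≈ g 1 * prod n (λ i → g (suc i))
  prod-suc n g = trans (prod-+ 1 n g) (*-congʳ (*-identityˡ _))

  -- The index moves around a cycle of length `n`: the shift loses `g 1` and gains `g (suc n)`. Used
  -- for the invariance of the norm under x ↦ ωx.
  prod-shift : ∀ n (g : ℕ → Carrier) → g (suc n) ≈ g 1 → prod n (λ i → g (suc i)) ≈ prod n g
  prod-shift zero    g eq = refl
  prod-shift (suc n) g eq = begin
    prod n (λ i → g (suc i)) * g (suc (suc n)) ≈⟨ *-congˡ eq ⟩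
    prod n (λ i → g (suc i)) * g 1  ≈⟨ *-comm _ _ ⟩
    g 1 * prod n (λ i → g (suc i))  ≈⟨ prod-suc n g ⟨
    prod (suc n) g  ∎

  x-y≈0⇒x≈y : ∀ {x y} → x - y ≈ 0# → x ≈ y
  x-y≈0⇒x≈y {x} {y} eq = begin
    x  ≈⟨ solve 2 (λ x y → x := (x :- y) :+ y) refl x y ⟩
    x - y + y   ≈⟨ +-congʳ eq ⟩
    0# + y      ≈⟨ +-identityˡ y ⟩
    y  ∎

  x≈y⇒x-y≈0 : ∀ {x y} → x ≈ y → x - y ≈ 0#
  x≈y⇒x-y≈0 {x} {y} eq = trans (+-congʳ eq) (-‿inverseʳ y)

-- Polynomial functions and their roots

NoZeroDivisors : ∀ {c ℓ} → CommutativeRing c ℓ → Set _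
NoZeroDivisors R = ∀ {x y} → x * y ≈ 0# → x ≈ 0# ⊎ y ≈ 0#
  where open CommutativeRing R

module PolynomialFunctions {c ℓ} (R : CommutativeRing c ℓ) where
  open RingKit R
  open import Relation.Binary.Reasoning.Setoid setoid

  eval : ∀ {n} → Vec Carrier n → Carrier → Carrier
  eval []       y = 0#
  eval (a ∷ as) y = a + y * eval as y

  eval-∷ʳ : ∀ {n} (as : Vec Carrier n) a y → eval (as ∷ʳ a) y ≈ eval as y + a * y ^ n
  eval-∷ʳ [] a y = solve 2 (λ a y → a :+ y :* con (ℤ.+ 0) := con (ℤ.+ 0) :+ a :* con (ℤ.+ 1)) refl a y
  eval-∷ʳ {suc n} (b ∷ as) a y = trans (+-congˡ (*-congˡ (eval-∷ʳ as a y)))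
    (solve 5 (λ a y b E P → b :+ y :* (E :+ a :* P) := (b :+ y :* E) :+ a :* (y :* P)) refl a y b (eval as y) (y ^ n))

  -- Polynomials of degree below `n` are handled as functions with a coefficient vector, so that
  -- maps such as `y ↦ (y + b) ^ n - y ^ n` over F[x], or `comp f` over F[x]/f, need no second
  -- polynomial ring.
  DegLT : ℕ → (Carrier → Carrier) → Set _
  DegLT n φ = Σ (Vec Carrier n) λ as → ∀ y → φ y ≈ eval as y

  DegLT-cong : ∀ {n φ ψ} → (∀ y → φ y ≈ ψ y) → DegLT n ψ → DegLT n φ
  DegLT-cong eq (as , ev) = as , λ y → trans (eq y) (ev y)

  DegLT-+ : ∀ {n φ ψ} → DegLT n φ → DegLT n ψ → DegLT n (λ y → φ y + ψ y)
  DegLT-+ (as , ev) (bs , fv) = Vec.zipWith _+_ as bs , λ y → trans (+-cong (ev y) (fv y)) (sym (go as bs y))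
    where
    go : ∀ {n} (as bs : Vec Carrier n) y → eval (Vec.zipWith _+_ as bs) y ≈ eval as y + eval bs y
    go [] [] y = sym (+-identityʳ _)
    go (a ∷ as) (b ∷ bs) y = trans (+-congˡ (*-congˡ (go as bs y)))
      (solve 5 (λ a b y A B → a :+ b :+ y :* (A :+ B) := (a :+ y :* A) :+ (b :+ y :* B)) refl a b y (eval as y) (eval bs y))

  DegLT-* : ∀ {n φ} k → DegLT n φ → DegLT n (λ y → k * φ y)
  DegLT-* k (as , ev) = Vec.map (k *_) as , λ y → trans (*-congˡ (ev y)) (sym (go as y))
    where
    go : ∀ {n} (as : Vec Carrier n) y → eval (Vec.map (k *_) as) y ≈ k * eval as y
    go [] y = sym (zeroʳ k)
    go (a ∷ as) y = trans (+-congˡ (*-congˡ (go as y)))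
      (solve 4 (λ k a y A → k :* a :+ y :* (k :* A) := k :* (a :+ y :* A)) refl k a y (eval as y))

  DegLT-- : ∀ {n φ ψ} → DegLT n φ → DegLT n ψ → DegLT n (λ y → φ y - ψ y)
  DegLT-- {φ = φ} {ψ} P Q = DegLT-cong (λ y → +-congˡ (sym (-1*x≈-x (ψ y)))) (DegLT-+ P (DegLT-* (- 1#) Q))

  DegLT-shift : ∀ {n φ} k → DegLT n φ → DegLT (suc n) (λ y → k + y * φ y)
  DegLT-shift k (as , ev) = k ∷ as , λ y → +-congˡ (*-congˡ (ev y))

  DegLT-weaken : ∀ {n φ} → DegLT n φ → DegLT (suc n) φ
  DegLT-weaken (as , ev) = as ∷ʳ 0# , λ y →
    trans (ev y) (sym (trans (eval-∷ʳ as 0# y) (trans (+-congˡ (zeroˡ _)) (+-identityʳ _))))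

  DegLT-weaken-≤ : ∀ {m n φ} → m ≤ n → DegLT m φ → DegLT n φ
  DegLT-weaken-≤ {m} {n} {φ} m≤n P = go (ℕP.≤⇒≤′ m≤n)
    where
    go : ∀ {n} → m ℕ.≤′ n → DegLT n φ
    go (ℕ.≤′-reflexive ≡.refl) = P
    go (ℕ.≤′-step le) = DegLT-weaken (go le)

  DegLT-0 : ∀ {n} → DegLT n (λ _ → 0#)
  DegLT-0 = DegLT-weaken-≤ z≤n ([] , λ _ → refl)

  DegLT-const : ∀ {n} k → DegLT (suc n) (λ _ → k)
  DegLT-const k = DegLT-cong (λ y → sym (trans (+-congˡ (zeroʳ y)) (+-identityʳ k))) (DegLT-shift k DegLT-0)

  DegLT-^ : ∀ n → DegLT (suc n) (_^ n)
  DegLT-^ zero    = DegLT-const 1#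
  DegLT-^ (suc n) = DegLT-cong (λ y → sym (+-identityˡ _)) (DegLT-shift 0# (DegLT-^ n))

  MonicFun : ℕ → (Carrier → Carrier) → Set _
  MonicFun n φ = DegLT n (λ y → φ y - y ^ n)

  Monic-^-id : ∀ n → 2 ≤ n → MonicFun n (λ y → y ^ n - y)
  Monic-^-id n 2≤n = DegLT-cong
    (λ y → solve 2 (λ P y → P :- y :- P := con (ℤ.- ℤ.+ 1) :* (y :* con (ℤ.+ 1))) refl (y ^ n) y)
    (DegLT-* _ (DegLT-weaken-≤ 2≤n (DegLT-^ 1)))

  Monic-^-const : ∀ n k → 1 ≤ n → MonicFun n (λ y → y ^ n - k)
  Monic-^-const (suc n) k 1≤n = DegLT-cong
    (λ y → solve 2 (λ P k → P :- k :- P := :- k) refl (y ^ suc n) k) (DegLT-const (- k))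

  Monic-prod : ∀ n (ρ : ℕ → Carrier) → MonicFun n (λ y → prod n (λ i → y - ρ i))
  Monic-prod zero ρ = DegLT-cong (λ y → -‿inverseʳ 1#) DegLT-0
  Monic-prod (suc n) ρ = DegLT-cong
    (λ y → solve 4 (λ P Q y r → P :* (y :- r) :- y :* Q := con (ℤ.+ 0) :+ y :* (P :- Q) :+ (:- r :* (P :- Q) :+ :- r :* Q)) refl
      (prod n (λ i → y - ρ i)) (y ^ n) y (ρ (suc n)))
    (DegLT-+ (DegLT-shift 0# (Monic-prod n ρ)) (DegLT-+ (DegLT-* _ (DegLT-weaken (Monic-prod n ρ))) (DegLT-* _ (DegLT-^ n))))

  -- Only the cancellation of the leading terms matters, so an induction on `n` replaces the
  -- binomial theorem.
  DegLT-binomial : ∀ n b → DegLT n (λ y → (y + b) ^ n - y ^ n)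
  DegLT-binomial zero b = DegLT-cong (λ y → -‿inverseʳ 1#) DegLT-0
  DegLT-binomial (suc n) b = DegLT-cong
    (λ y → solve 4 (λ P Q y b → (y :+ b) :* P :- y :* Q := con (ℤ.+ 0) :+ y :* (P :- Q) :+ (b :* (P :- Q) :+ b :* Q)) refl
      ((y + b) ^ n) (y ^ n) y b)
    (DegLT-+ (DegLT-shift 0# ih) (DegLT-+ (DegLT-* b (DegLT-weaken ih)) (DegLT-* b (DegLT-^ n))))
    where
    ih = DegLT-binomial n b

  -- Coefficients of the quotient of a + Y * eval as Y by Y - r, for any a.
  quotient : ∀ {n} → Carrier → Vec Carrier n → Vec Carrier n
  quotient r []       = []
  quotient r (a ∷ as) = eval (a ∷ as) r ∷ quotient r as

  quotient-eval : ∀ {n} a (as : Vec Carrier n) r y →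
    eval (a ∷ as) y ≈ (y - r) * eval (quotient r as) y + eval (a ∷ as) r
  quotient-eval a [] r y = solve 3 (λ a r y → a :+ y :* con (ℤ.+ 0) := (y :- r) :* con (ℤ.+ 0) :+ (a :+ r :* con (ℤ.+ 0))) refl a r y
  quotient-eval a (b ∷ as) r y = trans (+-congˡ (*-congˡ (quotient-eval b as r y)))
    (solve 5 (λ a r y E Q → a :+ y :* ((y :- r) :* Q :+ E) := (y :- r) :* (E :+ y :* Q) :+ (a :+ r :* E)) refl
      a r y (eval (b ∷ as) r) (eval (quotient r as) y))

  AllZero : ∀ {n} → Vec Carrier n → Set _
  AllZero as = ∀ i → Vec.lookup as i ≈ 0#

  AllZero-eval : ∀ {n} (as : Vec Carrier n) → AllZero as → ∀ y → eval as y ≈ 0#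
  AllZero-eval [] z y = refl
  AllZero-eval (a ∷ as) z y = trans (+-cong (z zero) (trans (*-congˡ (AllZero-eval as (λ i → z (suc i)) y)) (zeroʳ y))) (+-identityʳ 0#)

  AllZero-∷ : ∀ {n} a (as : Vec Carrier n) r → eval (a ∷ as) r ≈ 0# → AllZero as → AllZero (a ∷ as)
  AllZero-∷ a as r e z zero = trans (sym (trans (+-congˡ (trans (*-congˡ (AllZero-eval as z r)) (zeroʳ r))) (+-identityʳ a))) e
  AllZero-∷ a as r e z (suc i) = z i

  -- The entries of `quotient` are the partial values of Horner's scheme; when all of them vanish,
  -- the coefficients are recovered as zero from the top one downwards.
  AllZero-quotient : ∀ {n} (as : Vec Carrier n) r → AllZero (quotient r as) → AllZero as
  AllZero-quotient [] r z = λ ()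
  AllZero-quotient (a ∷ as) r z = AllZero-∷ a as r (z zero) (AllZero-quotient as r (λ i → z (suc i)))

  module _ (noZeroDivisors : NoZeroDivisors R) where

    -- Split off the first root by synthetic division. In a domain the remaining roots, being
    -- different from it, are roots of the quotient, which has one coefficient fewer.
    manyRoots⇒AllZero : ∀ {n} (as : Vec Carrier n) (ρ : Fin n → Carrier) →
      (∀ {i j} → ρ i ≈ ρ j → i ≡ j) → (∀ i → eval as (ρ i) ≈ 0#) → AllZero as
    manyRoots⇒AllZero [] ρ inj root = λ ()
    manyRoots⇒AllZero (a ∷ as) ρ inj root = AllZero-∷ a as r (root zero) (AllZero-quotient as r
      (manyRoots⇒AllZero (quotient r as) (λ i → ρ (suc i)) (λ eq → FinP.suc-injective (inj eq)) root′))
      where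
      r = ρ zero
      root′ : ∀ i → eval (quotient r as) (ρ (suc i)) ≈ 0#
      root′ i with noZeroDivisors (begin
        (ρ (suc i) - r) * eval (quotient r as) (ρ (suc i))  ≈⟨ +-identityʳ _ ⟨
        (ρ (suc i) - r) * eval (quotient r as) (ρ (suc i)) + 0#  ≈⟨ +-congˡ (root zero) ⟨
        (ρ (suc i) - r) * eval (quotient r as) (ρ (suc i)) + eval (a ∷ as) r      ≈⟨ quotient-eval a as r _ ⟨
        eval (a ∷ as) (ρ (suc i))  ≈⟨ root (suc i) ⟩
        0# ∎)
      ... | inj₂ z = z
      ... | inj₁ z with () ← inj (x-y≈0⇒x≈y z)

    DegLT-manyRoots : ∀ {n φ} → DegLT n φ → (ρ : Fin n → Carrier) →
      (∀ {i j} → ρ i ≈ ρ j → i ≡ j) → (∀ i → φ (ρ i) ≈ 0#) → ∀ y → φ y ≈ 0#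
    DegLT-manyRoots (as , ev) ρ inj root y =
      trans (ev y) (AllZero-eval as (manyRoots⇒AllZero as ρ inj (λ i → trans (sym (ev _)) (root i))) y)

    -- The leading coefficient 1 would have to vanish along with the others. The conclusion is an
    -- equation because the ring is not assumed nontrivial.
    Monic-tooManyRoots : ∀ {n φ} → MonicFun n φ → (ρ : Fin (suc n) → Carrier) →
      (∀ {i j} → ρ i ≈ ρ j → i ≡ j) → (∀ i → φ (ρ i) ≈ 0#) → 1# ≈ 0#
    Monic-tooManyRoots {n} {φ} (as , ev) ρ inj root =
      trans (reflexive (≡.sym (lookup-last as))) (manyRoots⇒AllZero (as ∷ʳ 1#) ρ inj (λ i → trans (sym (ev′ (ρ i))) (root i)) (Fin.fromℕ n))
      where
      lookup-last : ∀ {m} (as : Vec Carrier m) → Vec.lookup (as ∷ʳ 1#) (Fin.fromℕ m) ≡ 1#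
      lookup-last [] = ≡.refl
      lookup-last (_ ∷ as) = lookup-last as
      ev′ : ∀ y → φ y ≈ eval (as ∷ʳ 1#) y
      ev′ y = begin
        φ y  ≈⟨ solve 2 (λ p q → p := (p :- q) :+ con (ℤ.+ 1) :* q) refl (φ y) (y ^ n) ⟩
        (φ y - y ^ n) + 1# * y ^ n ≈⟨ +-congʳ (ev y) ⟩
        eval as y + 1# * y ^ n   ≈⟨ eval-∷ʳ as 1# y ⟨
        eval (as ∷ʳ 1#) y        ∎

    prod-root : ∀ n {g : ℕ → Carrier} i → 1 ≤ i → i ≤ n → g i ≈ 0# → prod n g ≈ 0#
    prod-root zero i 1≤i i≤n eq = ⊥-elim (ℕP.<-irrefl ≡.refl (ℕP.≤-trans 1≤i i≤n))
    prod-root (suc n) i 1≤i i≤n eq with i ℕ.≟ suc n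
    ... | yes ≡.refl = trans (*-congˡ eq) (zeroʳ _)
    ... | no i≢ = trans (*-congʳ (prod-root n i 1≤i (ℕ.s≤s⁻¹ (ℕP.≤∧≢⇒< i≤n i≢)) eq)) (zeroˡ _)

    -- The difference of the two monic functions has degree below `n` and still vanishes at the `n`
    -- distinct points.
    Monic-splits : ∀ {n φ} → MonicFun n φ → (ρ : ℕ → Carrier) →
      (∀ {i j} → 1 ≤ i → i ≤ n → 1 ≤ j → j ≤ n → ρ i ≈ ρ j → i ≡ j) →
      (∀ i → 1 ≤ i → i ≤ n → φ (ρ i) ≈ 0#) → ∀ y → φ y ≈ prod n (λ i → y - ρ i)
    Monic-splits {n} {φ} M ρ inj root y = x-y≈0⇒x≈y (DegLT-manyRoots
      (DegLT-cong (λ y → solve 3 (λ p q Y → p :- q := (p :- Y) :- (q :- Y)) refl (φ y) (prod n (λ i → y - ρ i)) (y ^ n)) (DegLT-- M (Monic-prod n ρ)))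
      (λ i → ρ (suc (Fin.toℕ i)))
      (λ {i} {j} eq → FinP.toℕ-injective (ℕP.suc-injective (inj (s≤s z≤n) (FinP.toℕ<n i) (s≤s z≤n) (FinP.toℕ<n j) eq)))
      (λ i → trans (+-cong (root _ (s≤s z≤n) (FinP.toℕ<n i)) (-‿cong (prod-root n _ (s≤s z≤n) (FinP.toℕ<n i) (-‿inverseʳ _)))) (-‿inverseʳ 0#))
      y)

-- The ring F[x] and its quotients

module PolynomialRing {c ℓ} (F : Field c ℓ) (q : ℕ) (card : HasCardinality F q) where
  open RingKit (Field.commutativeRing F)
  open Poly F q card
  open import Relation.Binary.Reasoning.Setoid setoid

  -- ≈ₚ wrapped in a record, so that Agda can infer the two polynomials from an equation.
  infix 4 _≋_
  record _≋_ (p r : Pol) : Set ℓ where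
    constructor mk
    field at : p ≈ₚ r
  open _≋_ public

  ≋-refl : ∀ {p} → p ≋ p
  ≋-refl = mk λ i → refl

  ≋-sym : ∀ {p r} → p ≋ r → r ≋ p
  ≋-sym eq = mk λ i → sym (at eq i)

  ≋-trans : ∀ {p r s} → p ≋ r → r ≋ s → p ≋ s
  ≋-trans eq eq′ = mk λ i → trans (at eq i) (at eq′ i)

  coeff-+ : ∀ p r i → coeff (p +ₚ r) i ≈ coeff p i + coeff r i
  coeff-+ []      r       i       = sym (+-identityˡ _)
  coeff-+ (a ∷ p) []      i       = sym (+-identityʳ _)
  coeff-+ (a ∷ p) (b ∷ r) zero    = refl
  coeff-+ (a ∷ p) (b ∷ r) (suc i) = coeff-+ p r i

  coeff-scale : ∀ a p i → coeff (scale a p) i ≈ a * coeff p i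
  coeff-scale a []      i       = sym (zeroʳ a)
  coeff-scale a (b ∷ p) zero    = refl
  coeff-scale a (b ∷ p) (suc i) = coeff-scale a p i

  infix 8 -ₚ_
  -ₚ_ : Pol → Pol
  -ₚ p = map (λ a → - a) p

  coeff-neg : ∀ p i → coeff (-ₚ p) i ≈ - coeff p i
  coeff-neg []      i       = sym -0#≈0#
  coeff-neg (b ∷ p) zero    = refl
  coeff-neg (b ∷ p) (suc i) = coeff-neg p i

  +ₚ-cong : ∀ {p p′ r r′} → p ≋ p′ → r ≋ r′ → p +ₚ r ≋ p′ +ₚ r′
  +ₚ-cong {p} {p′} {r} {r′} e f = mk λ i → trans (coeff-+ p r i) (trans (+-cong (at e i) (at f i)) (sym (coeff-+ p′ r′ i)))

  scale-cong : ∀ {a b p r} → a ≈ b → p ≋ r → scale a p ≋ scale b r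
  scale-cong {a} {b} {p} {r} e f = mk λ i → trans (coeff-scale a p i) (trans (*-cong e (at f i)) (sym (coeff-scale b r i)))

  -ₚ-cong : ∀ {p r} → p ≋ r → -ₚ p ≋ -ₚ r
  -ₚ-cong {p} {r} f = mk λ i → trans (coeff-neg p i) (trans (-‿cong (at f i)) (sym (coeff-neg r i)))

  ∷-cong : ∀ {a b p r} → a ≈ b → p ≋ r → a ∷ p ≋ b ∷ r
  ∷-cong e f = mk λ { zero → e ; (suc i) → at f i }

  tail-cong : ∀ {a b p r} → a ∷ p ≋ b ∷ r → p ≋ r
  tail-cong e = mk λ i → at e (suc i)

  0∷[]≋[] : [ 0# ] ≋ []
  0∷[]≋[] = mk λ { zero → refl ; (suc i) → refl }

  ∷≋[] : ∀ {a p} → a ≈ 0# → p ≋ [] → a ∷ p ≋ []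
  ∷≋[] e f = ≋-trans (∷-cong e f) 0∷[]≋[]

  +ₚ-assoc : ∀ p r s → (p +ₚ r) +ₚ s ≋ p +ₚ (r +ₚ s)
  +ₚ-assoc p r s = mk λ i → begin
    coeff ((p +ₚ r) +ₚ s) i  ≈⟨ trans (coeff-+ (p +ₚ r) s i) (+-congʳ (coeff-+ p r i)) ⟩
    (coeff p i + coeff r i) + coeff s i ≈⟨ +-assoc _ _ _ ⟩
    coeff p i + (coeff r i + coeff s i) ≈⟨ trans (coeff-+ p (r +ₚ s) i) (+-congˡ (coeff-+ r s i)) ⟨
    coeff (p +ₚ (r +ₚ s)) i  ∎

  +ₚ-comm : ∀ p r → p +ₚ r ≋ r +ₚ p
  +ₚ-comm p r = mk λ i → trans (coeff-+ p r i) (trans (+-comm _ _) (sym (coeff-+ r p i)))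

  +ₚ-identityʳ : ∀ p → p +ₚ [] ≋ p
  +ₚ-identityʳ p = mk λ i → trans (coeff-+ p [] i) (+-identityʳ _)

  +ₚ-inverseʳ : ∀ p → p +ₚ -ₚ p ≋ []
  +ₚ-inverseʳ p = mk λ i → trans (coeff-+ p (-ₚ p) i) (trans (+-congˡ (coeff-neg p i)) (-‿inverseʳ _))

  coeff-*-suc : ∀ a p s i → coeff ((a ∷ p) *ₚ s) (suc i) ≈ a * coeff s (suc i) + coeff (p *ₚ s) i
  coeff-*-suc a p s i = trans (coeff-+ (scale a s) _ (suc i)) (+-congʳ (coeff-scale a s (suc i)))

  coeff-*-0 : ∀ p s → coeff (p *ₚ s) 0 ≈ coeff p 0 * coeff s 0
  coeff-*-0 []      s = sym (zeroˡ _)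
  coeff-*-0 (a ∷ p) s = trans (coeff-+ (scale a s) (0# ∷ p *ₚ s) 0) (trans (+-identityʳ _) (coeff-scale a s 0))

  *ₚ-distribʳ-+ₚ : ∀ s p r → (p +ₚ r) *ₚ s ≋ p *ₚ s +ₚ r *ₚ s
  *ₚ-distribʳ-+ₚ s [] r = ≋-refl
  *ₚ-distribʳ-+ₚ s (a ∷ p) [] = ≋-sym (+ₚ-identityʳ _)
  *ₚ-distribʳ-+ₚ s (a ∷ p) (b ∷ r) = mk λ where
    zero → trans (coeff-*-0 ((a + b) ∷ p +ₚ r) s) (trans (distribʳ _ a b)
             (sym (trans (coeff-+ ((a ∷ p) *ₚ s) _ 0) (+-cong (coeff-*-0 (a ∷ p) s) (coeff-*-0 (b ∷ r) s)))))
    (suc i) → begin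
      coeff (((a + b) ∷ p +ₚ r) *ₚ s) (suc i)
        ≈⟨ coeff-*-suc (a + b) (p +ₚ r) s i ⟩
      (a + b) * coeff s (suc i) + coeff ((p +ₚ r) *ₚ s) i
        ≈⟨ +-congˡ (trans (at (*ₚ-distribʳ-+ₚ s p r) i) (coeff-+ (p *ₚ s) _ i)) ⟩
      (a + b) * coeff s (suc i) + (coeff (p *ₚ s) i + coeff (r *ₚ s) i)
        ≈⟨ solve 5 (λ a b s x y → (a :+ b) :* s :+ (x :+ y) := (a :* s :+ x) :+ (b :* s :+ y)) refl _ _ _ _ _ ⟩
      (a * coeff s (suc i) + coeff (p *ₚ s) i) + (b * coeff s (suc i) + coeff (r *ₚ s) i)
        ≈⟨ trans (coeff-+ ((a ∷ p) *ₚ s) _ (suc i)) (+-cong (coeff-*-suc a p s i) (coeff-*-suc b r s i)) ⟨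
      coeff ((a ∷ p) *ₚ s +ₚ (b ∷ r) *ₚ s) (suc i) ∎

  *ₚ-zeroʳ : ∀ p → p *ₚ [] ≋ []
  *ₚ-zeroʳ [] = ≋-refl
  *ₚ-zeroʳ (a ∷ p) = ∷≋[] refl (*ₚ-zeroʳ p)

  *ₚ-∷ʳ : ∀ p b r → p *ₚ (b ∷ r) ≋ scale b p +ₚ (0# ∷ p *ₚ r)
  *ₚ-∷ʳ [] b r = ≋-sym 0∷[]≋[]
  *ₚ-∷ʳ (a ∷ p) b r = mk λ where
    zero → +-congʳ (*-comm a b)
    (suc i) → begin
      coeff ((a ∷ p) *ₚ (b ∷ r)) (suc i)  ≈⟨ coeff-*-suc a p (b ∷ r) i ⟩
      a * coeff r i + coeff (p *ₚ (b ∷ r)) i  ≈⟨ +-congˡ (trans (at (*ₚ-∷ʳ p b r) i) (coeff-+ (scale b p) _ i)) ⟩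
      a * coeff r i + (coeff (scale b p) i + coeff (0# ∷ p *ₚ r) i) ≈⟨ +-congʳ (sym (coeff-scale a r i)) ⟩
      coeff (scale a r) i + (coeff (scale b p) i + coeff (0# ∷ p *ₚ r) i) ≈⟨ solve 3 (λ x y z → x :+ (y :+ z) := y :+ (x :+ z)) refl _ _ _ ⟩
      coeff (scale b p) i + (coeff (scale a r) i + coeff (0# ∷ p *ₚ r) i) ≈⟨ trans (coeff-+ (scale b p) _ i) (+-congˡ (coeff-+ (scale a r) _ i)) ⟨
      coeff (scale b p +ₚ (a ∷ p) *ₚ r) i  ∎

  *ₚ-comm : ∀ p r → p *ₚ r ≋ r *ₚ p
  *ₚ-comm [] r = ≋-sym (*ₚ-zeroʳ r)
  *ₚ-comm (a ∷ p) r = ≋-trans (+ₚ-cong ≋-refl (∷-cong refl (*ₚ-comm p r))) (≋-sym (*ₚ-∷ʳ r a p))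

  *ₚ-zeroˡ : ∀ {p} r → p ≋ [] → p *ₚ r ≋ []
  *ₚ-zeroˡ {[]} r e = ≋-refl
  *ₚ-zeroˡ {a ∷ p} r e = +ₚ-cong scale-0 (∷≋[] refl (*ₚ-zeroˡ {p} r (mk λ i → at e (suc i))))
    where
    scale-0 : scale a r ≋ []
    scale-0 = mk λ i → trans (coeff-scale a r i) (trans (*-congʳ (at e 0)) (zeroˡ _))

  *ₚ-congʳ : ∀ {p p′} r → p ≋ p′ → p *ₚ r ≋ p′ *ₚ r
  *ₚ-congʳ {[]} {p′} r e = ≋-sym (*ₚ-zeroˡ r (≋-sym e))
  *ₚ-congʳ {a ∷ p} {[]} r e = *ₚ-zeroˡ r e
  *ₚ-congʳ {a ∷ p} {b ∷ p′} r e = +ₚ-cong (scale-cong (at e 0) ≋-refl) (∷-cong refl (*ₚ-congʳ r (tail-cong e)))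

  *ₚ-cong : ∀ {p p′ r r′} → p ≋ p′ → r ≋ r′ → p *ₚ r ≋ p′ *ₚ r′
  *ₚ-cong {p} {p′} {r} {r′} e f =
    ≋-trans (*ₚ-congʳ r e) (≋-trans (*ₚ-comm p′ r) (≋-trans (*ₚ-congʳ p′ f) (*ₚ-comm r′ p′)))

  scale-*ₚ : ∀ a p s → scale a p *ₚ s ≋ scale a (p *ₚ s)
  scale-*ₚ a [] s = ≋-refl
  scale-*ₚ a (b ∷ p) s = mk λ where
    zero → trans (coeff-*-0 (scale a (b ∷ p)) s) (trans (*-assoc a b _) (sym (trans (coeff-scale a ((b ∷ p) *ₚ s) 0) (*-congˡ (coeff-*-0 (b ∷ p) s)))))
    (suc i) → begin
      coeff (scale a (b ∷ p) *ₚ s) (suc i)  ≈⟨ coeff-*-suc (a * b) (scale a p) s i ⟩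
      (a * b) * coeff s (suc i) + coeff (scale a p *ₚ s) i       ≈⟨ +-congˡ (trans (at (scale-*ₚ a p s) i) (coeff-scale a (p *ₚ s) i)) ⟩
      (a * b) * coeff s (suc i) + a * coeff (p *ₚ s) i  ≈⟨ solve 4 (λ a b x y → (a :* b) :* x :+ a :* y := a :* (b :* x :+ y)) refl _ _ _ _ ⟩
      a * (b * coeff s (suc i) + coeff (p *ₚ s) i)  ≈⟨ trans (coeff-scale a ((b ∷ p) *ₚ s) (suc i)) (*-congˡ (coeff-*-suc b p s i)) ⟨
      coeff (scale a ((b ∷ p) *ₚ s)) (suc i)  ∎

  0∷-*ₚ : ∀ p s → (0# ∷ p) *ₚ s ≋ 0# ∷ p *ₚ s
  0∷-*ₚ p s = mk λ where
    zero → trans (coeff-*-0 (0# ∷ p) s) (zeroˡ _)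
    (suc i) → trans (coeff-*-suc 0# p s i) (trans (+-congʳ (zeroˡ _)) (+-identityˡ _))

  *ₚ-assoc : ∀ p r s → (p *ₚ r) *ₚ s ≋ p *ₚ (r *ₚ s)
  *ₚ-assoc [] r s = ≋-refl
  *ₚ-assoc (a ∷ p) r s = ≋-trans (*ₚ-distribʳ-+ₚ s (scale a r) (0# ∷ p *ₚ r))
    (+ₚ-cong (scale-*ₚ a r s) (≋-trans (0∷-*ₚ (p *ₚ r) s) (∷-cong refl (*ₚ-assoc p r s))))

  [_]*ₚ : ∀ a p → [ a ] *ₚ p ≋ scale a p
  [ a ]*ₚ p = mk λ i → trans (coeff-+ (scale a p) [ 0# ] i) (trans (+-congˡ (at 0∷[]≋[] i)) (+-identityʳ _))

  *ₚ-identityˡ : ∀ p → oneP *ₚ p ≋ p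
  *ₚ-identityˡ p = ≋-trans ([ 1# ]*ₚ p) (mk λ i → trans (coeff-scale 1# p i) (*-identityˡ _))

  -- Opaque copies of the operations: as neutral terms they let Agda infer the operands.
  opaque
    infixl 6 _⊕_
    infixl 7 _⊗_
    _⊕_ _⊗_ : Pol → Pol → Pol
    _⊕_ = _+ₚ_
    _⊗_ = _*ₚ_

    ⊝_ : Pol → Pol
    ⊝_ = -ₚ_

    ⊕≡+ₚ : ∀ p r → p ⊕ r ≡ p +ₚ r
    ⊕≡+ₚ p r = ≡.refl

    ⊗≡*ₚ : ∀ p r → p ⊗ r ≡ p *ₚ r
    ⊗≡*ₚ p r = ≡.refl

    coeff-⊕ : ∀ p r i → coeff (p ⊕ r) i ≈ coeff p i + coeff r i
    coeff-⊕ = coeff-+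

    coeff-⊝ : ∀ p i → coeff (⊝ p) i ≈ - coeff p i
    coeff-⊝ = coeff-neg

    [_]⊗ : ∀ a p → [ a ] ⊗ p ≋ scale a p
    [_]⊗ = [_]*ₚ

    ∷-⊗ : ∀ a p r → (a ∷ p) ⊗ r ≋ scale a r ⊕ (0# ∷ p ⊗ r)
    ∷-⊗ a p r = ≋-refl

    isCommutativeRing′ : IsCommutativeRing _≋_ _⊕_ _⊗_ ⊝_ [] oneP
    isCommutativeRing′ = record
      { isRing = record
        { +-isAbelianGroup = record
          { isGroup = record
            { isMonoid = record
              { isSemigroup = record
                { isMagma = record
                  { isEquivalence = record { refl = ≋-refl ; sym = ≋-sym ; trans = ≋-trans }
                  ; ∙-cong = +ₚ-cong }
                ; assoc = +ₚ-assoc }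
              ; identity = (λ p → ≋-refl) , +ₚ-identityʳ }
            ; inverse = (λ p → ≋-trans (+ₚ-comm _ p) (+ₚ-inverseʳ p)) , +ₚ-inverseʳ
            ; ⁻¹-cong = -ₚ-cong }
          ; comm = +ₚ-comm }
        ; *-cong = *ₚ-cong
        ; *-assoc = *ₚ-assoc
        ; *-identity = *ₚ-identityˡ , λ p → ≋-trans (*ₚ-comm p oneP) (*ₚ-identityˡ p)
        ; distrib = (λ s p r → ≋-trans (*ₚ-comm s _) (≋-trans (*ₚ-distribʳ-+ₚ s p r) (+ₚ-cong (*ₚ-comm p s) (*ₚ-comm r s))))
                  , *ₚ-distribʳ-+ₚ }
      ; *-comm = *ₚ-comm }

  polynomialRing : CommutativeRing c ℓ
  polynomialRing = record { isCommutativeRing = isCommutativeRing′ }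

module PrincipalQuotient {c ℓ} (R : CommutativeRing c ℓ) (f : CommutativeRing.Carrier R) where
  open RingKit R

  infix 4 _∼_
  -- Congruence keeps its quotient as a witness. Carrier and operations stay those of the ring, so
  -- the quotient ring differs only in its equality.
  record _∼_ (a b : Carrier) : Set (c ⊔ ℓ) where
    constructor mod
    field
      quot : Carrier
      eq   : a ≈ b + quot * f

  ≈⇒∼ : ∀ {a b} → a ≈ b → a ∼ b
  ≈⇒∼ {a} {b} a≈b = mod 0# (trans a≈b (solve 2 (λ b f → b := b :+ con (ℤ.+ 0) :* f) refl b f))

  ∼-sym : ∀ {a b} → a ∼ b → b ∼ a
  ∼-sym {a} {b} (mod k eq) = mod (- k) (trans (solve 3 (λ b k f → b := (b :+ k :* f) :+ :- k :* f) refl b k f) (+-congʳ (sym eq)))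

  ∼-trans : ∀ {a b d} → a ∼ b → b ∼ d → a ∼ d
  ∼-trans {a} {b} {d} (mod k eq) (mod l eq′) = mod (k + l)
    (trans eq (trans (+-congʳ eq′) (solve 4 (λ d k l f → (d :+ l :* f) :+ k :* f := d :+ (k :+ l) :* f) refl d k l f)))

  ∼-+-cong : ∀ {a a′ b b′} → a ∼ a′ → b ∼ b′ → a + b ∼ a′ + b′
  ∼-+-cong {a} {a′} {b} {b′} (mod k eq) (mod l eq′) = mod (k + l)
    (trans (+-cong eq eq′) (solve 5 (λ a b k l f → (a :+ k :* f) :+ (b :+ l :* f) := (a :+ b) :+ (k :+ l) :* f) refl a′ b′ k l f))

  ∼-*-cong : ∀ {a a′ b b′} → a ∼ a′ → b ∼ b′ → a * b ∼ a′ * b′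
  ∼-*-cong {a} {a′} {b} {b′} (mod k eq) (mod l eq′) = mod (k * b′ + a′ * l + k * l * f)
    (trans (*-cong eq eq′) (solve 5 (λ a b k l f → (a :+ k :* f) :* (b :+ l :* f) := (a :* b) :+ (k :* b :+ a :* l :+ k :* l :* f) :* f) refl a′ b′ k l f))

  ∼-neg-cong : ∀ {a b} → a ∼ b → - a ∼ - b
  ∼-neg-cong {a} {b} (mod k eq) = mod (- k) (trans (-‿cong eq) (solve 3 (λ b k f → :- (b :+ k :* f) := :- b :+ :- k :* f) refl b k f))

  quotientRing : CommutativeRing c (c ⊔ ℓ)
  quotientRing = record
    { Carrier = Carrier ; _≈_ = _∼_ ; _+_ = _+_ ; _*_ = _*_ ; -_ = -_ ; 0# = 0# ; 1# = 1#
    ; isCommutativeRing = record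
      { isRing = record
        { +-isAbelianGroup = record
          { isGroup = record
            { isMonoid = record
              { isSemigroup = record
                { isMagma = record
                  { isEquivalence = record { refl = ≈⇒∼ refl ; sym = ∼-sym ; trans = ∼-trans }
                  ; ∙-cong = ∼-+-cong }
                ; assoc = λ x y z → ≈⇒∼ (+-assoc x y z) }
              ; identity = (λ x → ≈⇒∼ (+-identityˡ x)) , λ x → ≈⇒∼ (+-identityʳ x) }
            ; inverse = (λ x → ≈⇒∼ (-‿inverseˡ x)) , λ x → ≈⇒∼ (-‿inverseʳ x)
            ; ⁻¹-cong = ∼-neg-cong }
          ; comm = λ x y → ≈⇒∼ (+-comm x y) }
        ; *-cong = ∼-*-cong
        ; *-assoc = λ x y z → ≈⇒∼ (*-assoc x y z)
        ; *-identity = (λ x → ≈⇒∼ (*-identityˡ x)) , λ x → ≈⇒∼ (*-identityʳ x)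
        ; distrib = (λ x y z → ≈⇒∼ (distribˡ x y z)) , λ x y z → ≈⇒∼ (distribʳ x y z) }
      ; *-comm = λ x y → ≈⇒∼ (*-comm x y) }
    }

  ∼0⇒multiple : ∀ {a} → a ∼ 0# → ∃ λ k → a ≈ k * f
  ∼0⇒multiple (mod k eq) = k , trans eq (+-identityˡ _)

  multiple⇒∼0 : ∀ {a} k → a ≈ k * f → a ∼ 0#
  multiple⇒∼0 k eq = mod k (trans eq (sym (+-identityˡ _)))

-- Degree, division and primality

module PolynomialArithmetic {c ℓ} (F : Field c ℓ) (q : ℕ) (card : HasCardinality F q) where
  module F = RingKit (Field.commutativeRing F)
  open Field F public using (_⁻¹; 0≉1; ⁻¹-inverse)
  open Poly F q card public
  open PolynomialRing F q card public
  open RingKit polynomialRing public hiding (-_; _-_)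
  open RingKit polynomialRing using (-_; _-_)
  module ≋-Reasoning where
    open import Relation.Binary.Reasoning.Setoid setoid public

  F-noZeroDivisors : NoZeroDivisors (Field.commutativeRing F)
  F-noZeroDivisors {x} {y} xy≈0 with x ≈? F.0#
  ... | yes x≈0 = inj₁ x≈0
  ... | no  x≉0 = inj₂ (begin
    y  ≈⟨ F.*-identityˡ y ⟨
    F.1# F.* y  ≈⟨ F.*-congʳ (⁻¹-inverse x x≉0) ⟨
    (x F.* x ⁻¹) F.* y      ≈⟨ F.solve 3 (λ x y z → (x F.:* z) F.:* y F.:= z F.:* (x F.:* y)) F.refl x y (x ⁻¹) ⟩
    x ⁻¹ F.* (x F.* y)      ≈⟨ F.*-congˡ xy≈0 ⟩
    x ⁻¹ F.* F.0#  ≈⟨ F.zeroʳ _ ⟩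
    F.0#  ∎)
    where open import Relation.Binary.Reasoning.Setoid F.setoid

  *-≉0 : ∀ {x y} → ¬ x F.≈ F.0# → ¬ y F.≈ F.0# → ¬ x F.* y F.≈ F.0#
  *-≉0 x≉0 y≉0 eq with F-noZeroDivisors eq
  ... | inj₁ z = x≉0 z
  ... | inj₂ z = y≉0 z

  1≉0 : ¬ F.1# F.≈ F.0#
  1≉0 eq = 0≉1 (F.sym eq)

  ^-≉0 : ∀ {x} n → ¬ x F.≈ F.0# → ¬ x F.^ n F.≈ F.0#
  ^-≉0 zero    x≉0 = 1≉0
  ^-≉0 (suc n) x≉0 = *-≉0 x≉0 (^-≉0 n x≉0)

  -- Degree and leading coefficient as a relation: coefficient lists may end in zeros, and the zero
  -- polynomial, which satisfies no instance, needs no convention.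
  record Lead (p : Pol) (n : ℕ) (l : F.Carrier) : Set ℓ where
    field
      leading : coeff p n F.≈ l
      nonzero : ¬ l F.≈ F.0#
      above   : ∀ i → n < i → coeff p i F.≈ F.0#
  open Lead public

  Lead-cong : ∀ {p r n l} → p ≋ r → Lead p n l → Lead r n l
  Lead-cong e L = record
    { leading = F.trans (F.sym (at e _)) (leading L) ; nonzero = nonzero L
    ; above = λ i lt → F.trans (F.sym (at e i)) (above L i lt) }

  Lead-≈ : ∀ {p n l l′} → l F.≈ l′ → Lead p n l → Lead p n l′
  Lead-≈ e L = record
    { leading = F.trans (leading L) e ; nonzero = λ z → nonzero L (F.trans e z) ; above = above L }

  Lead-unique : ∀ {p r n m l l′} → p ≋ r → Lead p n l → Lead r m l′ → n ≡ m × l F.≈ l′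
  Lead-unique {n = n} {m} e L M with ℕP.<-cmp n m
  ... | tri< n<m _ _ = ⊥-elim (nonzero M (F.trans (F.sym (leading M)) (F.trans (F.sym (at e m)) (above L m n<m))))
  ... | tri≈ _ ≡.refl _ = ≡.refl , F.trans (F.sym (leading L)) (F.trans (at e n) (leading M))
  ... | tri> _ _ m<n = ⊥-elim (nonzero L (F.trans (F.sym (leading L)) (F.trans (at e n) (above M n m<n))))

  Lead⇒≉0 : ∀ {p n l} → Lead p n l → ¬ p ≋ []
  Lead⇒≉0 L e = nonzero L (F.trans (F.sym (leading L)) (at e _))

  Lead-∷ : ∀ {a p n l} → Lead p n l → Lead (a ∷ p) (suc n) l
  Lead-∷ L = record { leading = leading L ; nonzero = nonzero L ; above = λ { (suc i) (s≤s lt) → above L i lt } }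

  Lead-[] : ∀ {a p} → ¬ a F.≈ F.0# → p ≋ [] → Lead (a ∷ p) 0 a
  Lead-[] a≉0 e = record { leading = F.refl ; nonzero = a≉0 ; above = λ { (suc i) lt → at e i } }

  Lead-1 : Lead oneP 0 F.1#
  Lead-1 = Lead-[] 1≉0 ≋-refl

  lead? : ∀ p → p ≋ [] ⊎ ∃[ n ] ∃[ l ] Lead p n l
  lead? [] = inj₁ ≋-refl
  lead? (a ∷ p) with lead? p
  ... | inj₂ (n , l , L) = inj₂ (suc n , l , Lead-∷ L)
  ... | inj₁ e with a ≈? F.0#
  ...   | yes a≈0 = inj₁ (∷≋[] a≈0 e)
  ...   | no  a≉0 = inj₂ (0 , a , Lead-[] a≉0 e)

  Lead-+ˡ : ∀ {p r n l} → (∀ i → n ≤ i → coeff p i F.≈ F.0#) → Lead r n l → Lead (p + r) n l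
  Lead-+ˡ {p} {r} low L = record
    { leading = F.trans (coeff-⊕ p r _) (F.trans (F.+-congʳ (low _ ℕP.≤-refl)) (F.trans (F.+-identityˡ _) (leading L)))
    ; nonzero = nonzero L
    ; above = λ i lt → F.trans (coeff-⊕ p r i) (F.trans (F.+-cong (low i (ℕP.<⇒≤ lt)) (above L i lt)) (F.+-identityˡ _)) }

  Lead-scale : ∀ {p n l} a → ¬ a F.≈ F.0# → Lead p n l → Lead (scale a p) n (a F.* l)
  Lead-scale {p} a a≉0 L = record
    { leading = F.trans (coeff-scale a p _) (F.*-congˡ (leading L))
    ; nonzero = *-≉0 a≉0 (nonzero L)
    ; above = λ i lt → F.trans (coeff-scale a p i) (F.trans (F.*-congˡ (above L i lt)) (F.zeroʳ a)) }

  Lead-* : ∀ {p r n m l l′} → Lead p n l → Lead r m l′ → Lead (p * r) (n ℕ.+ m) (l F.* l′)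
  Lead-* {[]} L M = ⊥-elim (Lead⇒≉0 L ≋-refl)
  Lead-* {a ∷ p} {r} {zero} {m} L M =
    Lead-≈ (F.*-congʳ (leading L))
      (Lead-cong (sym (trans (∷-⊗ a p r) (trans (+-congˡ (∷≋[] F.refl (trans (*-congʳ {r} (mk λ i → above L (suc i) (s≤s z≤n))) (zeroˡ r)))) (+-identityʳ _))))
        (Lead-scale {r} a (λ z → nonzero L (F.trans (F.sym (leading L)) z)) M))
  Lead-* {a ∷ p} {r} {suc n} {m} L M = Lead-cong (sym (∷-⊗ a p r)) (Lead-+ˡ low (Lead-∷ (Lead-* {p} {r} tail M)))
    where
    tail : Lead p n _
    tail = record { leading = leading L ; nonzero = nonzero L ; above = λ i lt → above L (suc i) (s≤s lt) }
    low : ∀ i → suc (n ℕ.+ m) ≤ i → coeff (scale a r) i F.≈ F.0#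
    low i le = F.trans (coeff-scale a r i) (F.trans (F.*-congˡ (above M i (ℕP.≤-trans (s≤s (ℕP.m≤n+m m n)) le))) (F.zeroʳ a))

  Lead-^ : ∀ {p n l} k → Lead p n l → Lead (p ^ k) (k ℕ.* n) (l F.^ k)
  Lead-^ zero    L = Lead-1
  Lead-^ {p} (suc k) L = Lead-* {p} {p ^ k} L (Lead-^ k L)

  noZeroDivisors : NoZeroDivisors polynomialRing
  noZeroDivisors {p} {r} e with lead? p | lead? r
  ... | inj₁ z | _ = inj₁ z
  ... | inj₂ _ | inj₁ z = inj₂ z
  ... | inj₂ (_ , _ , L) | inj₂ (_ , _ , M) = ⊥-elim (Lead⇒≉0 (Lead-* L M) e)

  *-cancelʳ : ∀ {a b} f → ¬ f ≋ [] → a * f ≋ b * f → a ≋ b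
  *-cancelʳ {a} {b} f f≉0 e = case noZeroDivisors {a - b} {f} [a-b]f≋0 of λ
    { (inj₁ z) → x-y≈0⇒x≈y z
    ; (inj₂ z) → ⊥-elim (f≉0 z) }
    where
    [a-b]f≋0 : (a - b) * f ≋ []
    [a-b]f≋0 = trans (solve 3 (λ a b f → (a :- b) :* f := a :* f :- b :* f) refl a b f) (x≈y⇒x-y≈0 e)

  Lead-0⇒constant : ∀ {p l} → Lead p 0 l → p ≋ [ l ]
  Lead-0⇒constant L = mk λ { zero → leading L ; (suc i) → above L (suc i) (s≤s z≤n) }

  Lead-0⇒unit : ∀ {p l} → Lead p 0 l → IsUnitP p
  Lead-0⇒unit {p} {l} L = l , nonzero L , at (Lead-0⇒constant L)

  unit⇒Lead-0 : ∀ {p} (u : IsUnitP p) → Lead p 0 (proj₁ u)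
  unit⇒Lead-0 (a , a≉0 , e) = Lead-cong (≋-sym (mk e)) (Lead-[] a≉0 ≋-refl)

  constP-* : ∀ a b → [ a ] * [ b ] ≋ [ a F.* b ]
  constP-* a b = [ a ]⊗ [ b ]

  constP-cong : ∀ {a b} → a F.≈ b → [ a ] ≋ [ b ]
  constP-cong e = ∷-cong e ≋-refl

  constP-^ : ∀ a n → [ a ] ^ n ≋ [ a F.^ n ]
  constP-^ a zero = ≋-refl
  constP-^ a (suc n) = trans (*-congˡ (constP-^ a n)) (constP-* a _)

  constP-inverse : ∀ a → ¬ a F.≈ F.0# → [ a ⁻¹ ] * [ a ] ≋ oneP
  constP-inverse a a≉0 = trans (constP-* _ a) (constP-cong (F.trans (F.*-comm _ a) (⁻¹-inverse a a≉0)))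

  infix 4 _∣ₚ_
  _∣ₚ_ : Pol → Pol → Set (c ⊔ ℓ)
  f ∣ₚ a = ∃[ k ] a ≋ k * f

  Lead-∣ₚ : ∀ {f a D n l l′} → Lead f D l → Lead a n l′ → f ∣ₚ a → D ≤ n
  Lead-∣ₚ {f} L M (k , e) with lead? k
  ... | inj₁ z = ⊥-elim (Lead⇒≉0 M (trans e (trans (*-congʳ z) (zeroˡ f))))
  ... | inj₂ (m , _ , K) = ≡.subst (_ ℕ.≤_) (≡.sym (proj₁ (Lead-unique e M (Lead-* K L)))) (ℕP.m≤n+m _ m)

  scale-0 : ∀ {b} r → b F.≈ F.0# → scale b r ≋ []
  scale-0 {b} r b≈0 = mk λ i → F.trans (coeff-scale b r i) (F.trans (F.*-congʳ b≈0) (F.zeroˡ _))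

  0∷-* : ∀ p r → (F.0# ∷ p) * r ≋ F.0# ∷ p * r
  0∷-* p r = trans (∷-⊗ F.0# p r) (trans (+-congʳ (scale-0 r F.refl)) (+-identityˡ _))

  ∷-+ : ∀ {a p r s} → p ≋ r + s → a ∷ p ≋ (F.0# ∷ r) + (a ∷ s)
  ∷-+ {a} {p} {r} {s} e = mk λ where
    zero    → F.sym (F.trans (coeff-⊕ (F.0# ∷ r) (a ∷ s) 0) (F.+-identityˡ a))
    (suc i) → F.trans (at e i) (F.trans (coeff-⊕ r s i) (F.sym (coeff-⊕ (F.0# ∷ r) (a ∷ s) (suc i))))

  divMod : ∀ {f D l} → Lead f D l → ∀ a →
    ∃[ k ] ∃[ r ] a ≋ k * f + r × (∀ i → D ≤ i → coeff r i F.≈ F.0#)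
  divMod {f} L [] = [] , [] , sym (trans (+-identityʳ _) (zeroˡ f)) , λ i _ → F.refl
  divMod {f} {D} {l} L (a ∷ as) with divMod L as
  ... | k , r , e , low = (F.0# ∷ k) + [ ρ ] , (a ∷ r) - [ ρ ] * f , eq , low′
    where
    -- Shifting the division of `as` by one place gives the remainder `a ∷ r`, of degree at most
    -- `D`; this is the multiple of `f` that removes its coefficient at `D`.
    ρ = coeff (a ∷ r) D F.* l ⁻¹
    eq : a ∷ as ≋ ((F.0# ∷ k) + [ ρ ]) * f + ((a ∷ r) - [ ρ ] * f)
    eq = begin
      a ∷ as  ≈⟨ ∷-+ e ⟩
      (F.0# ∷ k * f) + (a ∷ r)  ≈⟨ +-congʳ (0∷-* k f) ⟨
      (F.0# ∷ k) * f + (a ∷ r)  ≈⟨ solve 4 (λ x p f r → x :* f :+ r := (x :+ p) :* f :+ (r :- p :* f)) refl (F.0# ∷ k) [ ρ ] f (a ∷ r) ⟩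
      ((F.0# ∷ k) + [ ρ ]) * f + ((a ∷ r) - [ ρ ] * f) ∎
      where open ≋-Reasoning
    coeff-r : ∀ i → coeff ((a ∷ r) - [ ρ ] * f) i F.≈ coeff (a ∷ r) i F.- ρ F.* coeff f i
    coeff-r i = F.trans (coeff-⊕ (a ∷ r) _ i) (F.+-congˡ (F.trans (coeff-⊝ ([ ρ ] * f) i)
      (F.-‿cong (F.trans (at ([ ρ ]⊗ f) i) (coeff-scale ρ f i)))))
    tail-low : ∀ i → D < i → coeff (a ∷ r) i F.≈ F.0#
    tail-low (suc i) (s≤s le) = low i le
    low′ : ∀ i → D ≤ i → coeff ((a ∷ r) - [ ρ ] * f) i F.≈ F.0#
    low′ i le with D ℕ.≟ i
    ... | yes ≡.refl = F.trans (coeff-r D) (F.x≈y⇒x-y≈0 (F.sym (begin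
      (coeff (a ∷ r) D F.* l ⁻¹) F.* coeff f D  ≈⟨ F.*-assoc _ _ _ ⟩
      coeff (a ∷ r) D F.* (l ⁻¹ F.* coeff f D)  ≈⟨ F.*-congˡ (F.trans (F.*-comm _ _) (F.trans (F.*-congʳ (leading L)) (⁻¹-inverse l (nonzero L)))) ⟩
      coeff (a ∷ r) D F.* F.1#  ≈⟨ F.*-identityʳ _ ⟩
      coeff (a ∷ r) D  ∎)))
      where open import Relation.Binary.Reasoning.Setoid F.setoid
    ... | no D≢i = F.trans (coeff-r i) (F.trans (F.+-cong (tail-low i D<i) (F.-‿cong (F.trans (F.*-congˡ (above L i D<i)) (F.zeroʳ ρ)))) (F.-‿inverseʳ _))
      where D<i = ℕP.≤∧≢⇒< le D≢i

  ∣ₚ? : ∀ {f D l} → Lead f D l → ∀ a → Dec (f ∣ₚ a)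
  ∣ₚ? {f} {D} L a with divMod L a
  ... | k , r , e , low with lead? r
  ...   | inj₁ z = yes (k , trans e (trans (+-congˡ z) (+-identityʳ _)))
  ...   | inj₂ (m , _ , M) = no λ { (k′ , e′) → ℕP.<⇒≱ (m<D m M) (Lead-∣ₚ L M (k′ - k , (begin
      r  ≈⟨ solve 3 (λ k f r → r := (k :* f :+ r) :- k :* f) refl k f r ⟩
      (k * f + r) - k * f    ≈⟨ +-congʳ (trans (sym e) e′) ⟩
      k′ * f - k * f         ≈⟨ solve 3 (λ k k′ f → k′ :* f :- k :* f := (k′ :- k) :* f) refl k k′ f ⟩
      (k′ - k) * f  ∎))) }
    where
    open ≋-Reasoning
    m<D : ∀ m {l} → Lead r m l → m < D
    m<D m M with m ℕ.<? D
    ... | yes lt = lt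
    ... | no ge = ⊥-elim (nonzero M (F.trans (F.sym (leading M)) (low m (ℕP.≮⇒≥ ge))))

  -- Euclid's algorithm. The number `n` exceeds the degree of the second argument; the next second
  -- argument is a remainder, whose degree is smaller, so the recursion is structural in `n`.
  bezout : ∀ n a b → (∀ i → n ≤ i → coeff b i F.≈ F.0#) →
    ∃[ g ] g ∣ₚ a × g ∣ₚ b × ∃[ u ] ∃[ v ] g ≋ u * a + v * b
  bezout zero a b low = a , (oneP , sym (*-identityˡ a)) , ([] , trans (mk λ i → low i z≤n) (sym (zeroˡ a))) , oneP , [] , solve 2 (λ a b → a := con (ℤ.+ 1) :* a :+ con (ℤ.+ 0) :* b) refl a b
  bezout (suc n) a b low with lead? b
  ... | inj₁ z = bezout zero a b (λ i _ → at z i)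
  ... | inj₂ (m , l , L) with divMod L a
  ...   | k , r , e , low-r with bezout n b r (λ i n≤i → low-r i (ℕP.≤-trans m≤n n≤i))
    where
    m≤n : m ≤ n
    m≤n with m ℕ.≤? n
    ... | yes le = le
    ... | no gt = ⊥-elim (nonzero L (F.trans (F.sym (leading L)) (low m (ℕP.≰⇒> gt))))
  ...     | g , (k₁ , e₁) , (k₂ , e₂) , u , v , e₃ = g
    , (k * k₁ + k₂ , (begin
        a  ≈⟨ e ⟩
        k * b + r  ≈⟨ +-cong (*-congˡ e₁) e₂ ⟩
        k * (k₁ * g) + k₂ * g   ≈⟨ solve 4 (λ k k₁ k₂ g → k :* (k₁ :* g) :+ k₂ :* g := (k :* k₁ :+ k₂) :* g) refl k k₁ k₂ g ⟩
        (k * k₁ + k₂) * g       ∎))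
    , (k₁ , e₁) , v , u - v * k , (begin
        g  ≈⟨ e₃ ⟩
        u * b + v * r  ≈⟨ solve 5 (λ b r u v k → u :* b :+ v :* r := v :* (k :* b :+ r) :+ (u :- v :* k) :* b) refl b r u v k ⟩
        v * (k * b + r) + (u - v * k) * b ≈⟨ +-congʳ (*-congˡ e) ⟨
        v * a + (u - v * k) * b         ∎)
    where open ≋-Reasoning

  coeff-bound : ∀ (p : Pol) i → length p ≤ i → coeff p i F.≈ F.0#
  coeff-bound []      i       le         = F.refl
  coeff-bound (a ∷ p) (suc i) (s≤s le) = coeff-bound p i le

  -- Write `f = k g` with `g` the greatest common divisor of `f` and `a`. A unit `k` makes `f` an
  -- associate of `g` and so a divisor of `a`; a unit `g` is scaled to 1 in its Bézout identity.
  irreducible⇒coprime : ∀ {f} → Irreducible f → ∀ a → f ∣ₚ a ⊎ ∃[ u ] ∃[ v ] oneP ≋ u * f + v * a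
  irreducible⇒coprime {f} (_ , _ , irr) a with bezout (length a) f a (coeff-bound a)
  ... | g , (k , e) , (k′ , e′) , u , v , e″ with irr k g (at (trans e (reflexive (⊗≡*ₚ k g))))
  ...   | inj₂ (b , b≉0 , eq) = inj₂ ([ b ⁻¹ ] * u , [ b ⁻¹ ] * v , (begin
        oneP  ≈⟨ constP-inverse b b≉0 ⟨
        [ b ⁻¹ ] * [ b ]  ≈⟨ *-congˡ (trans (sym (mk eq)) e″) ⟩
        [ b ⁻¹ ] * (u * f + v * a)        ≈⟨ solve 5 (λ i u v f a → i :* (u :* f :+ v :* a) := (i :* u) :* f :+ (i :* v) :* a) refl [ b ⁻¹ ] u v f a ⟩
        [ b ⁻¹ ] * u * f + [ b ⁻¹ ] * v * a ∎))
    where open ≋-Reasoning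
  ...   | inj₁ (b , b≉0 , eq) = inj₁ (k′ * [ b ⁻¹ ] , (begin
        a  ≈⟨ e′ ⟩
        k′ * g  ≈⟨ *-congˡ (*-identityˡ g) ⟨
        k′ * (oneP * g)  ≈⟨ *-congˡ (*-congʳ (constP-inverse b b≉0)) ⟨
        k′ * ([ b ⁻¹ ] * [ b ] * g)  ≈⟨ *-congˡ (*-congʳ (*-congˡ (mk eq))) ⟨
        k′ * ([ b ⁻¹ ] * k * g)      ≈⟨ solve 4 (λ k′ i k g → k′ :* (i :* k :* g) := k′ :* i :* (k :* g)) refl k′ [ b ⁻¹ ] k g ⟩
        k′ * [ b ⁻¹ ] * (k * g)      ≈⟨ *-congˡ e ⟨
        k′ * [ b ⁻¹ ] * f  ∎))
    where open ≋-Reasoning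

  irreducible⇒prime : ∀ {f} → Irreducible f → ∀ a b → f ∣ₚ a * b → f ∣ₚ a ⊎ f ∣ₚ b
  irreducible⇒prime {f} irr a b (k , e) with irreducible⇒coprime irr a
  ... | inj₁ f∣a = inj₁ f∣a
  ... | inj₂ (u , v , eq) = inj₂ (u * b + v * k , (begin
    b  ≈⟨ *-identityˡ b ⟨
    oneP * b  ≈⟨ *-congʳ eq ⟩
    (u * f + v * a) * b     ≈⟨ solve 5 (λ u f v a b → (u :* f :+ v :* a) :* b := u :* b :* f :+ v :* (a :* b)) refl u f v a b ⟩
    u * b * f + v * (a * b) ≈⟨ +-congˡ (*-congˡ e) ⟩
    u * b * f + v * (k * f) ≈⟨ solve 5 (λ u b f v k → u :* b :* f :+ v :* (k :* f) := (u :* b :+ v :* k) :* f) refl u b f v k ⟩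
    (u * b + v * k) * f     ∎))
    where open ≋-Reasoning

  quotient-noZeroDivisors : ∀ {f} → Irreducible f → NoZeroDivisors (PrincipalQuotient.quotientRing polynomialRing f)
  quotient-noZeroDivisors {f} irr {a} {b} ab∼0 with irreducible⇒prime irr a b (∼0⇒multiple ab∼0)
    where open PrincipalQuotient polynomialRing f
  ... | inj₁ (k , e) = inj₁ (PrincipalQuotient.multiple⇒∼0 polynomialRing f k e)
  ... | inj₂ (k , e) = inj₂ (PrincipalQuotient.multiple⇒∼0 polynomialRing f k e)

  -- The only part of unique factorisation that is needed: `f` is prime, so one copy of it can be
  -- cancelled from `a` or from `b`, and induction on `n` distributes the copies between them.
  factorsOfPower : ∀ {f} → Irreducible f → ∀ n a b → a * b ≋ f ^ n →
    ∃[ i ] ∃[ j ] ∃[ x ] ∃[ y ] i ℕ.+ j ≡ n × ¬ x F.≈ F.0# × ¬ y F.≈ F.0# × a ≋ [ x ] * f ^ i × b ≋ [ y ] * f ^ j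
  factorsOfPower {f} irr zero a b e with lead? a | lead? b
  ... | inj₁ z | _ = ⊥-elim (1≉0 (at (trans (sym e) (trans (*-congʳ z) (zeroˡ b))) 0))
  ... | inj₂ _ | inj₁ z = ⊥-elim (1≉0 (at (trans (sym e) (trans (*-congˡ z) (zeroʳ a))) 0))
  ... | inj₂ (n , x , L) | inj₂ (m , y , M) with ℕP.m+n≡0⇒m≡0 n n+m≡0 | ℕP.m+n≡0⇒n≡0 n n+m≡0
    where n+m≡0 = proj₁ (Lead-unique e (Lead-* L M) Lead-1)
  ...   | ≡.refl | ≡.refl = 0 , 0 , x , y , ≡.refl , nonzero L , nonzero M
                          , trans (Lead-0⇒constant L) (sym (*-identityʳ _)) , trans (Lead-0⇒constant M) (sym (*-identityʳ _))
  factorsOfPower {f} irr (suc n) a b e = case irreducible⇒prime irr a b (f ^ n , trans e (*-comm f _)) of λ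
    { (inj₁ (a′ , e′)) → case factorsOfPower irr n a′ b (cancel (trans (solve 3 (λ a b f → a :* b :* f := (a :* f) :* b) refl a′ b f) (*-congʳ (sym e′)))) of λ
      { (i , j , x , y , i+j≡n , x≉0 , y≉0 , ea , eb) → suc i , j , x , y , ≡.cong suc i+j≡n , x≉0 , y≉0
        , trans e′ (trans (*-congʳ ea) (solve 3 (λ x f P → x :* P :* f := x :* (f :* P)) refl [ x ] f (f ^ i))) , eb }
    ; (inj₂ (b′ , e′)) → case factorsOfPower irr n a b′ (cancel (trans (*-assoc a b′ f) (*-congˡ (sym e′)))) of λ
      { (i , j , x , y , i+j≡n , x≉0 , y≉0 , ea , eb) → i , suc j , x , y , ≡.trans (ℕP.+-suc i j) (≡.cong suc i+j≡n) , x≉0 , y≉0 , ea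
        , trans e′ (trans (*-congʳ eb) (solve 3 (λ x f P → x :* P :* f := x :* (f :* P)) refl [ y ] f (f ^ j))) } }
    where
    cancel : ∀ {g} → g * f ≋ a * b → g ≋ f ^ n
    cancel eq = *-cancelʳ f (λ z → proj₁ irr (at z)) (trans eq (trans e (*-comm f _)))

-- Substitution and Frobenius

module Substitution {c ℓ} (F : Field c ℓ) (q : ℕ) (card : HasCardinality F q) where
  open HasCardinality card
  open PolynomialArithmetic F q card public

  private
    index : F.Carrier → Fin q
    index x = proj₁ (enum-surj x)

    enum-index : ∀ x → enum (index x) F.≈ x
    enum-index x = proj₂ (enum-surj x)

    module Σ* = CommutativeMonoidSum F.*-commutativeMonoid

  q≢0 : ∃[ q′ ] q ≡ suc q′
  q≢0 with index F.0#
  ... | zero  = _ , ≡.refl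
  ... | suc _ = _ , ≡.refl

  -- Multiplication by `a` permutes F. In `nz` the zero element is replaced by 1, so the product of
  -- all `nz` is nonzero; the permutation multiplies it by the product of `ratio`, which is 1 at
  -- zero and `a` at the other q - 1 places. Comparing the products before and after gives
  -- `a^(q-1) = 1`.
  F-fermat : ∀ a → ¬ a F.≈ F.0# → a F.^ (q ∸ 1) F.≈ F.1#
  F-fermat a a≉0 = F.trans (F.sym ∏ratio≈a^) ∏ratio≈1
    where
    open import Relation.Binary.Reasoning.Setoid F.setoid
    a⁻¹a≈1 : ∀ x → a ⁻¹ F.* (a F.* x) F.≈ x
    a⁻¹a≈1 x = F.trans (F.sym (F.*-assoc _ _ _)) (F.trans (F.*-congʳ (F.trans (F.*-comm _ _) (⁻¹-inverse a a≉0))) (F.*-identityˡ x))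
    aa⁻¹≈1 : ∀ x → a F.* (a ⁻¹ F.* x) F.≈ x
    aa⁻¹≈1 x = F.trans (F.sym (F.*-assoc _ _ _)) (F.trans (F.*-congʳ (⁻¹-inverse a a≉0)) (F.*-identityˡ x))
    mul : F.Carrier → Fin q → Fin q
    mul b i = index (b F.* enum i)
    mul-inv : ∀ {b b′} → (∀ x → b F.* (b′ F.* x) F.≈ x) → ∀ i → mul b (mul b′ i) ≡ i
    mul-inv h i = enum-inj _ _ (F.trans (enum-index _) (F.trans (F.*-congˡ (enum-index _)) (h (enum i))))
    π = permutation (mul a) (mul (a ⁻¹)) (mul-inv aa⁻¹≈1) (mul-inv a⁻¹a≈1)
    nz ratio : Fin q → F.Carrier
    nz i with enum i ≈? F.0#
    ... | yes _ = F.1#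
    ... | no  _ = enum i
    ratio i with enum i ≈? F.0#
    ... | yes _ = F.1#
    ... | no  _ = a
    nz-≉0 : ∀ i → ¬ nz i F.≈ F.0#
    nz-≉0 i with enum i ≈? F.0#
    ... | yes _ = 1≉0
    ... | no  h = h
    nz-π : ∀ i → nz (π ⟨$⟩ʳ i) F.≈ ratio i F.* nz i
    nz-π i with enum i ≈? F.0# | enum (mul a i) ≈? F.0#
    ... | yes _ | yes _ = F.sym (F.*-identityˡ _)
    ... | yes z | no  h = ⊥-elim (h (F.trans (enum-index _) (F.trans (F.*-congˡ z) (F.zeroʳ a))))
    ... | no  h | yes z = ⊥-elim (*-≉0 a≉0 h (F.trans (F.sym (enum-index _)) z))
    ... | no  _ | no  _ = enum-index _
    ∏-≉0 : ∀ {n} (t : Fin n → F.Carrier) → (∀ i → ¬ t i F.≈ F.0#) → ¬ Σ*.sum t F.≈ F.0#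
    ∏-≉0 {zero}  t h = 1≉0
    ∏-≉0 {suc n} t h = *-≉0 (h zero) (∏-≉0 (λ i → t (suc i)) (λ i → h (suc i)))
    ∏ratio≈1 : Σ*.sum ratio F.≈ F.1#
    ∏ratio≈1 with F-noZeroDivisors {Σ*.sum ratio F.- F.1#} {Σ*.sum nz} (begin
      (Σ*.sum ratio F.- F.1#) F.* Σ*.sum nz  ≈⟨ F.solve 2 (λ r z → (r F.:- F.con (ℤ.+ 1)) F.:* z F.:= r F.:* z F.:- z) F.refl _ _ ⟩
      Σ*.sum ratio F.* Σ*.sum nz F.- Σ*.sum nz  ≈⟨ F.x≈y⇒x-y≈0 (F.trans (F.sym (Σ*.∑-distrib-+ ratio nz)) (F.trans (Σ*.sum-cong-≋ (λ i → F.sym (nz-π i))) (F.sym (Σ*.sum-permute nz π)))) ⟩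
      F.0#  ∎)
    ... | inj₁ z = F.x-y≈0⇒x≈y z
    ... | inj₂ z = ⊥-elim (∏-≉0 nz nz-≉0 z)
    ∏-const : ∀ {n} (t : Fin n → F.Carrier) → (∀ i → t i F.≈ a) → Σ*.sum t F.≈ a F.^ n
    ∏-const {zero}  t h = F.refl
    ∏-const {suc n} t h = F.*-cong (h zero) (∏-const (λ i → t (suc i)) (λ i → h (suc i)))
    ratio-0 : ∀ i → enum i F.≈ F.0# → ratio i F.≈ F.1#
    ratio-0 i z with enum i ≈? F.0#
    ... | yes _ = F.refl
    ... | no  h = ⊥-elim (h z)
    ratio-a : ∀ i → ¬ enum i F.≈ F.0# → ratio i F.≈ a
    ratio-a i h with enum i ≈? F.0#
    ... | yes z = ⊥-elim (h z)
    ... | no  _ = F.refl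
    remove-0 : ∀ {n} (t : Fin n → F.Carrier) (i : Fin n) → t i F.≈ F.1# → (∀ j → ¬ i ≡ j → t j F.≈ a) → Σ*.sum t F.≈ a F.^ (n ∸ 1)
    remove-0 {suc n} t i ti tj = F.trans (Σ*.sum-remove {i = i} t) (F.trans (F.*-congʳ ti) (F.trans (F.*-identityˡ _)
      (∏-const _ (λ j → tj _ (λ eq → FinP.punchInᵢ≢i i j (≡.sym eq))))))
    ∏ratio≈a^ : Σ*.sum ratio F.≈ a F.^ (q ∸ 1)
    ∏ratio≈a^ = remove-0 ratio (index F.0#) (ratio-0 _ (enum-index _))
      (λ j i≢j → ratio-a j (λ z → i≢j (enum-inj _ _ (F.trans (enum-index _) (F.sym z)))))

  F-x^q≈x : ∀ a → a F.^ q F.≈ a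
  F-x^q≈x a with a ≈? F.0# | q≢0
  ... | yes z | q′ , ≡.refl = F.trans (F.*-congʳ z) (F.trans (F.zeroˡ _) (F.sym z))
  ... | no  h | q′ , ≡.refl = F.trans (F.*-congˡ (F-fermat a h)) (F.*-identityʳ a)

  X : Pol
  X = F.0# ∷ F.1# ∷ []

  Lead-X : Lead X 1 F.1#
  Lead-X = Lead-∷ Lead-1

  X-* : ∀ p → X * p ≋ F.0# ∷ p
  X-* p = trans (0∷-* oneP p) (∷-cong F.refl (*-identityˡ p))

  ∷-X : ∀ a p → a ∷ p ≋ [ a ] + X * p
  ∷-X a p = trans (sym (mk λ { zero → F.trans (coeff-⊕ [ a ] (F.0# ∷ p) 0) (F.+-identityʳ a)
                             ; (suc i) → F.trans (coeff-⊕ [ a ] (F.0# ∷ p) (suc i)) (F.+-identityˡ _) })) (+-congˡ (sym (X-* p)))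

  coeff-X^ : ∀ t p i → coeff (X ^ t * p) (t ℕ.+ i) F.≈ coeff p i
  coeff-X^ zero    p i = at (*-identityˡ p) i
  coeff-X^ (suc t) p i = F.trans (at (trans (*-assoc X (X ^ t) p) (X-* _)) (suc t ℕ.+ i)) (coeff-X^ t p i)

  coeff-X^-< : ∀ t p i → i < t → coeff (X ^ t * p) i F.≈ F.0#
  coeff-X^-< (suc t) p zero    lt = at (trans (*-assoc X (X ^ t) p) (X-* _)) 0
  coeff-X^-< (suc t) p (suc i) (s≤s lt) = F.trans (at (trans (*-assoc X (X ^ t) p) (X-* _)) (suc i)) (coeff-X^-< t p i lt)

  Lead-X^ : ∀ t → Lead (X ^ t) t F.1#
  Lead-X^ t = ≡.subst (λ n → Lead (X ^ t) n F.1#) (ℕP.*-identityʳ t) (Lead-≈ (F.1^n≈1 t) (Lead-^ t Lead-X))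

  comp : Pol → Pol → Pol
  comp []      b = []
  comp (a ∷ p) b = [ a ] + b * comp p b

  comp-congʳ : ∀ p {b b′} → b ≋ b′ → comp p b ≋ comp p b′
  comp-congʳ []      e = ≋-refl
  comp-congʳ (a ∷ p) e = +-congˡ (*-cong e (comp-congʳ p e))

  comp-zero : ∀ p b → p ≋ [] → comp p b ≋ []
  comp-zero []      b e = ≋-refl
  comp-zero (a ∷ p) b e = trans (+-cong (∷≋[] (at e 0) ≋-refl) (trans (*-congˡ (comp-zero p b (mk λ i → at e (suc i)))) (zeroʳ b))) (+-identityˡ _)

  comp-congˡ : ∀ {p p′} b → p ≋ p′ → comp p b ≋ comp p′ b
  comp-congˡ {[]}    {p′}     b e = sym (comp-zero p′ b (sym e))
  comp-congˡ {a ∷ p} {[]}     b e = comp-zero (a ∷ p) b e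
  comp-congˡ {a ∷ p} {_ ∷ p′} b e = +-cong (constP-cong (at e 0)) (*-congˡ (comp-congˡ b (tail-cong e)))

  comp-const : ∀ a b → comp [ a ] b ≋ [ a ]
  comp-const a b = trans (+-congˡ (zeroʳ b)) (+-identityʳ _)

  comp-X : ∀ b → comp X b ≋ b
  comp-X b = trans (+-cong 0∷[]≋[] (*-congˡ (comp-const F.1# b))) (trans (+-identityˡ _) (*-identityʳ b))

  constP-+ : ∀ a b → [ a F.+ b ] ≋ [ a ] + [ b ]
  constP-+ a b = sym (mk λ { zero → coeff-⊕ [ a ] [ b ] 0 ; (suc i) → F.trans (coeff-⊕ [ a ] [ b ] (suc i)) (F.+-identityˡ _) })

  comp-+ₚ : ∀ p r b → comp (p +ₚ r) b ≋ comp p b + comp r b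
  comp-+ₚ []      r       b = sym (+-identityˡ _)
  comp-+ₚ (a ∷ p) []      b = sym (+-identityʳ _)
  comp-+ₚ (a ∷ p) (x ∷ r) b = trans (+-cong (constP-+ a x) (*-congˡ (comp-+ₚ p r b)))
    (solve 5 (λ a x b p r → a :+ x :+ b :* (p :+ r) := (a :+ b :* p) :+ (x :+ b :* r)) refl [ a ] [ x ] b (comp p b) (comp r b))

  comp-+ : ∀ p r b → comp (p + r) b ≋ comp p b + comp r b
  comp-+ p r b = trans (reflexive (≡.cong (λ s → comp s b) (⊕≡+ₚ p r))) (comp-+ₚ p r b)

  comp-scale : ∀ a p b → comp (scale a p) b ≋ [ a ] * comp p b
  comp-scale a []      b = sym (zeroʳ _)
  comp-scale a (x ∷ p) b = trans (+-cong (sym (constP-* a x)) (*-congˡ (comp-scale a p b)))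
    (solve 4 (λ a x b p → a :* x :+ b :* (a :* p) := a :* (x :+ b :* p)) refl [ a ] [ x ] b (comp p b))

  comp-* : ∀ p r b → comp (p * r) b ≋ comp p b * comp r b
  comp-* []      r b = trans (comp-zero _ b (zeroˡ r)) (sym (zeroˡ _))
  comp-* (a ∷ p) r b = begin
    comp ((a ∷ p) * r) b  ≈⟨ comp-congˡ b (∷-⊗ a p r) ⟩
    comp (scale a r + (F.0# ∷ p * r)) b  ≈⟨ comp-+ (scale a r) _ b ⟩
    comp (scale a r) b + ([ F.0# ] + b * comp (p * r) b) ≈⟨ +-cong (comp-scale a r b) (trans (+-congʳ 0∷[]≋[]) (trans (+-identityˡ _) (*-congˡ (comp-* p r b)))) ⟩
    [ a ] * comp r b + b * (comp p b * comp r b)  ≈⟨ solve 4 (λ a b p r → a :* r :+ b :* (p :* r) := (a :+ b :* p) :* r) refl [ a ] b (comp p b) (comp r b) ⟩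
    ([ a ] + b * comp p b) * comp r b  ∎
    where open ≋-Reasoning

  comp-^ : ∀ p n b → comp (p ^ n) b ≋ comp p b ^ n
  comp-^ p zero    b = comp-const F.1# b
  comp-^ p (suc n) b = trans (comp-* p (p ^ n) b) (*-congˡ (comp-^ p n b))

  comp-X^ : ∀ n b → comp (X ^ n) b ≋ b ^ n
  comp-X^ n b = trans (comp-^ X n b) (^-congˡ n (comp-X b))

  comp-prod : ∀ n (g : ℕ → Pol) b → comp (prod n g) b ≋ prod n (λ i → comp (g i) b)
  comp-prod zero    g b = comp-const F.1# b
  comp-prod (suc n) g b = trans (comp-* (prod n g) (g (suc n)) b) (*-congʳ (comp-prod n g b))

  comp-comp : ∀ p b d → comp (comp p b) d ≋ comp p (comp b d)
  comp-comp []      b d = ≋-refl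
  comp-comp (a ∷ p) b d = trans (comp-+ [ a ] _ d) (+-cong (comp-const a d) (trans (comp-* b _ d) (*-congˡ (comp-comp p b d))))

  comp-identity : ∀ p → comp p X ≋ p
  comp-identity []      = ≋-refl
  comp-identity (a ∷ p) = trans (+-congˡ (*-congˡ (comp-identity p))) (sym (∷-X a p))

  Lead-comp : ∀ {p y n m l l′} → Lead p n l → Lead y (suc m) l′ → Lead (comp p y) (n ℕ.* suc m) (l F.* l′ F.^ n)
  Lead-comp {[]} L M = ⊥-elim (Lead⇒≉0 L ≋-refl)
  Lead-comp {a ∷ p} {y} {zero} {l = l} L M = Lead-≈ (F.trans (leading L) (F.sym (F.*-identityʳ l)))
    (Lead-cong (sym (trans (+-congˡ (trans (*-congˡ (comp-zero p y (mk λ i → above L (suc i) (s≤s z≤n)))) (zeroʳ y))) (+-identityʳ _)))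
      (Lead-[] (λ z → nonzero L (F.trans (F.sym (leading L)) z)) ≋-refl))
  Lead-comp {a ∷ p} {y} {suc n} {m} {l} {l′} L M = Lead-+ˡ (λ { (suc i) _ → F.refl })
    (Lead-≈ (F.solve 3 (λ l l′ P → l′ F.:* (l F.:* P) F.:= l F.:* (l′ F.:* P)) F.refl l l′ (l′ F.^ n)) (Lead-* M (Lead-comp {p} tail M)))
    where
    tail : Lead p n l
    tail = record { leading = leading L ; nonzero = nonzero L ; above = λ i lt → above L (suc i) (s≤s lt) }

  coeff-*-0′ : ∀ p r → coeff (p * r) 0 F.≈ coeff p 0 F.* coeff r 0
  coeff-*-0′ p r = F.trans (at (reflexive (⊗≡*ₚ p r)) 0) (coeff-*-0 p r)

  comp-0 : ∀ p {y} → coeff y 0 F.≈ F.0# → coeff (comp p y) 0 F.≈ coeff p 0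
  comp-0 []  e = F.refl
  comp-0 (a ∷ p) {y} e = F.trans (coeff-⊕ [ a ] _ 0) (F.trans (F.+-congˡ (F.trans (coeff-*-0′ y _) (F.trans (F.*-congʳ e) (F.zeroˡ _)))) (F.+-identityʳ a))

  -- A nonzero difference keeps a nonzero leading coefficient after substitution of a polynomial of
  -- positive degree.
  comp-X^-injective : ∀ {p r} t → comp p (X ^ suc t) ≋ comp r (X ^ suc t) → p ≋ r
  comp-X^-injective {p} {r} t e with lead? (p - r)
    where open RingKit polynomialRing using (_-_)
  ... | inj₁ z = x-y≈0⇒x≈y z
  ... | inj₂ (n , l , L) = ⊥-elim (Lead⇒≉0 (Lead-comp L (Lead-X^ (suc t))) (begin
    comp (p - r) y  ≈⟨ solve 2 (λ s t → s := s :+ t :- t) refl (comp (p - r) y) (comp r y) ⟩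
    comp (p - r) y + comp r y - comp r y ≈⟨ +-congʳ (trans (sym (comp-+ (p - r) r y)) (trans (comp-congˡ y (solve 2 (λ p r → p :- r :+ r := p) refl p r)) e)) ⟩
    comp r y - comp r y  ≈⟨ x≈y⇒x-y≈0 refl ⟩
    []  ∎))
    where
    open RingKit polynomialRing using (_-_)
    open ≋-Reasoning
    y = X ^ suc t

  coeff-dilate : ∀ p a i → coeff (comp p ([ a ] * X)) i F.≈ a F.^ i F.* coeff p i
  coeff-dilate []      a i = F.sym (F.zeroʳ _)
  coeff-dilate (x ∷ p) a zero = F.trans (comp-0 (x ∷ p) (F.trans (coeff-*-0′ [ a ] X) (F.zeroʳ a))) (F.sym (F.*-identityˡ x))
  coeff-dilate (x ∷ p) a (suc i) = begin
    coeff ([ x ] + [ a ] * X * comp p ([ a ] * X)) (suc i)  ≈⟨ F.trans (coeff-⊕ [ x ] _ (suc i)) (F.+-identityˡ _) ⟩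
    coeff ([ a ] * X * comp p ([ a ] * X)) (suc i)  ≈⟨ at (trans (*-assoc [ a ] X _) (trans ([ a ]⊗ _) (scale-cong F.refl (X-* _)))) (suc i) ⟩
    coeff (scale a (comp p ([ a ] * X))) i  ≈⟨ coeff-scale a (comp p ([ a ] * X)) i ⟩
    a F.* coeff (comp p ([ a ] * X)) i  ≈⟨ F.*-congˡ (coeff-dilate p a i) ⟩
    a F.* (a F.^ i F.* coeff p i)  ≈⟨ F.*-assoc _ _ _ ⟨
    a F.* a F.^ i F.* coeff p i  ∎
    where open import Relation.Binary.Reasoning.Setoid F.setoid

  coeff-drop : ∀ t (p : Pol) i → coeff (drop t p) i ≡ coeff p (t ℕ.+ i)
  coeff-drop zero    p       i = ≡.refl
  coeff-drop (suc t) []      i = ≡.refl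
  coeff-drop (suc t) (a ∷ p) i = coeff-drop t p i

  -- Keep the constant term, drop the next `t` coefficients, which vanish, and repeat on the rest of
  -- the list; its length bounds the recursion.
  multiples⇒comp-X^ : ∀ t p → (∀ j r → 1 ≤ r → r ≤ t → coeff p (j ℕ.* suc t ℕ.+ r) F.≈ F.0#) → ∃[ s ] p ≋ comp s (X ^ suc t)
  multiples⇒comp-X^ t p = go (length p) p ℕP.≤-refl
    where
    go : ∀ n p → length p ≤ n → (∀ j r → 1 ≤ r → r ≤ t → coeff p (j ℕ.* suc t ℕ.+ r) F.≈ F.0#) → ∃[ s ] p ≋ comp s (X ^ suc t)
    go n [] le h = [] , ≋-refl
    go (suc n) (a ∷ p) (s≤s le) h with go n (drop t p)
        (ℕP.≤-trans (ℕP.≤-reflexive (ListP.length-drop t p)) (ℕP.≤-trans (ℕP.m∸n≤m (length p) t) le))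
        (λ j r 1≤r r≤t → F.trans (F.reflexive (≡.trans (coeff-drop t p _) (≡.cong (coeff p) (≡.sym (ℕP.+-assoc t (j ℕ.* suc t) r))))) (h (suc j) r 1≤r r≤t))
    ... | s , e = a ∷ s , trans (mk eq) (+-congˡ (*-congˡ e))
      where
      eq : ∀ i → coeff (a ∷ p) i F.≈ coeff ([ a ] + X ^ suc t * drop t p) i
      eq zero = F.sym (F.trans (coeff-⊕ [ a ] _ 0) (F.trans (F.+-congˡ (coeff-X^-< (suc t) (drop t p) 0 (s≤s z≤n))) (F.+-identityʳ a)))
      eq (suc i) with ℕP.<-cmp i t
      ... | tri< i<t _ _ = F.trans (h 0 (suc i) (s≤s z≤n) i<t)
              (F.sym (F.trans (coeff-⊕ [ a ] _ (suc i)) (F.trans (F.+-congˡ (coeff-X^-< (suc t) (drop t p) (suc i) (s≤s i<t))) (F.+-identityʳ _))))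
      ... | _ with t ℕ.≤? i
      ...   | no ¬t≤i = F.trans (h 0 (suc i) (s≤s z≤n) (ℕP.≰⇒> ¬t≤i))
              (F.sym (F.trans (coeff-⊕ [ a ] _ (suc i)) (F.trans (F.+-congˡ (coeff-X^-< (suc t) (drop t p) (suc i) (s≤s (ℕP.≰⇒> ¬t≤i)))) (F.+-identityʳ _))))
      ...   | yes t≤i = F.sym (F.trans (coeff-⊕ [ a ] _ (suc i)) (F.trans (F.+-identityˡ _)
              (≡.subst (λ z → coeff (X ^ suc t * drop t p) (suc z) F.≈ coeff p z) (ℕP.m+[n∸m]≡n t≤i)
                (F.trans (coeff-X^ (suc t) (drop t p) (i ∸ t)) (F.reflexive (coeff-drop t p (i ∸ t)))))))

  -- As a polynomial in b, and then in a, the difference of the two sides has degree < q and vanishes on F.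
  frobenius-+ : ∀ a b → (a + b) ^ q ≋ a ^ q + b ^ q
  frobenius-+ a b = trans (x-y≈0⇒x≈y (vanish step₁ step₂ a)) (+-comm _ _)
    where
    open RingKit polynomialRing using (_-_)
    open PolynomialFunctions polynomialRing
    vanish : ∀ {φ} → DegLT q φ → (∀ x → φ [ x ] ≋ []) → ∀ y → φ y ≋ []
    vanish {φ} D z = DegLT-manyRoots noZeroDivisors D (λ i → [ enum i ]) (λ eq → enum-inj _ _ (at eq 0)) (λ i → z (enum i))
    const^q : ∀ x → [ x ] ^ q ≋ [ x ]
    const^q x = trans (constP-^ x q) (constP-cong (F-x^q≈x x))
    D-const : ∀ k → DegLT q (λ _ → k)
    D-const k with q≢0
    ... | q′ , ≡.refl = DegLT-const k
    const-+ : ∀ b x → (b + [ x ]) ^ q - b ^ q - [ x ] ≋ []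
    const-+ b x = vanish (DegLT-- (DegLT-binomial q [ x ]) (D-const [ x ])) (λ y → begin
      ([ y ] + [ x ]) ^ q - [ y ] ^ q - [ x ] ≈⟨ +-congʳ (+-cong (trans (^-congˡ q (sym (constP-+ y x))) (trans (const^q _) (constP-+ y x))) (-‿cong (const^q y))) ⟩
      [ y ] + [ x ] - [ y ] - [ x ]  ≈⟨ solve 2 (λ x y → y :+ x :- y :- x := con (ℤ.+ 0)) refl [ x ] [ y ] ⟩
      []  ∎) b
      where open ≋-Reasoning
    step₁ : DegLT q (λ y → (y + b) ^ q - (b ^ q + y ^ q))
    step₁ = DegLT-cong (λ y → solve 3 (λ u v w → u :- (v :+ w) := (u :- w) :- v) refl ((y + b) ^ q) (b ^ q) (y ^ q)) (DegLT-- (DegLT-binomial q b) (D-const (b ^ q)))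
    step₂ : ∀ x → ([ x ] + b) ^ q - (b ^ q + [ x ] ^ q) ≋ []
    step₂ x = begin
      ([ x ] + b) ^ q - (b ^ q + [ x ] ^ q)   ≈⟨ +-cong (^-congˡ q (+-comm [ x ] b)) (-‿cong (+-congˡ (const^q x))) ⟩
      (b + [ x ]) ^ q - (b ^ q + [ x ])       ≈⟨ solve 3 (λ u v w → u :- (v :+ w) := u :- v :- w) refl ((b + [ x ]) ^ q) (b ^ q) [ x ] ⟩
      (b + [ x ]) ^ q - b ^ q - [ x ]         ≈⟨ const-+ b x ⟩
      []  ∎
      where open ≋-Reasoning

  -- Raising to the power `q` is additive and fixes the constants, so it acts on the variable alone.
  frobenius : ∀ a → a ^ q ≋ comp a (X ^ q)
  frobenius [] with q≢0
  ... | q′ , ≡.refl = zeroˡ _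
  frobenius (x ∷ a) = begin
    (x ∷ a) ^ q  ≈⟨ ^-congˡ q (∷-X x a) ⟩
    ([ x ] + X * a) ^ q  ≈⟨ frobenius-+ [ x ] (X * a) ⟩
    [ x ] ^ q + (X * a) ^ q  ≈⟨ +-cong (trans (constP-^ x q) (constP-cong (F-x^q≈x x))) (trans (^-distrib-* X a q) (*-congˡ (frobenius a))) ⟩
    [ x ] + X ^ q * comp a (X ^ q)     ∎
    where open ≋-Reasoning

  frobenius-iterate : ∀ r a → a ^ (q ℕ.^ r) ≋ comp a (X ^ (q ℕ.^ r))
  frobenius-iterate zero a = trans (x^1≈x a) (trans (sym (comp-identity a)) (comp-congʳ a (sym (x^1≈x X))))
  frobenius-iterate (suc r) a = begin
    a ^ (q ℕ.* Q)  ≈⟨ ^-assocʳ a q Q ⟨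
    (a ^ q) ^ Q  ≈⟨ frobenius-iterate r (a ^ q) ⟩
    comp (a ^ q) (X ^ Q)  ≈⟨ comp-^ a q (X ^ Q) ⟩
    comp a (X ^ Q) ^ q  ≈⟨ frobenius _ ⟩
    comp (comp a (X ^ Q)) (X ^ q)        ≈⟨ comp-comp a (X ^ Q) (X ^ q) ⟩
    comp a (comp (X ^ Q) (X ^ q))        ≈⟨ comp-congʳ a (trans (comp-X^ Q (X ^ q)) (^-assocʳ X q Q)) ⟩
    comp a (X ^ (q ℕ.* Q))  ∎
    where
    open ≋-Reasoning
    Q = q ℕ.^ r

  replicate-++ : ∀ t p → replicate t F.0# ++ p ≋ X ^ t * p
  replicate-++ zero    p = sym (*-identityˡ p)
  replicate-++ (suc t) p = sym (trans (*-assoc X (X ^ t) p) (trans (X-* _) (∷-cong F.refl (sym (replicate-++ t p)))))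

  substMono≋comp : ∀ a t p → substMono a t p ≋ comp p ([ a ] * X ^ t)
  substMono≋comp a t []      = ≋-refl
  substMono≋comp a t (b ∷ p) = trans (reflexive (≡.sym (⊕≡+ₚ [ b ] _))) (+-congˡ (trans (replicate-++ t _)
    (trans (*-congˡ (trans (sym ([ a ]⊗ _)) (*-congˡ (substMono≋comp a t p))))
      (solve 3 (λ x a p → x :* (a :* p) := a :* x :* p) refl (X ^ t) [ a ] (comp p ([ a ] * X ^ t))))))

  substPow≋comp : ∀ n p → substPow n p ≋ comp p (X ^ n)
  substPow≋comp n p = trans (substMono≋comp F.1# n p) (comp-congʳ p (*-identityˡ _))

  xPowMinusOne≋ : ∀ n → xPowMinusOne n ≋ X ^ n + [ F.- F.1# ]
  xPowMinusOne≋ n = trans (reflexive (≡.sym (⊕≡+ₚ _ [ F.- F.1# ]))) (+-congʳ (trans (replicate-++ n oneP) (*-identityʳ _)))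

-- Irreducibility of f(x^p)

module PowerSubstitution {c ℓ} (F : Field c ℓ) (q : ℕ) (card : HasCardinality F q) where
  open Substitution F q card public

  asEq : ∀ p r → p ≈ₚ r → p ≋ r
  asEq p r = mk

  Irreducible-cong : ∀ {f g} → f ≋ g → Irreducible f → Irreducible g
  Irreducible-cong {f} {g} e (f≉0 , ¬unit , irr) =
    (λ z → f≉0 (at (trans e (asEq g [] z)))) ,
    (λ { (a , a≉0 , z) → ¬unit (a , a≉0 , at (trans e (asEq g [ a ] z))) }) ,
    (λ a b z → irr a b (at (trans e (asEq g (a *ₚ b) z))))

  IsUnitP-cong : ∀ {f g} → f ≋ g → IsUnitP f → IsUnitP g
  IsUnitP-cong {f} e (a , a≉0 , z) = a , a≉0 , at (trans (sym e) (asEq f [ a ] z))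

  IsUnitP-scale : ∀ {f} a → ¬ a F.≈ F.0# → IsUnitP f → IsUnitP ([ a ] * f)
  IsUnitP-scale {f} a a≉0 (b , b≉0 , z) = a F.* b , *-≉0 a≉0 b≉0 , at (trans (*-congˡ (asEq f [ b ] z)) (constP-* a b))

  unscale : ∀ a → ¬ a F.≈ F.0# → ∀ f → [ a ⁻¹ ] * ([ a ] * f) ≋ f
  unscale a a≉0 f = trans (sym (*-assoc _ _ f)) (trans (*-congʳ (constP-inverse a a≉0)) (*-identityˡ f))

  rescale : ∀ a → ¬ a F.≈ F.0# → ∀ f → [ a ] * ([ a ⁻¹ ] * f) ≋ f
  rescale a a≉0 f = trans (solve 3 (λ a b f → a :* (b :* f) := b :* (a :* f)) refl [ a ] [ a ⁻¹ ] f) (unscale a a≉0 f)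

  toIrreducible : ∀ {f D l} → Lead f (suc D) l → (∀ g h → f ≋ g * h → IsUnitP g ⊎ IsUnitP h) → Irreducible f
  toIrreducible {f} L irr =
    (λ z → Lead⇒≉0 L (asEq f [] z)) ,
    (λ u → ℕP.1+n≢0 (proj₁ (Lead-unique refl L (unit⇒Lead-0 u)))) ,
    (λ g h e → irr g h (trans (asEq f (g *ₚ h) e) (reflexive (≡.sym (⊗≡*ₚ g h)))))

  fromIrreducible : ∀ {f} → Irreducible f → ∀ g h → f ≋ g * h → IsUnitP g ⊎ IsUnitP h
  fromIrreducible (_ , _ , irr) g h e = irr g h (at (trans e (reflexive (⊗≡*ₚ g h))))

  irreducible-degree : ∀ {f D l} → Irreducible f → Lead f D l → ∃[ D′ ] D ≡ suc D′
  irreducible-degree {D = zero}  (_ , ¬unit , _) L = ⊥-elim (¬unit (Lead-0⇒unit L))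
  irreducible-degree {D = suc _} _ L = _ , ≡.refl

  Irreducible-scale : ∀ {f D l} a → ¬ a F.≈ F.0# → Lead f D l → Irreducible f → Irreducible ([ a ] * f)
  Irreducible-scale {f} a a≉0 L irr with irreducible-degree irr L
  ... | D′ , ≡.refl = toIrreducible (Lead-* (Lead-[] a≉0 refl) L) split
    where
    split : ∀ g h → [ a ] * f ≋ g * h → IsUnitP g ⊎ IsUnitP h
    split g h e = case fromIrreducible irr ([ a ⁻¹ ] * g) h
      (trans (sym (unscale a a≉0 f)) (trans (*-congˡ e) (sym (*-assoc _ g h)))) of λ where
      (inj₁ u) → inj₁ (IsUnitP-cong (rescale a a≉0 g) (IsUnitP-scale a a≉0 u))
      (inj₂ u) → inj₂ u

  dilate : F.Carrier → Pol → Pol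
  dilate a f = comp f ([ a ] * X)

  Lead-[]*X : ∀ {a} → ¬ a F.≈ F.0# → Lead ([ a ] * X) 1 a
  Lead-[]*X {a} a≉0 = Lead-≈ (F.*-identityʳ a) (Lead-* (Lead-[] a≉0 refl) Lead-X)

  Lead-dilate : ∀ {f D l} a → ¬ a F.≈ F.0# → Lead f D l → Lead (dilate a f) D (l F.* a F.^ D)
  Lead-dilate {f} {D} {l} a a≉0 L = ≡.subst (λ n → Lead (dilate a f) n (l F.* a F.^ D)) (ℕP.*-identityʳ D) (Lead-comp L (Lead-[]*X a≉0))

  comp-[]*X : ∀ a b → comp ([ a ] * X) b ≋ [ a ] * b
  comp-[]*X a b = trans (comp-* [ a ] X b) (*-cong (comp-const a b) (comp-X b))

  dilate-dilate : ∀ a b f → dilate b (dilate a f) ≋ dilate (a F.* b) f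
  dilate-dilate a b f = trans (comp-comp f _ _) (comp-congʳ f (trans (comp-[]*X a _) (trans (sym (*-assoc _ _ X)) (*-congʳ (constP-* a b)))))

  dilate-cong : ∀ {a b} f → a F.≈ b → dilate a f ≋ dilate b f
  dilate-cong f e = comp-congʳ f (*-congʳ (constP-cong e))

  dilate-1 : ∀ f → dilate F.1# f ≋ f
  dilate-1 f = trans (comp-congʳ f (*-identityˡ X)) (comp-identity f)

  Irreducible-dilate : ∀ {f D l} a → ¬ a F.≈ F.0# → Lead f D l → Irreducible f → Irreducible (dilate a f)
  Irreducible-dilate {f} a a≉0 L irr with irreducible-degree irr L
  ... | D′ , ≡.refl = toIrreducible (Lead-dilate a a≉0 L) split
    where
    unit-dilate : ∀ g → IsUnitP (dilate (a ⁻¹) g) → IsUnitP g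
    unit-dilate g (b , b≉0 , z) = b , b≉0 , at (trans (sym (trans (dilate-dilate _ a g)
      (trans (dilate-cong g (F.trans (F.*-comm _ a) (⁻¹-inverse a a≉0))) (dilate-1 g)))) (trans (comp-congˡ _ (asEq (dilate (a ⁻¹) g) [ b ] z)) (comp-const b ([ a ] * X))))
    split : ∀ g h → dilate a f ≋ g * h → IsUnitP g ⊎ IsUnitP h
    split g h e = case fromIrreducible irr (dilate (a ⁻¹) g) (dilate (a ⁻¹) h)
      (trans (sym (trans (dilate-dilate a (a ⁻¹) f) (trans (dilate-cong f (⁻¹-inverse a a≉0)) (dilate-1 f))))
        (trans (comp-congˡ _ e) (comp-* g h _))) of λ where
      (inj₁ u) → inj₁ (unit-dilate g u)
      (inj₂ u) → inj₂ (unit-dilate h u)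

  Lead-prod : ∀ n {g : ℕ → Pol} {A} {l : ℕ → F.Carrier} → (∀ j → Lead (g j) A (l j)) → Lead (prod n g) (n ℕ.* A) (F.prod n l)
  Lead-prod zero    h = Lead-1
  Lead-prod (suc n) {g} {A} {l} h = ≡.subst (λ k → Lead (prod (suc n) g) k (F.prod (suc n) l)) (ℕP.+-comm (n ℕ.* A) A) (Lead-* (Lead-prod n h) (h (suc n)))

  coeff-prod-0 : ∀ n (g : ℕ → Pol) → coeff (prod n g) 0 F.≈ F.prod n (λ j → coeff (g j) 0)
  coeff-prod-0 zero    g = F.refl
  coeff-prod-0 (suc n) g = F.trans (coeff-*-0′ (prod n g) (g (suc n))) (F.*-congʳ (coeff-prod-0 n g))

  module RootOfUnity (ω : F.Carrier) (t : ℕ)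
                     (ω^p≈1 : ω F.^ suc t F.≈ F.1#) (order : ∀ i → ω F.^ i F.≈ F.1# → suc t ∣ i) where
    private
      p : ℕ
      p = suc t

    σ : F.Carrier
    σ = F.prod p (λ j → ω F.^ j)

    ω≉0 : ¬ ω F.≈ F.0#
    ω≉0 z = 1≉0 (F.trans (F.sym ω^p≈1) (F.trans (F.*-congʳ z) (F.zeroˡ _)))

    norm : Pol → Pol
    norm a = prod p (λ j → dilate (ω F.^ j) a)

    norm-* : ∀ a b → norm (a * b) ≋ norm a * norm b
    norm-* a b = trans (prod-cong p (λ j _ _ → comp-* a b _)) (prod-* p _ _)

    -- The substitution x ↦ ωx permutes the factors cyclically, since `ω ^ suc p` equals `ω ^ 1`.
    norm-invariant : ∀ a → dilate ω (norm a) ≋ norm a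
    norm-invariant a = trans (comp-prod p _ _) (trans
      (prod-cong p (λ j _ _ → trans (dilate-dilate _ ω a) (dilate-cong a (F.*-comm _ ω))))
      (prod-shift p (λ j → dilate (ω F.^ j) a) (dilate-cong a (F.*-congˡ ω^p≈1))))

    -- The substitution multiplies the coefficient at i by ω^i, so invariance forces it to vanish
    -- unless ω^i = 1, that is unless p divides i.
    invariant⇒comp : ∀ a → dilate ω a ≋ a → ∃[ s ] a ≋ comp s (X ^ p)
    invariant⇒comp a e = multiples⇒comp-X^ t a vanish
      where
      vanish : ∀ j r → 1 ≤ r → r ≤ t → coeff a (j ℕ.* p ℕ.+ r) F.≈ F.0#
      vanish j r 1≤r r≤t = case F-noZeroDivisors {ω F.^ (j ℕ.* p ℕ.+ r) F.- F.1#} {coeff a (j ℕ.* p ℕ.+ r)}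
        (F.trans (F.solve 2 (λ w x → (w F.:- F.con (ℤ.+ 1)) F.:* x F.:= w F.:* x F.:- x) F.refl _ _)
          (F.x≈y⇒x-y≈0 (F.trans (F.sym (coeff-dilate a ω _)) (at e (j ℕ.* p ℕ.+ r))))) of λ where
        (inj₂ z) → z
        (inj₁ z) → ⊥-elim (ℕP.<⇒≱ (s≤s r≤t) (∣⇒≤ {{ℕ.>-nonZero 1≤r}} (∣m+n∣m⇒∣n (order _ (F.x-y≈0⇒x≈y z)) (n∣m*n j))))

    -- The polynomial N(a) with norm of `a` equal to N(a)(X^p). The norm has degree pA, so N(a) has
    -- degree A. Replacing x by ω^j x multiplies the leading coefficient by ω^(jA), which
    -- accumulates to `σ ^ A`; the constant term is not affected.
    record Norm (a : Pol) (A : ℕ) (l : F.Carrier) : Set (c ⊔ ℓ) where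
      field
        root       : Pol
        norm≋comp  : norm a ≋ comp root (X ^ p)
        lead       : Lead root A (l F.^ p F.* σ F.^ A)
        constant   : coeff root 0 F.≈ coeff a 0 F.^ p

    getNorm : ∀ {a A l} → Lead a A l → Norm a A l
    getNorm {a} {A} {l} L = record { root = s ; norm≋comp = e ; lead = lead-s ; constant = constant-s }
      where
      s = proj₁ (invariant⇒comp (norm a) (norm-invariant a))
      e = proj₂ (invariant⇒comp (norm a) (norm-invariant a))
      lead-norm : Lead (norm a) (p ℕ.* A) (l F.^ p F.* σ F.^ A)
      lead-norm = Lead-≈ (F.trans (F.prod-* p (λ _ → l) (λ j → (ω F.^ j) F.^ A)) (F.*-cong (F.prod-const p l) (F.sym (F.prod-^ p (λ j → ω F.^ j) A))))
        (Lead-prod p (λ j → Lead-dilate (ω F.^ j) (^-≉0 j ω≉0) L))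
      lead-s : Lead s A (l F.^ p F.* σ F.^ A)
      lead-s = case lead? s of λ
        { (inj₁ z) → ⊥-elim (Lead⇒≉0 lead-norm (trans e (comp-zero s _ z)))
        ; (inj₂ (n , l′ , M)) → descend M (Lead-unique e lead-norm (Lead-comp M (Lead-X^ p))) }
        where
        descend : ∀ {n l′} → Lead s n l′ → p ℕ.* A ≡ n ℕ.* p × l F.^ p F.* σ F.^ A F.≈ l′ F.* F.1# F.^ n → Lead s A (l F.^ p F.* σ F.^ A)
        descend {n} {l′} M (pA≡np , eq) = ≡.subst (λ k → Lead s k _) (ℕP.*-cancelʳ-≡ n A p (≡.trans (≡.sym pA≡np) (ℕP.*-comm p A)))
          (Lead-≈ (F.sym (F.trans eq (F.trans (F.*-congˡ (F.1^n≈1 n)) (F.*-identityʳ l′)))) M)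
      constant-s : coeff s 0 F.≈ coeff a 0 F.^ p
      constant-s = F.trans (F.sym (comp-0 s (F.trans (coeff-*-0′ X (X ^ t)) (F.zeroˡ _)))) (F.trans (F.sym (at e 0))
        (F.trans (coeff-prod-0 p _) (F.trans (F.prod-cong p (λ j _ _ → comp-0 a (F.trans (coeff-*-0′ [ ω F.^ j ] X) (F.zeroʳ _)))) (F.prod-const p _))))

    -- Since (ω^j)^p = 1, each of the p substitutions fixes `comp f (X ^ p)`, so its norm is its
    -- p-th power.
    norm-comp : ∀ f → norm (comp f (X ^ p)) ≋ comp (f ^ p) (X ^ p)
    norm-comp f = trans (prod-cong p (λ j _ _ → trans (comp-comp f _ _) (comp-congʳ f (trans (comp-X^ p _)
      (trans (^-distrib-* [ ω F.^ j ] X p) (trans (*-congʳ (trans (constP-^ _ p) (constP-cong (ω^jp≈1 j)))) (*-identityˡ _)))))))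
      (trans (prod-const p _) (sym (comp-^ f p _)))
      where
      ω^jp≈1 : ∀ j → (ω F.^ j) F.^ p F.≈ F.1#
      ω^jp≈1 j = F.trans (F.^-comm ω j p) (F.trans (F.^-congˡ j ω^p≈1) (F.1^n≈1 j))

    -- Taking norms in f(X^p) = a b gives N(a) N(b) = f^p, so N(a) is x f^i; compare leading and constant coefficients.
    factor-dichotomy : ∀ {f D l} → Irreducible f → Lead f D l → ∀ a b → comp f (X ^ p) ≋ a * b →
      (IsUnitP a ⊎ IsUnitP b) ⊎
      ∃[ i ] ∃[ x ] ∃[ y ] 1 ≤ i × i < p × ¬ y F.≈ F.0# × x F.^ p F.* l F.^ i F.≈ y F.^ p F.* (σ F.^ D F.* coeff f 0) F.^ i
    factor-dichotomy {f} {D} {l} irr L a b e = case lead? a of λ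
      { (inj₁ z) → ⊥-elim (Lead⇒≉0 (Lead-comp L (Lead-X^ p)) (trans e (trans (*-congʳ z) (zeroˡ b))))
      ; (inj₂ (_ , _ , La)) → case lead? b of λ
        { (inj₁ z) → ⊥-elim (Lead⇒≉0 (Lead-comp L (Lead-X^ p)) (trans e (trans (*-congˡ z) (zeroʳ a))))
        ; (inj₂ (_ , _ , Lb)) → compare La Lb (getNorm La) (getNorm Lb) } }
      where
      f₀ = coeff f 0
      Result = (IsUnitP a ⊎ IsUnitP b) ⊎
        ∃[ i ] ∃[ x ] ∃[ y ] 1 ≤ i × i < p × ¬ y F.≈ F.0# × x F.^ p F.* l F.^ i F.≈ y F.^ p F.* (σ F.^ D F.* f₀) F.^ i

      compare : ∀ {A B lₐ l_b} → Lead a A lₐ → Lead b B l_b → Norm a A lₐ → Norm b B l_b → Result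
      compare {A} {B} {lₐ} La Lb Na Nb = analyse (factorsOfPower irr p (Norm.root Na) (Norm.root Nb) (comp-X^-injective t roots))
        where
        roots : comp (Norm.root Na * Norm.root Nb) (X ^ p) ≋ comp (f ^ p) (X ^ p)
        roots = begin
          comp (Norm.root Na * Norm.root Nb) (X ^ p)  ≈⟨ comp-* _ _ _ ⟩
          comp (Norm.root Na) (X ^ p) * comp (Norm.root Nb) (X ^ p) ≈⟨ *-cong (Norm.norm≋comp Na) (Norm.norm≋comp Nb) ⟨
          norm a * norm b  ≈⟨ norm-* a b ⟨
          norm (a * b)  ≈⟨ prod-cong p (λ j _ _ → comp-congˡ _ e) ⟨
          norm (comp f (X ^ p))  ≈⟨ norm-comp f ⟩
          comp (f ^ p) (X ^ p)  ∎
          where open ≋-Reasoning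
        degree0⇒unit : ∀ {r n l} → n ≡ 0 → Lead r n l → IsUnitP r
        degree0⇒unit ≡.refl = Lead-0⇒unit
        degree-[]*1 : ∀ {s n l x} → ¬ x F.≈ F.0# → Lead s n l → s ≋ [ x ] * oneP → n ≡ 0
        degree-[]*1 x≉0 L e = proj₁ (Lead-unique e L (Lead-* (Lead-[] x≉0 refl) Lead-1))
        coeff-^-0 : ∀ k → coeff (f ^ k) 0 F.≈ f₀ F.^ k
        coeff-^-0 zero    = F.refl
        coeff-^-0 (suc k) = F.trans (coeff-*-0′ f (f ^ k)) (F.*-congˡ (coeff-^-0 k))

        -- If N(a) = x f^i, its constant terms give a(0)^p = x f(0)^i and its leading terms give
        -- lₐ^p σ^A = x l^i. Eliminating `x` leaves the claim, where A = iD turns σ^A into (σ^D)^i.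
        coefficients : ∀ i x → ¬ x F.≈ F.0# → Norm.root Na ≋ [ x ] * f ^ i →
          coeff a 0 F.^ p F.* l F.^ i F.≈ lₐ F.^ p F.* (σ F.^ D F.* f₀) F.^ i
        coefficients i x x≉0 ea = begin
          coeff a 0 F.^ p F.* l F.^ i  ≈⟨ F.*-congʳ (Norm.constant Na) ⟨
          coeff (Norm.root Na) 0 F.* l F.^ i      ≈⟨ F.*-congʳ (F.trans (at ea 0) (F.trans (coeff-*-0′ [ x ] (f ^ i)) (F.*-congˡ (coeff-^-0 i)))) ⟩
          x F.* f₀ F.^ i F.* l F.^ i  ≈⟨ F.solve 3 (λ x f l → x F.:* f F.:* l F.:= x F.:* l F.:* f) F.refl x (f₀ F.^ i) (l F.^ i) ⟩
          x F.* l F.^ i F.* f₀ F.^ i  ≈⟨ F.*-congʳ (proj₂ leads) ⟨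
          lₐ F.^ p F.* σ F.^ A F.* f₀ F.^ i       ≈⟨ F.*-assoc _ _ _ ⟩
          lₐ F.^ p F.* (σ F.^ A F.* f₀ F.^ i)     ≈⟨ F.*-congˡ (F.*-congʳ (F.trans (F.^-congʳ σ (≡.trans (proj₁ leads) (ℕP.*-comm i D))) (F.sym (F.^-assocʳ σ D i)))) ⟩
          lₐ F.^ p F.* ((σ F.^ D) F.^ i F.* f₀ F.^ i) ≈⟨ F.*-congˡ (F.^-distrib-* _ _ i) ⟨
          lₐ F.^ p F.* (σ F.^ D F.* f₀) F.^ i     ∎
          where
          open import Relation.Binary.Reasoning.Setoid F.setoid
          leads = Lead-unique ea (Norm.lead Na) (Lead-* (Lead-[] x≉0 refl) (Lead-^ i L))

        -- An exponent 0 makes N(a) or N(b) constant, and `a` and N(a) have the same degree.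
        -- Otherwise both exponents are positive, whence i < p.
        analyse : (∃[ i ] ∃[ j ] ∃[ x ] ∃[ y ] i ℕ.+ j ≡ p × ¬ x F.≈ F.0# × ¬ y F.≈ F.0# ×
          Norm.root Na ≋ [ x ] * f ^ i × Norm.root Nb ≋ [ y ] * f ^ j) → Result
        analyse (zero  , j    , x , y , _ , x≉0 , _ , ea , _) = inj₁ (inj₁ (degree0⇒unit (degree-[]*1 x≉0 (Norm.lead Na) ea) La))
        analyse (suc i , zero , x , y , _ , _ , y≉0 , _ , eb) = inj₁ (inj₂ (degree0⇒unit (degree-[]*1 y≉0 (Norm.lead Nb) eb) Lb))
        analyse (suc i , suc j , x , y , i+j≡p , x≉0 , _ , ea , _) = inj₂ (suc i , coeff a 0 , lₐ , s≤s z≤n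
          , ≡.subst (suc (suc i) ℕ.≤_) (≡.trans (≡.sym (ℕP.+-suc (suc i) j)) i+j≡p) (s≤s (ℕP.m≤m+n (suc i) j))
          , nonzero La , coefficients (suc i) x x≉0 ea)

  -- The norm (−1)^D f(0)/l of a root of f, and its powers prime to p, are not p-th powers;
  -- the sign (−1)^(p−1) appears as the product of all p-th roots of unity.
  record NormNotPower (p D : ℕ) (l f₀ : F.Carrier) : Set (c ⊔ ℓ) where
    field
      ω      : F.Carrier
      ω^p≈1  : ω F.^ p F.≈ F.1#
      order  : ∀ i → ω F.^ i F.≈ F.1# → p ∣ i
      notPower : ∀ i x y → 1 ≤ i → i < p → ¬ y F.≈ F.0# →
        ¬ x F.^ p F.* l F.^ i F.≈ y F.^ p F.* (F.prod p (λ j → ω F.^ j) F.^ D F.* f₀) F.^ i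

  NormNotPower-cong : ∀ {p D l f₀ g₀} → f₀ F.≈ g₀ → NormNotPower p D l f₀ → NormNotPower p D l g₀
  NormNotPower-cong f₀≈g₀ N = record { ω = ω ; ω^p≈1 = ω^p≈1 ; order = order
    ; notPower = λ i x y 1≤i i<p y≉0 eq → notPower i x y 1≤i i<p y≉0 (F.trans eq (F.*-congˡ (F.^-congˡ i (F.*-congˡ (F.sym f₀≈g₀))))) }
    where open NormNotPower N

  irreducible-primePower : ∀ {f D l} p → Prime p → Irreducible f → Lead f D l → NormNotPower p D l (coeff f 0) → Irreducible (comp f (X ^ p))
  irreducible-primePower zero pr irr L H = ⊥-elim (¬prime[0] pr)
  irreducible-primePower {f} p@(suc t) pr irr L H with irreducible-degree irr L
  ... | D′ , ≡.refl = toIrreducible (Lead-comp L (Lead-X^ p)) conclude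
    where
    open NormNotPower H
    conclude : ∀ g h → comp f (X ^ p) ≋ g * h → IsUnitP g ⊎ IsUnitP h
    conclude g h e = case RootOfUnity.factor-dichotomy ω t ω^p≈1 order irr L g h e of λ
      { (inj₁ u) → u
      ; (inj₂ (i , x , y , 1≤i , i<p , y≉0 , eq)) → ⊥-elim (notPower i x y 1≤i i<p y≉0 eq) }

  -- The primes of the exponent are adjoined one at a time: substituting X^p in f(X^s) gives
  -- f(X^(ps)). Every intermediate f(X^s) has degree Ds and the end coefficients of `f`, hence the
  -- form of the hypothesis, which covers all s that can occur.
  irreducible-comp-X^ : ∀ {f D l} → Irreducible f → Lead f D l → ∀ ps → All Prime ps →
    (∀ p s → Prime p → p ℕ.* s ∣ product ps → NormNotPower p (D ℕ.* s) l (coeff f 0)) →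
    Irreducible (comp f (X ^ product ps))
  irreducible-comp-X^ {f} irr L [] _ H = Irreducible-cong (sym (trans (comp-congʳ f (x^1≈x X)) (comp-identity f))) irr
  irreducible-comp-X^ {f} {D} {l} irr L (p ∷ ps) (pr ∷ prs) H =
    Irreducible-cong (trans (comp-comp f _ _) (comp-congʳ f (trans (comp-X^ s (X ^ p)) (^-assocʳ X p s))))
      (irreducible-primePower p pr (irreducible-comp-X^ irr L ps prs λ p′ s′ pr′ div → H p′ s′ pr′ (∣-trans div (n∣m*n p))) lead
        (NormNotPower-cong (F.sym (comp-0 f coeff-X^s)) (H p s pr ∣-refl)))
    where
    s = product ps
    s≢0 : ∃[ s′ ] s ≡ suc s′
    s≢0 with s | product≢0 (All.map prime⇒nonZero prs)
    ... | suc s′ | _ = s′ , ≡.refl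
    coeff-X^s : coeff (X ^ s) 0 F.≈ F.0#
    coeff-X^s with s | s≢0
    ... | _ | s′ , ≡.refl = F.trans (coeff-*-0′ X (X ^ s′)) (F.zeroˡ _)
    lead : Lead (comp f (X ^ s)) (D ℕ.* s) l
    lead with s | s≢0
    ... | _ | s′ , ≡.refl = Lead-≈ (F.trans (F.*-congˡ (F.1^n≈1 D)) (F.*-identityʳ l)) (Lead-comp L (Lead-X^ (suc s′)))

-- Roots of an irreducible factor of x^e − 1

leastWitness : ∀ {ℓ} (P : ℕ → Set ℓ) → (∀ j → Dec (P j)) → ∀ k → 1 ≤ k → P k →
  ∃[ r ] 1 ≤ r × P r × (∀ j → 1 ≤ j → j < r → ¬ P j)
leastWitness P P? k 1≤k Pk = go k k 1≤k Pk ℕP.≤-refl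
  where
  search : ∀ k → (∃[ j ] 1 ≤ j × j < k × P j) ⊎ (∀ j → 1 ≤ j → j < k → ¬ P j)
  search zero = inj₂ λ _ _ ()
  search (suc k) with search k
  ... | inj₁ (j , 1≤j , j<k , Pj) = inj₁ (j , 1≤j , ℕP.m≤n⇒m≤1+n j<k , Pj)
  ... | inj₂ none with P? k | 1 ℕ.≤? k
  ...   | yes Pk | yes 1≤k = inj₁ (k , 1≤k , ℕP.≤-refl , Pk)
  ...   | yes Pk | no  k<1 = inj₂ λ j 1≤j j≤k _ → k<1 (ℕP.≤-trans 1≤j (ℕ.s≤s⁻¹ j≤k))
  ...   | no ¬Pk | _ = inj₂ λ j 1≤j j≤k Pj → case ℕP.m≤n⇒m<n∨m≡n (ℕ.s≤s⁻¹ j≤k) of λ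
    { (inj₁ j<k) → none j 1≤j j<k Pj ; (inj₂ ≡.refl) → ¬Pk Pj }
  go : ∀ fuel k → 1 ≤ k → P k → k ≤ fuel → ∃[ r ] 1 ≤ r × P r × (∀ j → 1 ≤ j → j < r → ¬ P j)
  go zero k 1≤k Pk k≤0 = ⊥-elim (ℕP.<⇒≱ 1≤k k≤0)
  go (suc fuel) k 1≤k Pk k≤ with search k
  ... | inj₂ none = k , 1≤k , Pk , none
  ... | inj₁ (j , 1≤j , j<k , Pj) = go fuel j 1≤j Pj (ℕ.s≤s⁻¹ (ℕP.≤-trans j<k k≤))

module RootField {c ℓ} (F : Field c ℓ) (q : ℕ) (card : HasCardinality F q) where
  open PowerSubstitution F q card public
  open HasCardinality card

  2≤q : 2 ≤ q
  2≤q = distinct⇒2≤ (proj₁ (enum-surj F.0#)) (proj₁ (enum-surj F.1#))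
    (λ eq → 0≉1 (F.trans (F.sym (proj₂ (enum-surj F.0#))) (F.trans (F.reflexive (≡.cong enum eq)) (proj₂ (enum-surj F.1#)))))
    where
    distinct⇒2≤ : ∀ {n} (i j : Fin n) → ¬ i ≡ j → 2 ≤ n
    distinct⇒2≤ {1} zero zero i≢j = ⊥-elim (i≢j ≡.refl)
    distinct⇒2≤ {suc (suc n)} _ _ _ = s≤s (s≤s z≤n)

  1≤q^ : ∀ r → 1 ≤ q ℕ.^ r
  1≤q^ r = ℕP.m^n>0 q {{ℕ.>-nonZero (ℕP.≤-trans (s≤s z≤n) 2≤q)}} r

  -- Base-q digits as coefficients. For `n` the degree of an irreducible `f`, this supplies q^n
  -- pairwise incongruent residues modulo `f`.
  polynomialOf : ∀ n → Fin (q ℕ.^ n) → Pol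
  polynomialOf zero    i = []
  polynomialOf (suc n) i = enum (proj₁ (Fin.remQuot (q ℕ.^ n) i)) ∷ polynomialOf n (proj₂ (Fin.remQuot {q} (q ℕ.^ n) i))

  length-polynomialOf : ∀ n i → length (polynomialOf n i) ≡ n
  length-polynomialOf zero    i = ≡.refl
  length-polynomialOf (suc n) i = ≡.cong suc (length-polynomialOf n _)

  polynomialOf-injective : ∀ n {i j} → polynomialOf n i ≋ polynomialOf n j → i ≡ j
  polynomialOf-injective zero {zero} {zero} e = ≡.refl
  polynomialOf-injective (suc n) {i} {j} e = ≡.trans (≡.sym (FinP.combine-remQuot {q} (q ℕ.^ n) i))
    (≡.trans (≡.cong₂ Fin.combine (enum-inj _ _ (at e 0)) (polynomialOf-injective n (tail-cong e))) (FinP.combine-remQuot {q} (q ℕ.^ n) j))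

  module Modulo (g : Pol) where
    open PrincipalQuotient polynomialRing g
    private module K = RingKit quotientRing

    comp-∼-cong : ∀ a {b b′} → b ∼ b′ → comp a b ∼ comp a b′
    comp-∼-cong []      e = K.refl
    comp-∼-cong (x ∷ a) e = K.+-congˡ {[ x ]} (K.*-cong e (comp-∼-cong a e))

    -- With Q = q^r, a^Q = a(X^Q) ∼ a(X) = a, so fixing the class of X is enough. The modulus is
    -- arbitrary, because the statement is used modulo `f` and also modulo its square.
    fixes-all : ∀ {r} → X ^ (q ℕ.^ r) ∼ X → ∀ a → a ^ (q ℕ.^ r) ∼ a
    fixes-all {r} e a = K.trans (≈⇒∼ (frobenius-iterate r a)) (K.trans (comp-∼-cong a e) (≈⇒∼ (comp-identity a)))

    ^∼1-∣ : ∀ {a i j} → a ^ i ∼ oneP → i ∣ j → a ^ j ∼ oneP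
    ^∼1-∣ {a} {i} e (divides z ≡.refl) = K.trans (≈⇒∼ (trans (^-congʳ a (ℕP.*-comm z i)) (sym (^-assocʳ a i z)))) (K.trans (K.^-congˡ z e) (≈⇒∼ (1^n≈1 z)))

    ^∼1⇒fixes : ∀ {e k} → X ^ e ∼ oneP → e ∣ q ℕ.^ k ∸ 1 → X ^ (q ℕ.^ k) ∼ X
    ^∼1⇒fixes {e} {k} X^e∼1 e∣ = K.trans (≈⇒∼ (^-congʳ X (≡.sym (ℕP.m+[n∸m]≡n (1≤q^ k)))))
      (K.trans (K.*-congˡ {X} (^∼1-∣ {X} X^e∼1 e∣)) (≈⇒∼ (*-identityʳ X)))

    -- X is a unit modulo `g`, with inverse X^(e-1), and may be cancelled from X^Q ∼ X; the chain
    -- multiplies by X^e and regroups.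
    fixes⇒^∼1 : ∀ {e k} → 1 ≤ e → X ^ e ∼ oneP → X ^ (q ℕ.^ k) ∼ X → X ^ (q ℕ.^ k ∸ 1) ∼ oneP
    fixes⇒^∼1 {e} {k} 1≤e X^e∼1 fix = begin
      X ^ (Q ∸ 1)  ≈⟨ ≈⇒∼ (*-identityʳ _) ⟨
      X ^ (Q ∸ 1) * oneP  ≈⟨ K.*-congˡ {X ^ (Q ∸ 1)} X^e∼1 ⟨
      X ^ (Q ∸ 1) * X ^ e  ≈⟨ ≈⇒∼ (*-congˡ (^-congʳ X (≡.sym (ℕP.m+[n∸m]≡n 1≤e)))) ⟩
      X ^ (Q ∸ 1) * (X * X ^ (e ∸ 1)) ≈⟨ ≈⇒∼ (solve 3 (λ a x b → a :* (x :* b) := (x :* a) :* b) refl _ X _) ⟩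
      (X * X ^ (Q ∸ 1)) * X ^ (e ∸ 1) ≈⟨ ≈⇒∼ (*-congʳ (^-congʳ X (ℕP.m+[n∸m]≡n (1≤q^ k)))) ⟩
      X ^ Q * X ^ (e ∸ 1)  ≈⟨ K.*-congʳ {X ^ (e ∸ 1)} fix ⟩
      X * X ^ (e ∸ 1)  ≈⟨ ≈⇒∼ (^-congʳ X (ℕP.m+[n∸m]≡n 1≤e)) ⟩
      X ^ e  ≈⟨ X^e∼1 ⟩
      oneP  ∎
      where
      open import Relation.Binary.Reasoning.Setoid K.setoid
      Q = q ℕ.^ k

    ^∼1-gcd : ∀ {i j} → X ^ i ∼ oneP → X ^ j ∼ oneP → X ^ gcd i j ∼ oneP
    ^∼1-gcd {i} {j} ei ej = use (Bézout.identity (gcd-GCD i j))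
      where
      cancel : ∀ {g x y i j} → X ^ i ∼ oneP → X ^ j ∼ oneP → g ℕ.+ y ℕ.* j ≡ x ℕ.* i → X ^ g ∼ oneP
      cancel {g} {x} {y} {i} {j} ei ej eq = begin
        X ^ g  ≈⟨ ≈⇒∼ (*-identityʳ _) ⟨
        X ^ g * oneP  ≈⟨ K.*-congˡ {X ^ g} (^∼1-∣ {X} ej (n∣m*n y)) ⟨
        X ^ g * X ^ (y ℕ.* j)      ≈⟨ ≈⇒∼ (^-homo-* X g (y ℕ.* j)) ⟨
        X ^ (g ℕ.+ y ℕ.* j)        ≈⟨ ≈⇒∼ (^-congʳ X eq) ⟩
        X ^ (x ℕ.* i)  ≈⟨ ^∼1-∣ {X} ei (n∣m*n x) ⟩
        oneP  ∎
        where open import Relation.Binary.Reasoning.Setoid K.setoid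
      use : Bézout.Identity (gcd i j) i j → X ^ gcd i j ∼ oneP
      use (Bézout.+- x y eq) = cancel {gcd i j} {x} {y} ei ej eq
      use (Bézout.-+ x y eq) = cancel {gcd i j} {y} {x} ej ei eq

  module _ {f : Pol} {D : ℕ} (irr : Irreducible f) (L : Lead f D F.1#) where
    open Modulo f using (comp-∼-cong; fixes-all)
    private
      open PrincipalQuotient polynomialRing f using (quotientRing; ≈⇒∼; multiple⇒∼0; ∼0⇒multiple) renaming (_∼_ to infix 4 _∼_)
      module K = RingKit quotientRing
      open PolynomialFunctions quotientRing
      nzd : NoZeroDivisors quotientRing
      nzd = quotient-noZeroDivisors irr
      module K-Reasoning where
        open import Relation.Binary.Reasoning.Setoid K.setoid public

    1≤D : 1 ≤ D
    1≤D = case irreducible-degree irr L of λ { (_ , ≡.refl) → s≤s z≤n }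

    ∼? : ∀ a b → Dec (a ∼ b)
    ∼? a b = case ∣ₚ? L (a K.- b) of λ
      { (yes (k , e)) → yes (K.x-y≈0⇒x≈y (multiple⇒∼0 k e))
      ; (no ∤) → no λ a∼b → ∤ (∼0⇒multiple (K.x≈y⇒x-y≈0 a∼b)) }

    -- A nonzero multiple of `f` has degree at least `D`, whereas the difference of the two residues
    -- has degree below `D`.
    reduced-unique : ∀ {a b} → (∀ i → D ≤ i → coeff a i F.≈ F.0#) → (∀ i → D ≤ i → coeff b i F.≈ F.0#) → a ∼ b → a ≋ b
    reduced-unique {a} {b} low-a low-b a∼b = case lead? (a K.- b) of λ
      { (inj₁ z) → x-y≈0⇒x≈y z
      ; (inj₂ (n , _ , M)) → ⊥-elim (nonzero M (F.trans (F.sym (leading M)) (low n (Lead-∣ₚ L M (∼0⇒multiple (K.x≈y⇒x-y≈0 a∼b)))))) }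
      where
      low : ∀ i → D ≤ i → coeff (a K.- b) i F.≈ F.0#
      low i le = F.trans (coeff-⊕ a _ i) (F.trans (F.+-cong (low-a i le) (F.trans (coeff-⊝ b i) (F.-‿cong (low-b i le)))) (F.-‿inverseʳ F.0#))

    constants-unique : ∀ {x y} → [ x ] ∼ [ y ] → x F.≈ y
    constants-unique {x} {y} e = at (reduced-unique low low e) 0
      where
      low : ∀ {x} i → D ≤ i → coeff [ x ] i F.≈ F.0#
      low {x} i D≤i = coeff-bound [ x ] i (ℕP.≤-trans 1≤D D≤i)

    1≁0 : ¬ K.1# ∼ K.0#
    1≁0 e = case ∼0⇒multiple e of λ { (k , eq) → ℕP.<⇒≱ 1≤D (Lead-∣ₚ L Lead-1 (k , eq)) }

    f∼0 : f ∼ []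
    f∼0 = multiple⇒∼0 oneP (sym (*-identityˡ f))

    ^∼0⇒∼0 : ∀ n {a} → a ^ n ∼ [] → a ∼ []
    ^∼0⇒∼0 zero    e = ⊥-elim (1≁0 e)
    ^∼0⇒∼0 (suc n) e = case nzd e of λ { (inj₁ z) → z ; (inj₂ z) → ^∼0⇒∼0 n z }

    Fixes : ℕ → Set _
    Fixes r = X ^ (q ℕ.^ r) ∼ X

    X^q^-+ : ∀ r s → X ^ (q ℕ.^ (r ℕ.+ s)) ≋ (X ^ (q ℕ.^ r)) ^ (q ℕ.^ s)
    X^q^-+ r s = trans (^-congʳ X (ℕP.^-distribˡ-+-* q r s)) (sym (^-assocʳ X (q ℕ.^ r) (q ℕ.^ s)))

    -- Frobenius is injective on a domain: the q^r-th power of X^(q^s) - X is X^(q^(r+s)) - X^(q^r),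
    -- which is congruent to 0.
    fixes-cancel : ∀ r s → X ^ (q ℕ.^ (r ℕ.+ s)) ∼ X ^ (q ℕ.^ r) → Fixes s
    fixes-cancel r s e = K.x-y≈0⇒x≈y (^∼0⇒∼0 (q ℕ.^ r) (begin
      (X ^ (q ℕ.^ s) K.- X) ^ (q ℕ.^ r)  ≈⟨ ≈⇒∼ (frobenius-iterate r _) ⟩
      comp (X ^ (q ℕ.^ s) K.- X) (X ^ (q ℕ.^ r))       ≈⟨ K.x-y≈0⇒x≈y (K.x≈y⇒x-y≈0 (≈⇒∼ (comp-minus (X ^ (q ℕ.^ r))))) ⟩
      (X ^ (q ℕ.^ r)) ^ (q ℕ.^ s) K.- X ^ (q ℕ.^ r)    ≈⟨ K.x≈y⇒x-y≈0 (K.trans (K.sym (≈⇒∼ (X^q^-+ r s))) e) ⟩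
      []  ∎))
      where
      open K-Reasoning
      comp-minus : ∀ y → comp (X ^ (q ℕ.^ s) K.- X) y ≋ y ^ (q ℕ.^ s) K.- y
      comp-minus y = trans (solve 2 (λ u v → u := (u :+ v) :- v) refl _ (comp X y))
        (+-cong (trans (sym (comp-+ _ X y)) (trans (comp-congˡ y (solve 2 (λ u v → u :- v :+ v := u) refl _ X)) (comp-X^ (q ℕ.^ s) y))) (-‿cong (comp-X y)))

    fixes-multiple : ∀ r j s → Fixes r → X ^ (q ℕ.^ (j ℕ.* r ℕ.+ s)) ∼ X ^ (q ℕ.^ s)
    fixes-multiple r zero    s e = K.refl
    fixes-multiple r (suc j) s e = begin
      X ^ (q ℕ.^ (r ℕ.+ j ℕ.* r ℕ.+ s))  ≈⟨ ≈⇒∼ (trans (^-congʳ X (≡.cong (q ℕ.^_) (ℕP.+-assoc r (j ℕ.* r) s))) (X^q^-+ r (j ℕ.* r ℕ.+ s))) ⟩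
      (X ^ (q ℕ.^ r)) ^ (q ℕ.^ (j ℕ.* r ℕ.+ s))         ≈⟨ K.^-congˡ (q ℕ.^ (j ℕ.* r ℕ.+ s)) e ⟩
      X ^ (q ℕ.^ (j ℕ.* r ℕ.+ s))  ≈⟨ fixes-multiple r j s e ⟩
      X ^ (q ℕ.^ s)  ∎
      where open K-Reasoning

    comp-f-Monic : MonicFun D (comp f)
    comp-f-Monic = go f D L
      where
      go : ∀ g n → Lead g n F.1# → MonicFun n (comp g)
      go [] n M = ⊥-elim (Lead⇒≉0 M ≋-refl)
      go (x ∷ g) zero M = DegLT-cong (λ y → K.trans (K.+-congʳ {K.- oneP} (≈⇒∼ (trans (+-cong (constP-cong (leading M))
        (trans (*-congˡ (comp-zero g y (mk λ i → above M (suc i) (s≤s z≤n)))) (zeroʳ y))) (+-identityʳ _)))) (K.-‿inverseʳ oneP)) DegLT-0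
      go (x ∷ g) (suc n) M = DegLT-cong (λ y → ≈⇒∼ (solve 4 (λ x y p r → x :+ y :* p :- y :* r := x :+ y :* (p :- r)) refl [ x ] y (comp g y) (y ^ n)))
        (DegLT-shift [ x ] (go g n (record { leading = leading M ; nonzero = nonzero M ; above = λ i lt → above M (suc i) (s≤s lt) })))

    -- By Frobenius f(X^(q^i)) = f^(q^i), a positive power of `f`.
    conjugate-root : ∀ i → comp f (X ^ (q ℕ.^ i)) ∼ []
    conjugate-root i = K.trans (≈⇒∼ (sym (frobenius-iterate i f))) (K.x≈0⇒x^n≈0 (1≤q^ i) f∼0)

    module Period {r : ℕ} (1≤r : 1 ≤ r) (fix-r : Fixes r) (minimal : ∀ j → 1 ≤ j → j < r → ¬ Fixes j) where
      private
        conjugates-distinct : ∀ {i j} → i < j → j ∸ i < r → ¬ X ^ (q ℕ.^ j) ∼ X ^ (q ℕ.^ i)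
        conjugates-distinct {i} {j} i<j lt e = minimal (j ∸ i) (ℕP.m<n⇒0<n∸m i<j) lt
          (fixes-cancel i (j ∸ i) (K.trans (K.reflexive (≡.cong (λ s → X ^ (q ℕ.^ s)) (ℕP.m+[n∸m]≡n (ℕP.<⇒≤ i<j)))) e))

        conjugates-injective : ∀ {i j} → j ∸ i < r → i ∸ j < r → X ^ (q ℕ.^ i) ∼ X ^ (q ℕ.^ j) → i ≡ j
        conjugates-injective {i} {j} lt lt′ e with ℕP.<-cmp i j
        ... | tri< i<j _ _ = ⊥-elim (conjugates-distinct i<j lt (K.sym e))
        ... | tri≈ _ eq _ = eq
        ... | tri> _ _ j<i = ⊥-elim (conjugates-distinct j<i lt′ e)

        -- Every residue is a root of Y^(q^r) - Y, which has degree q^r; if r < D there would be q^D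
        -- > q^r of them.
        D≤r : D ≤ r
        D≤r = case D ℕ.≤? r of λ
          { (yes le) → le
          ; (no gt) → ⊥-elim (1≁0 (Monic-tooManyRoots nzd (Monic-^-id (q ℕ.^ r) (2≤q^ 1≤r)) (ρ (ℕP.≰⇒> gt)) (λ {i} {j} → ρ-inj (ℕP.≰⇒> gt) {i} {j})
              (λ i → K.x≈y⇒x-y≈0 (fixes-all {r} fix-r _)))) }
          where
          2≤q^ : ∀ {r} → 1 ≤ r → 2 ≤ q ℕ.^ r
          2≤q^ {suc r} _ = ℕP.≤-trans 2≤q (ℕP.m≤m*n q (q ℕ.^ r) {{ℕ.>-nonZero (1≤q^ r)}})
          q^r<q^D : r < D → q ℕ.^ r < q ℕ.^ D
          q^r<q^D r<D = ℕP.^-monoʳ-< q 2≤q r<D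
          ρ : r < D → Fin (suc (q ℕ.^ r)) → Pol
          ρ r<D i = polynomialOf D (Fin.inject≤ i (q^r<q^D r<D))
          low : ∀ i j → D ≤ j → coeff (polynomialOf D i) j F.≈ F.0#
          low i j D≤j = coeff-bound (polynomialOf D i) j (ℕP.≤-trans (ℕP.≤-reflexive (length-polynomialOf D i)) D≤j)
          ρ-inj : ∀ r<D {i j} → ρ r<D i ∼ ρ r<D j → i ≡ j
          ρ-inj r<D e = FinP.inject≤-injective (q^r<q^D r<D) (q^r<q^D r<D) _ _ (polynomialOf-injective D (reduced-unique (low _) (low _) e))

        -- If D < r, the conjugates X^(q^i) with 0 ≤ i ≤ D would be D + 1 distinct roots of `f`,
        -- which has degree D.
        r≤D : r ≤ D
        r≤D = case r ℕ.≤? D of λ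
          { (yes le) → le
          ; (no gt) → ⊥-elim (1≁0 (Monic-tooManyRoots nzd comp-f-Monic (λ i → X ^ (q ℕ.^ Fin.toℕ i))
              (λ {i} {j} e → FinP.toℕ-injective (conjugates-injective (small (ℕP.≰⇒> gt) j i) (small (ℕP.≰⇒> gt) i j) e))
              (λ i → conjugate-root (Fin.toℕ i)))) }
          where
          small : D < r → (i j : Fin (suc D)) → Fin.toℕ i ∸ Fin.toℕ j < r
          small D<r i j = ℕP.≤-<-trans (ℕP.m∸n≤m (Fin.toℕ i) (Fin.toℕ j)) (ℕP.<-≤-trans (FinP.toℕ<n i) D<r)

        r≡D : r ≡ D
        r≡D = ℕP.≤-antisym r≤D D≤r

      fixes-degree : Fixes D
      fixes-degree = ≡.subst Fixes r≡D fix-r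

      -- The remainder of `k` modulo the least period is again a period, so it is 0; and the least
      -- period is `D`.
      degree-∣ : ∀ k → Fixes k → D ∣ k
      degree-∣ k fix-k = ≡.subst (_∣ k) r≡D (m%n≡0⇒n∣m k r (remainder≡0))
        where
        instance
          r≢0 : ℕ.NonZero r
          r≢0 = ℕ.>-nonZero 1≤r
        fix-rem : Fixes (k % r)
        fix-rem = K.trans (K.sym (fixes-multiple r (k / r) (k % r) fix-r))
          (K.trans (K.reflexive (≡.cong (λ s → X ^ (q ℕ.^ s)) (≡.sym (≡.trans (m≡m%n+[m/n]*n k r) (ℕP.+-comm (k % r) _))))) fix-k)
        remainder≡0 : k % r ≡ 0
        remainder≡0 = none (k % r) fix-rem (m%n<n k r)
          where
          none : ∀ s → Fixes s → s < r → s ≡ 0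
          none zero    _ _  = ≡.refl
          none (suc s) e lt = ⊥-elim (minimal (suc s) (s≤s z≤n) lt e)

      -- Evaluating f(Y) = ∏ (Y - X^(q^i)) at Y = 0 writes f(0) as a product of `D` elements
      -- -X^(q^i). The e-th power of each is (-1)^e because X^e ∼ 1, and congruent constants are
      -- equal.
      norm-^ : ∀ e → X ^ e ∼ oneP → coeff f 0 F.^ e F.≈ ((F.- F.1#) F.^ e) F.^ D
      norm-^ e X^e∼1 = constants-unique (begin
        [ coeff f 0 F.^ e ]  ≈⟨ ≈⇒∼ (constP-^ _ e) ⟨
        [ coeff f 0 ] ^ e  ≈⟨ K.^-congˡ e (≈⇒∼ (comp-f-0 f)) ⟨
        comp f [] ^ e  ≈⟨ K.^-congˡ e (Monic-splits nzd comp-f-Monic (λ i → X ^ (q ℕ.^ i))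
                                                                   (λ {i} {j} 1≤i i≤D 1≤j j≤D → conjugates-injective (small 1≤i j≤D) (small 1≤j i≤D))
                                                                   (λ i _ _ → conjugate-root i) []) ⟩
        K.prod D (λ i → [] K.- X ^ (q ℕ.^ i)) ^ e  ≈⟨ K.prod-^ D _ e ⟩
        K.prod D (λ i → ([] K.- X ^ (q ℕ.^ i)) ^ e)  ≈⟨ K.prod-cong D (λ i _ _ → conj i) ⟩
        K.prod D (λ _ → [ (F.- F.1#) F.^ e ])  ≈⟨ K.prod-const D _ ⟩
        [ (F.- F.1#) F.^ e ] ^ D  ≈⟨ ≈⇒∼ (constP-^ _ D) ⟩
        [ ((F.- F.1#) F.^ e) F.^ D ]  ∎)
        where
        open K-Reasoning
        comp-f-0 : ∀ g → comp g [] ≋ [ coeff g 0 ]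
        comp-f-0 []      = sym 0∷[]≋[]
        comp-f-0 (x ∷ g) = trans (+-congˡ (zeroˡ _)) (+-identityʳ _)
        -- The conjugates are indexed by 1, ..., D rather than 0, ..., D - 1, as `prod` starts at 1;
        -- index differences still stay below the period.
        small : ∀ {i j} → 1 ≤ i → j ≤ D → j ∸ i < r
        small {suc i} {zero}  _ _   = 1≤r
        small {suc i} {suc j} _ j<D = ≡.subst (j ∸ i ℕ.<_) (≡.sym r≡D) (ℕP.≤-<-trans (ℕP.m∸n≤m j i) j<D)
        conj : ∀ i → ([] K.- X ^ (q ℕ.^ i)) ^ e ∼ [ (F.- F.1#) F.^ e ]
        conj i = begin
          ([] K.- X ^ (q ℕ.^ i)) ^ e  ≈⟨ ≈⇒∼ (^-congˡ e (trans (solve 1 (λ x → con (ℤ.+ 0) :- x := :- con (ℤ.+ 1) :* x) refl _) (*-congʳ neg1))) ⟩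
          ([ F.- F.1# ] * X ^ (q ℕ.^ i)) ^ e         ≈⟨ ≈⇒∼ (^-distrib-* _ _ e) ⟩
          [ F.- F.1# ] ^ e * (X ^ (q ℕ.^ i)) ^ e     ≈⟨ K.*-congˡ {[ F.- F.1# ] ^ e} (K.trans (≈⇒∼ (^-comm X (q ℕ.^ i) e)) (K.trans (K.^-congˡ (q ℕ.^ i) X^e∼1) (≈⇒∼ (1^n≈1 (q ℕ.^ i))))) ⟩
          [ F.- F.1# ] ^ e * oneP  ≈⟨ ≈⇒∼ (trans (*-identityʳ _) (constP-^ _ e)) ⟩
          [ (F.- F.1#) F.^ e ]  ∎
          where
          neg1 : K.- oneP ≋ [ F.- F.1# ]
          neg1 = mk λ { zero → coeff-⊝ oneP 0 ; (suc i) → F.trans (coeff-⊝ oneP (suc i)) F.-0#≈0# }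

    record Conjugates (k : ℕ) : Set (c ⊔ ℓ) where
      field
        fixed      : Fixes D
        degree∣    : D ∣ k
        constant^  : ∀ e → X ^ e ∼ oneP → coeff f 0 F.^ e F.≈ ((F.- F.1#) F.^ e) F.^ D

    conjugates : ∀ k → 1 ≤ k → Fixes k → Conjugates k
    conjugates k 1≤k fix-k = case leastWitness Fixes (λ j → ∼? (X ^ (q ℕ.^ j)) X) k 1≤k fix-k of λ
      { (r , 1≤r , fix-r , minimal) → record
        { fixed     = Period.fixes-degree 1≤r fix-r minimal
        ; degree∣   = Period.degree-∣ 1≤r fix-r minimal k fix-k
        ; constant^ = Period.norm-^ 1≤r fix-r minimal } }

-- Factorisation of y^n − 1 into binomials

prime-divisor : ∀ n → 2 ≤ n → ∃[ p ] Prime p × p ∣ n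
prime-divisor n 2≤n with factorise n {{ℕ.>-nonZero (ℕP.<⇒≤ 2≤n)}}
... | record { factors = []     ; isFactorisation = ≡.refl } = ⊥-elim (ℕP.<-irrefl ≡.refl 2≤n)
... | record { factors = p ∷ ps ; isFactorisation = ≡.refl ; factorsPrime = pr ∷ _ } = p , pr , m∣m*n _

2≤prime : ∀ {p} → Prime p → 2 ≤ p
2≤prime pr = ℕ.nonTrivial⇒n>1 _ {{prime⇒nonTrivial pr}}

prime∤1 : ∀ {p} → Prime p → ¬ p ∣ 1
prime∤1 pr p∣1 = ¬prime[1] (≡.subst Prime (∣1⇒≡1 p∣1) pr)

prime∣prime⇒≡ : ∀ {p r} → Prime p → Prime r → r ∣ p → r ≡ p
prime∣prime⇒≡ pp pr r∣p with prime⇒irreducible pp r∣p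
... | inj₁ ≡.refl = ⊥-elim (¬prime[1] pr)
... | inj₂ r≡p    = r≡p

prime∤⇒coprime : ∀ {p u} → Prime p → ¬ p ∣ u → Coprime u p
prime∤⇒coprime pr p∤u (d∣u , d∣p) with prime⇒irreducible pr d∣p
... | inj₁ d≡1    = d≡1
... | inj₂ ≡.refl = ⊥-elim (p∤u d∣u)

coprime-*ʳ : ∀ {u a b} → Coprime u a → Coprime u b → Coprime u (a ℕ.* b)
coprime-*ʳ ua ub (d∣u , d∣ab) = ub (d∣u , coprime-divisor (λ { (c∣d , c∣a) → ua (∣-trans c∣d d∣u , c∣a) }) d∣ab)

coprime-∣ʳ : ∀ {u a b} → b ∣ a → Coprime u a → Coprime u b
coprime-∣ʳ b∣a ua (d∣u , d∣b) = ua (d∣u , ∣-trans d∣b b∣a)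

coprime-^ʳ : ∀ {u a} k → Coprime u a → Coprime u (a ℕ.^ k)
coprime-^ʳ zero    ua (_ , d∣1) = ∣1⇒≡1 d∣1
coprime-^ʳ (suc k) ua = coprime-*ʳ ua (coprime-^ʳ k ua)

-- If p does not divide t, then t is prime to the power of p and divides m; otherwise one factor p
-- is cancelled from t and from the power.
prime-∣-^*-split : ∀ {p} → Prime p → ∀ a m t → t ∣ p ℕ.^ suc a ℕ.* m → t ∣ p ℕ.^ a ℕ.* m ⊎ p ℕ.^ suc a ∣ t
prime-∣-^*-split {p} pr a m t t∣ with p ∣? t
... | no p∤t = inj₁ (∣n⇒∣m*n (p ℕ.^ a) (coprime-divisor (coprime-^ʳ (suc a) (prime∤⇒coprime pr p∤t)) t∣))
prime-∣-^*-split {p} pr zero m t t∣ | yes p∣t = inj₂ (≡.subst (_∣ t) (≡.sym (ℕP.*-identityʳ p)) p∣t)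
prime-∣-^*-split {p} pr (suc a) m t t∣ | yes (divides s ≡.refl) with prime-∣-^*-split pr a m s
    (*-cancelˡ-∣ p {{prime⇒nonZero pr}} (≡.subst₂ _∣_ (ℕP.*-comm s p) (ℕP.*-assoc p (p ℕ.^ suc a) m) t∣))
... | inj₁ s∣ = inj₁ (≡.subst₂ _∣_ (ℕP.*-comm p s) (≡.sym (ℕP.*-assoc p (p ℕ.^ a) m)) (*-monoʳ-∣ p s∣))
... | inj₂ P∣s = inj₂ (≡.subst (p ℕ.^ suc (suc a) ∣_) (ℕP.*-comm p s) (*-monoʳ-∣ p P∣s))

extract-prime : ∀ {p} → Prime p → ∀ n → 1 ≤ n → p ∣ n → ∃[ a ] ∃[ m ] n ≡ p ℕ.^ suc a ℕ.* m × ¬ p ∣ m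
extract-prime {p} pr = <-rec _ go
  where
  go : ∀ n → (∀ {k} → k < n → 1 ≤ k → p ∣ k → ∃[ a ] ∃[ m ] k ≡ p ℕ.^ suc a ℕ.* m × ¬ p ∣ m) →
       1 ≤ n → p ∣ n → ∃[ a ] ∃[ m ] n ≡ p ℕ.^ suc a ℕ.* m × ¬ p ∣ m
  go n rec 1≤n (divides k n≡k*p) with p ∣? k
  ... | no p∤k = 0 , k , ≡.trans n≡k*p (≡.trans (ℕP.*-comm k p) (≡.cong (ℕ._* k) (≡.sym (ℕP.*-identityʳ p)))) , p∤k
  ... | yes p∣k with rec k<n 1≤k p∣k
    where
    1≤k : 1 ≤ k
    1≤k = ℕP.n≢0⇒n>0 λ { ≡.refl → ℕP.<⇒≢ 1≤n (≡.sym n≡k*p) }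
    k<n : k < n
    k<n = ≡.subst (k ℕ.<_) (≡.sym n≡k*p) (ℕP.m<m*n k p {{ℕ.>-nonZero 1≤k}} (2≤prime pr))
  ...   | a , m , k≡ , p∤m = suc a , m , ≡.trans n≡k*p (≡.trans (ℕP.*-comm k p) (≡.trans (≡.cong (p ℕ.*_) k≡) (≡.sym (ℕP.*-assoc p _ m)))) , p∤m

module BinomialFactorisation {c ℓ} (R : CommutativeRing c ℓ) (noZeroDivisors : NoZeroDivisors R) where
  open RingKit R
  open PolynomialFunctions R
  open import Relation.Binary.Reasoning.Setoid setoid

  -- A product over a filtered range becomes a product over the whole range with 1 at the excluded
  -- places, so that ranges can be split pointwise.
  when : ∀ {a} {P : Set a} → Dec P → Carrier → Carrier
  when (yes _) x = x
  when (no  _) x = 1#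

  when-cong : ∀ {a b} {P : Set a} {Q : Set b} (P? : Dec P) (Q? : Dec Q) {x y} → (P → Q) → (Q → P) → (P → x ≈ y) → when P? x ≈ when Q? y
  when-cong (yes p) (yes q) f g eq = eq p
  when-cong (yes p) (no ¬q) f g eq = ⊥-elim (¬q (f p))
  when-cong (no ¬p) (yes q) f g eq = ⊥-elim (¬p (g q))
  when-cong (no ¬p) (no ¬q) f g eq = refl

  when-yes : ∀ {a} {P : Set a} (P? : Dec P) {x} → P → when P? x ≈ x
  when-yes (yes _) p = refl
  when-yes (no ¬p) p = ⊥-elim (¬p p)

  when-no : ∀ {a} {P : Set a} (P? : Dec P) {x} → ¬ P → when P? x ≈ 1#
  when-no (yes p) ¬p = ⊥-elim (¬p p)
  when-no (no _)  ¬p = refl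

  -- The three implications say that `P′` is the conjunction of `P` and the negation of `Q`, so `P`
  -- is the disjoint union of `P′` and its part inside `Q`.
  when-split : ∀ {a b} {P P′ : Set a} {Q : Set b} (P? : Dec P) (P′? : Dec P′) (Q? : Dec Q) {x} →
    (P → ¬ Q → P′) → (P′ → P) → (P′ → ¬ Q) → when P? x ≈ when P′? x * when Q? (when P? x)
  when-split (yes p) (yes p′) (yes q) f g h = ⊥-elim (h p′ q)
  when-split (yes p) (yes p′) (no ¬q) f g h = sym (*-identityʳ _)
  when-split (yes p) (no ¬p′) (yes q) f g h = sym (*-identityˡ _)
  when-split (yes p) (no ¬p′) (no ¬q) f g h = ⊥-elim (¬p′ (f p ¬q))
  when-split (no ¬p) (yes p′) Q?      f g h = ⊥-elim (¬p (g p′))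
  when-split (no ¬p) (no _)   (yes _) f g h = sym (*-identityˡ _)
  when-split (no ¬p) (no _)   (no _)  f g h = sym (*-identityˡ _)

  prod-multiples : ∀ p N (g : ℕ → Carrier) → 1 ≤ p → prod (p ℕ.* N) (λ t → when (p ∣? t) (g t)) ≈ prod N (λ t → g (p ℕ.* t))
  prod-multiples p zero g 1≤p = reflexive (≡.cong (λ k → prod k (λ t → when (p ∣? t) (g t))) (ℕP.*-zeroʳ p))
  prod-multiples (suc p′) (suc N) g 1≤p = begin
    prod (p ℕ.* suc N) h  ≡⟨ ≡.cong (λ k → prod k h) (≡.trans (ℕP.*-suc p N) (ℕP.+-comm p _)) ⟩
    prod (p ℕ.* N ℕ.+ p) h  ≈⟨ prod-+ (p ℕ.* N) p h ⟩
    prod (p ℕ.* N) h * (prod p′ (λ j → h (p ℕ.* N ℕ.+ j)) * h (p ℕ.* N ℕ.+ p))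
      ≈⟨ *-cong (prod-multiples p N g 1≤p) (trans (*-congʳ (prod-1 p′ λ j 1≤j j≤p′ → when-no (p ∣? _) λ p∣ →
           ℕP.<⇒≱ (s≤s j≤p′) (∣⇒≤ {{ℕ.>-nonZero 1≤j}} (∣m+n∣m⇒∣n p∣ (m∣m*n N))))) (*-identityˡ _)) ⟩
    prod N (λ t → g (p ℕ.* t)) * h (p ℕ.* N ℕ.+ p)
      ≡⟨ ≡.cong (λ k → prod N (λ t → g (p ℕ.* t)) * h k) (≡.sym (≡.trans (ℕP.*-suc p N) (ℕP.+-comm p _))) ⟩
    prod N (λ t → g (p ℕ.* t)) * h (p ℕ.* suc N)  ≈⟨ *-congˡ (when-yes (p ∣? _) (m∣m*n (suc N))) ⟩
    prod N (λ t → g (p ℕ.* t)) * g (p ℕ.* suc N)  ∎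
    where
    p = suc p′
    h : ℕ → Carrier
    h t = when (p ∣? t) (g t)

  prod-truncate : ∀ {M N} (g : ℕ → Carrier) → N ≤ M → (∀ i → N < i → g i ≈ 1#) → prod M g ≈ prod N g
  prod-truncate {M} {N} g N≤M one = begin
    prod M g  ≡⟨ ≡.cong (λ k → prod k g) (≡.sym (ℕP.m+[n∸m]≡n N≤M)) ⟩
    prod (N ℕ.+ (M ∸ N)) g  ≈⟨ prod-+ N (M ∸ N) g ⟩
    prod N g * prod (M ∸ N) (λ i → g (N ℕ.+ i))     ≈⟨ *-congˡ (prod-1 (M ∸ N) λ i 1≤i _ → one _ (ℕP.m<m+n N 1≤i)) ⟩
    prod N g * 1#  ≈⟨ *-identityʳ _ ⟩
    prod N g  ∎

  HasOrder : Carrier → ℕ → Set ℓ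
  HasOrder θ d = 1 ≤ d × θ ^ d ≈ 1# × (∀ j → 1 ≤ j → j < d → ¬ θ ^ j ≈ 1#)

  HasOrder-^ : ∀ {θ p d} → HasOrder θ (p ℕ.* d) → HasOrder (θ ^ p) d
  HasOrder-^ {θ} {p} {d} (1≤pd , θ^pd≈1 , minimal) = 1≤d , trans (^-assocʳ θ p d) θ^pd≈1 ,
    λ j 1≤j j<d e → minimal (p ℕ.* j) (ℕP.*-mono-≤ 1≤p 1≤j) (ℕP.*-monoʳ-< p {{ℕ.>-nonZero 1≤p}} j<d) (trans (sym (^-assocʳ θ p j)) e)
    where
    1≤p : 1 ≤ p
    1≤p = ℕP.n≢0⇒n>0 λ { ≡.refl → ℕP.<⇒≱ 1≤pd z≤n }
    1≤d : 1 ≤ d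
    1≤d = ℕP.n≢0⇒n>0 λ { ≡.refl → ℕP.<⇒≱ 1≤pd (ℕP.≤-reflexive (ℕP.*-zeroʳ p)) }

  -- Multiplication by θ^(d-i) plays the role of division by θ^i: it sends θ^i to 1 and θ^j to
  -- θ^(j-i).
  powers-distinct : ∀ {θ d} → HasOrder θ d → ∀ {i j} → i < j → i ≤ d → j ∸ i < d → ¬ θ ^ i ≈ θ ^ j
  powers-distinct {θ} {d} (1≤d , θ^d≈1 , minimal) {i} {j} i<j i≤d lt e = minimal (j ∸ i) (ℕP.m<n⇒0<n∸m i<j) lt (begin
    θ ^ (j ∸ i)  ≈⟨ trans (*-congʳ θ^d≈1) (*-identityˡ _) ⟨
    θ ^ d * θ ^ (j ∸ i)  ≈⟨ *-congʳ (split (d ∸ i) i (ℕP.m∸n+n≡m i≤d)) ⟩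
    θ ^ (d ∸ i) * θ ^ i * θ ^ (j ∸ i)    ≈⟨ *-assoc _ _ _ ⟩
    θ ^ (d ∸ i) * (θ ^ i * θ ^ (j ∸ i))  ≈⟨ *-congˡ (split i (j ∸ i) (ℕP.m+[n∸m]≡n (ℕP.<⇒≤ i<j))) ⟨
    θ ^ (d ∸ i) * θ ^ j  ≈⟨ *-congˡ e ⟨
    θ ^ (d ∸ i) * θ ^ i  ≈⟨ split (d ∸ i) i (ℕP.m∸n+n≡m i≤d) ⟨
    θ ^ d  ≈⟨ θ^d≈1 ⟩
    1#  ∎)
    where
    split : ∀ a b {n} → a ℕ.+ b ≡ n → θ ^ n ≈ θ ^ a * θ ^ b
    split a b ≡.refl = ^-homo-* θ a b

  powers-injective : ∀ {θ d} → HasOrder θ d → ∀ {i j} → 1 ≤ i → i ≤ d → 1 ≤ j → j ≤ d → θ ^ i ≈ θ ^ j → i ≡ j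
  powers-injective {θ} {d} H {i} {j} 1≤i i≤d 1≤j j≤d e with ℕP.<-cmp i j
  ... | tri< i<j _ _ = ⊥-elim (powers-distinct H i<j i≤d (ℕP.<-≤-trans (ℕP.∸-monoʳ-< 1≤i (ℕP.<⇒≤ i<j)) j≤d) e)
  ... | tri≈ _ eq _ = eq
  ... | tri> _ _ j<i = ⊥-elim (powers-distinct H j<i j≤d (ℕP.<-≤-trans (ℕP.∸-monoʳ-< 1≤j (ℕP.<⇒≤ j<i)) i≤d) (sym e))

  x^d-1 : ∀ {θ d} → HasOrder θ d → ∀ y → prod d (λ u → y - θ ^ u) ≈ y ^ d - 1#
  x^d-1 {θ} {d} H@(1≤d , θ^d≈1 , _) y = sym (Monic-splits noZeroDivisors (Monic-^-const d 1# 1≤d) (θ ^_) (powers-injective H)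
    (λ i _ _ → x≈y⇒x-y≈0 (trans (^-comm θ i d) (trans (^-congˡ i θ^d≈1) (1^n≈1 i)))) y)

  A : Carrier → ℕ → Carrier → ℕ → Carrier
  A θ d y t = prod d (λ u → when (gcd u t ℕ.≟ 1) (y ^ t - θ ^ u))

  -- For `y = X ^ e`, `M = m` and θ replaced by the constant θ^(-e), this is the asserted product
  -- for x^(en) - 1.
  Q : Carrier → ℕ → Carrier → ℕ → Carrier
  Q θ d y M = prod M (λ t → when (t ∣? M) (A θ d y t))

  -- For p prime to t, the u prime to t are those prime to pt together with the multiples of p.
  A-split : ∀ {p} a θ d y t → Prime p → ¬ p ∣ t → A θ (p ℕ.* d) (y ^ (p ℕ.^ suc a)) t ≈ A θ (p ℕ.* d) y (p ℕ.^ suc a ℕ.* t) * A (θ ^ p) d (y ^ (p ℕ.^ suc a)) t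
  A-split {p} a θ d y t pr p∤t = begin
    A θ (p ℕ.* d) Y t
      ≈⟨ prod-cong (p ℕ.* d) (λ u _ _ → when-split (gcd u t ℕ.≟ 1) (gcd u (P ℕ.* t) ℕ.≟ 1) (p ∣? u) (coprime-P u) (coprime-t u) (coprime-p u)) ⟩
    prod (p ℕ.* d) (λ u → when (gcd u (P ℕ.* t) ℕ.≟ 1) (Y ^ t - θ ^ u) * when (p ∣? u) (g u))
      ≈⟨ prod-* (p ℕ.* d) _ _ ⟩
    prod (p ℕ.* d) (λ u → when (gcd u (P ℕ.* t) ℕ.≟ 1) (Y ^ t - θ ^ u)) * prod (p ℕ.* d) (λ u → when (p ∣? u) (g u))
      ≈⟨ *-cong (prod-cong (p ℕ.* d) λ u _ _ → when-cong (gcd u (P ℕ.* t) ℕ.≟ 1) (gcd u (P ℕ.* t) ℕ.≟ 1) (λ z → z) (λ z → z) (λ _ → +-congʳ (^-assocʳ y P t)))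
                (prod-multiples p d g (ℕP.<⇒≤ (2≤prime pr))) ⟩
    A θ (p ℕ.* d) y (P ℕ.* t) * prod d (λ v → g (p ℕ.* v))
      ≈⟨ *-congˡ (prod-cong d λ v _ _ → when-cong (gcd (p ℕ.* v) t ℕ.≟ 1) (gcd v t ℕ.≟ 1) (coprime-v v) (coprime-pv v) (λ _ → +-congˡ (-‿cong (sym (^-assocʳ θ p v))))) ⟩
    A θ (p ℕ.* d) y (P ℕ.* t) * A (θ ^ p) d Y t ∎
    where
    P = p ℕ.^ suc a
    Y = y ^ P
    g : ℕ → Carrier
    g u = when (gcd u t ℕ.≟ 1) (Y ^ t - θ ^ u)
    coprime-P : ∀ u → gcd u t ≡ 1 → ¬ p ∣ u → gcd u (P ℕ.* t) ≡ 1
    coprime-P u eq p∤u = coprime⇒gcd≡1 (coprime-*ʳ (coprime-^ʳ (suc a) (prime∤⇒coprime pr p∤u)) (gcd≡1⇒coprime {u} {t} eq))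
    coprime-t : ∀ u → gcd u (P ℕ.* t) ≡ 1 → gcd u t ≡ 1
    coprime-t u eq = coprime⇒gcd≡1 (coprime-∣ʳ (n∣m*n P) (gcd≡1⇒coprime {u} {P ℕ.* t} eq))
    coprime-p : ∀ u → gcd u (P ℕ.* t) ≡ 1 → ¬ p ∣ u
    coprime-p u eq p∣u = ¬prime[1] (≡.subst Prime (gcd≡1⇒coprime {u} {P ℕ.* t} eq (p∣u , ∣m⇒∣m*n t (m∣m*n (p ℕ.^ a)))) pr)
    coprime-v : ∀ v → gcd (p ℕ.* v) t ≡ 1 → gcd v t ≡ 1
    coprime-v v eq = coprime⇒gcd≡1 (Coprimality.sym (coprime-∣ʳ (n∣m*n p) (Coprimality.sym (gcd≡1⇒coprime {p ℕ.* v} {t} eq))))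
    coprime-pv : ∀ v → gcd v t ≡ 1 → gcd (p ℕ.* v) t ≡ 1
    coprime-pv v eq = coprime⇒gcd≡1 (Coprimality.sym (coprime-*ʳ (prime∤⇒coprime pr p∤t) (Coprimality.sym (gcd≡1⇒coprime {v} {t} eq))))

  -- Peel off a prime p of M = p^(a+1) m: writing X for the contribution of the t divisible by p^(a+1),
  -- Q(M) = Q(p^a m) X, while the induction hypotheses for m give Y^(dm) - 1 = X (Y^(dm/p) - 1), where Y = y^(p^(a+1)).
  x^dM-1 : ∀ M → 1 ≤ M → ∀ θ d y → HasOrder θ d → (∀ p → Prime p → p ∣ M → p ∣ d) → Q θ d y M ≈ y ^ (d ℕ.* M) - 1#
  x^dM-1 = <-rec _ step
    where
    Claim : ℕ → Set _
    Claim M = 1 ≤ M → ∀ θ d y → HasOrder θ d → (∀ p → Prime p → p ∣ M → p ∣ d) → Q θ d y M ≈ y ^ (d ℕ.* M) - 1#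

    peel : ∀ p a m d → Prime p → ¬ p ∣ m → 1 ≤ m → Claim m → Claim (p ℕ.^ a ℕ.* m) →
      ∀ θ y → HasOrder θ (p ℕ.* d) → (∀ r → Prime r → r ∣ p ℕ.^ suc a ℕ.* m → r ∣ p ℕ.* d) →
      Q θ (p ℕ.* d) y (p ℕ.^ suc a ℕ.* m) ≈ y ^ (p ℕ.* d ℕ.* (p ℕ.^ suc a ℕ.* m)) - 1#
    peel p a m d pr p∤m 1≤m ih-m ih-N θ y H rad = begin
      Q θ (p ℕ.* d) y M
        -- A divisor of p^(a+1) m divides p^a m or is a multiple of p^(a+1), and not both because p
        -- does not divide m.
        ≈⟨ prod-cong M (λ t _ _ → when-split (t ∣? M) (t ∣? N) (P ∣? t) (only-N t) (λ t∣N → ∣-trans t∣N N∣M) (not-both t)) ⟩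
      prod M (λ t → when (t ∣? N) (A θ (p ℕ.* d) y t) * when (P ∣? t) (when (t ∣? M) (A θ (p ℕ.* d) y t)))
        ≈⟨ prod-* M _ _ ⟩
      prod M (λ t → when (t ∣? N) (A θ (p ℕ.* d) y t)) * prod M (λ t → when (P ∣? t) (when (t ∣? M) (A θ (p ℕ.* d) y t)))
        ≈⟨ *-cong (prod-truncate _ (∣⇒≤ {{ℕ.>-nonZero 1≤M}} N∣M) (λ t N<t → when-no (t ∣? N) λ t∣N → ℕP.<⇒≱ N<t (∣⇒≤ {{ℕ.>-nonZero 1≤N}} t∣N)))
                  (prod-multiples P m _ 1≤P) ⟩
      Q θ (p ℕ.* d) y N * prod m (λ t → when (P ℕ.* t ∣? M) (A θ (p ℕ.* d) y (P ℕ.* t)))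
        ≈⟨ *-cong (ih-N 1≤N θ (p ℕ.* d) y H (λ r r-pr r∣N → rad r r-pr (∣-trans r∣N N∣M)))
                  (prod-cong m λ t _ _ → when-cong (P ℕ.* t ∣? M) (t ∣? m) (*-cancelˡ-∣ P {{ℕ.>-nonZero 1≤P}}) (*-monoʳ-∣ P) (λ _ → refl)) ⟩
      (y ^ (p ℕ.* d ℕ.* N) - 1#) * Z
        ≈⟨ *-congʳ (+-congʳ (trans (^-congʳ y (exponents p d (p ℕ.^ a) m)) (sym (^-assocʳ y P (d ℕ.* m))))) ⟩
      (Y ^ (d ℕ.* m) - 1#) * Z
        -- The first factor is expanded again, now over θ^p, whose order is `d`, so that `A-split`
        -- can merge it with `Z` divisor by divisor.
        ≈⟨ *-congʳ (ih-m 1≤m (θ ^ p) d Y (HasOrder-^ {θ} {p} H) rad-d) ⟨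
      Q (θ ^ p) d Y m * Z
        ≈⟨ *-comm _ _ ⟩
      Z * Q (θ ^ p) d Y m
        ≈⟨ prod-* m _ _ ⟨
      prod m (λ t → when (t ∣? m) (A θ (p ℕ.* d) y (P ℕ.* t)) * when (t ∣? m) (A (θ ^ p) d Y t))
        ≈⟨ prod-cong m (λ t _ _ → combine t) ⟨
      Q θ (p ℕ.* d) Y m
        ≈⟨ ih-m 1≤m θ (p ℕ.* d) Y H (λ r r-pr r∣m → rad r r-pr (∣n⇒∣m*n P r∣m)) ⟩
      Y ^ (p ℕ.* d ℕ.* m) - 1#
        ≈⟨ +-congʳ (trans (^-assocʳ y P (p ℕ.* d ℕ.* m)) (^-congʳ y (exponents′ P (p ℕ.* d) m))) ⟩
      y ^ (p ℕ.* d ℕ.* M) - 1# ∎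
      where
      P = p ℕ.^ suc a
      N = p ℕ.^ a ℕ.* m
      M = P ℕ.* m
      Y = y ^ P
      Z = prod m (λ t → when (t ∣? m) (A θ (p ℕ.* d) y (P ℕ.* t)))
      1≤P : 1 ≤ P
      1≤P = ℕP.m^n>0 p {{prime⇒nonZero pr}} (suc a)
      1≤N : 1 ≤ N
      1≤N = ℕP.*-mono-≤ (ℕP.m^n>0 p {{prime⇒nonZero pr}} a) 1≤m
      1≤M : 1 ≤ M
      1≤M = ℕP.*-mono-≤ 1≤P 1≤m
      N∣M : N ∣ M
      N∣M = *-monoˡ-∣ m (n∣m*n p)
      exponents : ∀ p d x m → p ℕ.* d ℕ.* (x ℕ.* m) ≡ p ℕ.* x ℕ.* (d ℕ.* m)
      exponents = solve-∀
      exponents′ : ∀ P x m → P ℕ.* (x ℕ.* m) ≡ x ℕ.* (P ℕ.* m)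
      exponents′ = solve-∀
      only-N : ∀ t → t ∣ M → ¬ P ∣ t → t ∣ N
      only-N t t∣M P∤t with prime-∣-^*-split pr a m t t∣M
      ... | inj₁ t∣N = t∣N
      ... | inj₂ P∣t = ⊥-elim (P∤t P∣t)
      not-both : ∀ t → t ∣ N → ¬ P ∣ t
      not-both t t∣N P∣t = p∤m (*-cancelˡ-∣ (p ℕ.^ a) {{ℕP.m^n≢0 p a {{prime⇒nonZero pr}}}} (≡.subst (_∣ N) (ℕP.*-comm p (p ℕ.^ a)) (∣-trans P∣t t∣N)))
      combine : ∀ t → when (t ∣? m) (A θ (p ℕ.* d) Y t) ≈ when (t ∣? m) (A θ (p ℕ.* d) y (P ℕ.* t)) * when (t ∣? m) (A (θ ^ p) d Y t)
      combine t with t ∣? m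
      ... | yes t∣m = A-split a θ d y t pr (λ p∣t → p∤m (∣-trans p∣t t∣m))
      ... | no  _   = sym (*-identityˡ _)
      -- For θ^p the primes of m must divide `d` and not merely `p * d`; none of them is p, since p
      -- does not divide m.
      rad-d : ∀ r → Prime r → r ∣ m → r ∣ d
      rad-d r r-pr r∣m with euclidsLemma p d r-pr (rad r r-pr (∣n⇒∣m*n P r∣m))
      ... | inj₂ r∣d = r∣d
      ... | inj₁ r∣p with prime∣prime⇒≡ pr r-pr r∣p
      ...   | ≡.refl = ⊥-elim (p∤m r∣m)

    step : ∀ M → (∀ {k} → k < M → Claim k) → Claim M
    step 1 rec _ θ d y H rad = begin
      1# * prod d (λ u → when (gcd u 1 ℕ.≟ 1) (y ^ 1 - θ ^ u)) ≈⟨ *-identityˡ _ ⟩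
      prod d (λ u → when (gcd u 1 ℕ.≟ 1) (y ^ 1 - θ ^ u))      ≈⟨ prod-cong d (λ u _ _ → trans (when-yes (gcd u 1 ℕ.≟ 1) (∣1⇒≡1 (gcd[m,n]∣n u 1))) (+-congʳ (x^1≈x y))) ⟩
      prod d (λ u → y - θ ^ u)  ≈⟨ x^d-1 H y ⟩
      y ^ d - 1#  ≈⟨ +-congʳ (^-congʳ y (ℕP.*-identityʳ d)) ⟨
      y ^ (d ℕ.* 1) - 1#  ∎
    step M@(suc (suc _)) rec _ θ d y H rad = case prime-divisor M (s≤s (s≤s z≤n)) of λ
      { (p , pr , p∣M) → case extract-prime pr M (s≤s z≤n) p∣M of λ
        { (a , m , eq , p∤m) → case rad p pr p∣M of λ
          { (divides d′ eq′) → use p pr a m eq p∤m d′ (≡.trans eq′ (ℕP.*-comm d′ p)) } } }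
      where
      use : ∀ p → Prime p → ∀ a m → M ≡ p ℕ.^ suc a ℕ.* m → ¬ p ∣ m → ∀ d′ → d ≡ p ℕ.* d′ → Q θ d y M ≈ y ^ (d ℕ.* M) - 1#
      use p pr a m eq p∤m d′ ≡.refl = ≡.subst (λ M → Q θ d y M ≈ y ^ (d ℕ.* M) - 1#) (≡.sym eq)
        (peel p a m d′ pr p∤m 1≤m (rec m<M) (rec N<M) θ y H (λ r r-pr r∣ → rad r r-pr (≡.subst (r ∣_) (≡.sym eq) r∣)))
        where
        1≤m : 1 ≤ m
        1≤m = ℕP.n≢0⇒n>0 λ { ≡.refl → ℕP.1+n≢0 (≡.trans eq (ℕP.*-zeroʳ (p ℕ.^ suc a))) }
        N<M : p ℕ.^ a ℕ.* m < M
        N<M = ≡.subst (p ℕ.^ a ℕ.* m ℕ.<_) (≡.trans (ℕP.*-comm _ p) (≡.trans (≡.sym (ℕP.*-assoc p (p ℕ.^ a) m)) (≡.sym eq)))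
          (ℕP.m<m*n (p ℕ.^ a ℕ.* m) p {{ℕ.>-nonZero (ℕP.*-mono-≤ (ℕP.m^n>0 p {{prime⇒nonZero pr}} a) 1≤m)}} (2≤prime pr))
        m<M : m < M
        m<M = ℕP.≤-<-trans (ℕP.m≤n*m m (p ℕ.^ a) {{ℕP.m^n≢0 p a {{prime⇒nonZero pr}}}}) N<M

-- The norm is not a p-th power

private
  -- The exponent of ω in ω · ω² ⋯ ω^n. For odd n it is a multiple of n, so the product of all n-th
  -- roots of unity is then 1.
  triangle : ℕ → ℕ
  triangle zero    = 0
  triangle (suc n) = triangle n ℕ.+ suc n

  triangle-odd : ∀ h → triangle (suc (h ℕ.+ h)) ≡ suc (h ℕ.+ h) ℕ.* suc h
  triangle-odd h = ℕP.*-cancelˡ-≡ _ _ 2 (≡.trans (double (suc (h ℕ.+ h))) (rearrange h))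
    where
    double : ∀ n → 2 ℕ.* triangle n ≡ n ℕ.* suc n
    double zero    = ≡.refl
    double (suc n) = ≡.trans (ℕP.*-distribˡ-+ 2 (triangle n) (suc n)) (≡.trans (≡.cong (ℕ._+ 2 ℕ.* suc n) (double n)) (step n))
      where
      step : ∀ n → n ℕ.* suc n ℕ.+ 2 ℕ.* suc n ≡ suc n ℕ.* suc (suc n)
      step = solve-∀
    rearrange : ∀ h → suc (h ℕ.+ h) ℕ.* suc (suc (h ℕ.+ h)) ≡ 2 ℕ.* (suc (h ℕ.+ h) ℕ.* suc h)
    rearrange = solve-∀

even⊎odd : ∀ n → (∃[ h ] n ≡ h ℕ.+ h) ⊎ (∃[ h ] n ≡ suc (h ℕ.+ h))
even⊎odd zero = inj₁ (0 , ≡.refl)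
even⊎odd (suc n) with even⊎odd n
... | inj₁ (h , ≡.refl) = inj₂ (h , ≡.refl)
... | inj₂ (h , ≡.refl) = inj₁ (suc h , ≡.cong suc (≡.sym (ℕP.+-suc h h)))

prime-2⊎odd : ∀ {p} → Prime p → p ≡ 2 ⊎ ∃[ h ] p ≡ suc (h ℕ.+ h)
prime-2⊎odd {p} pr with even⊎odd p
... | inj₂ odd = inj₂ odd
... | inj₁ (h , eq) with prime⇒irreducible pr (divides h (≡.trans eq (≡.trans (≡.cong (h ℕ.+_) (≡.sym (ℕP.+-identityʳ h))) (ℕP.*-comm 2 h))))
...   | inj₁ ()
...   | inj₂ 2≡p = inj₁ (≡.sym 2≡p)

-- d stands for gcd n (q − 1) and r for (q − 1) / d.
record Parameters (q e k n d m r : ℕ) : Set where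
  field
    1≤d     : 1 ≤ d
    1≤m     : 1 ≤ m
    q-1≡rd  : q ∸ 1 ≡ r ℕ.* d
    n≡dm    : n ≡ d ℕ.* m
    p∣d     : ∀ p → Prime p → p ∣ m → p ∣ d
    p∤r     : ∀ p → Prime p → p ∣ m → ¬ p ∣ r
    p∤k     : ∀ p → Prime p → p ∣ m → ¬ p ∣ k
    coprime : Coprime n e
    4∣m⇒4∣d : 4 ∣ m → 4 ∣ d

getParameters : ∀ q e k n d m → 1 ≤ n → (∀ p → Prime p → p ∣ n → p ∣ (q ∸ 1)) → gcd n (k ℕ.* e) ≡ 1 →
  (8 ∣ n → 4 ∣ (q ∸ 1)) → d ≡ gcd n (q ∸ 1) → n ≡ d ℕ.* m → 1 ≤ d → ∃[ r ] Parameters q e k n d m r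
getParameters q e k n d m 1≤n rad cop eight d≡ n≡dm 1≤d = use (≡.subst (_∣ (q ∸ 1)) (≡.sym d≡) (gcd[m,n]∣n n (q ∸ 1)))
  where
  m∣n : m ∣ n
  m∣n = divides d n≡dm
  d-greatest : ∀ {c} → c ∣ n → c ∣ q ∸ 1 → c ∣ d
  d-greatest c∣n c∣q-1 = ≡.subst (_ ∣_) (≡.sym d≡) (gcd-greatest c∣n c∣q-1)
  p∣d : ∀ p → Prime p → p ∣ m → p ∣ d
  p∣d p pr p∣m = d-greatest (∣-trans p∣m m∣n) (rad p pr (∣-trans p∣m m∣n))
  coprime-ke : Coprime n (k ℕ.* e)
  coprime-ke = gcd≡1⇒coprime cop
  use : d ∣ q ∸ 1 → ∃[ r ] Parameters q e k n d m r
  use (divides r eq) = r , record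
    { 1≤d = 1≤d
    ; 1≤m = ℕP.n≢0⇒n>0 λ { ≡.refl → ℕP.<⇒≢ 1≤n (≡.sym (≡.trans n≡dm (ℕP.*-zeroʳ d))) }
    ; q-1≡rd = eq
    ; n≡dm = n≡dm
    ; p∣d = p∣d
    -- This is the maximality of the gcd: p ∣ m gives pd ∣ n, and p ∣ r would give pd ∣ q - 1, so pd
    -- would divide d.
    ; p∤r = λ p pr p∣m p∣r → prime∤1 pr (*-cancelˡ-∣ d {{ℕ.>-nonZero 1≤d}} (≡.subst₂ _∣_ (ℕP.*-comm p d) (≡.sym (ℕP.*-identityʳ d))
        (d-greatest (≡.subst₂ _∣_ (ℕP.*-comm d p) (≡.sym n≡dm) (*-monoʳ-∣ d p∣m)) (≡.subst (p ℕ.* d ∣_) (≡.sym eq) (*-monoˡ-∣ d p∣r)))))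
    ; p∤k = λ p pr p∣m p∣k → ¬prime[1] (≡.subst Prime (coprime-ke (∣-trans p∣m m∣n , ∣m⇒∣m*n e p∣k)) pr)
    ; coprime = λ { (c∣n , c∣e) → coprime-ke (c∣n , ∣n⇒∣m*n k c∣e) }
    -- From 4 ∣ m follows 2 ∣ d, so 8 divides dm = n, and the hypothesis on 8 yields 4 ∣ q - 1.
    ; 4∣m⇒4∣d = λ 4∣m → d-greatest (∣-trans 4∣m m∣n)
        (eight (≡.subst (8 ∣_) (≡.sym n≡dm) (∣-trans (*-monoʳ-∣ 2 4∣m) (*-monoˡ-∣ m (p∣d 2 prime[2] (∣-trans (divides 2 ≡.refl) 4∣m))))))
    }

module IrreducibleFactors {c ℓ} (F : Field c ℓ) (q : ℕ) (card : HasCardinality F q) where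
  open RootField F q card public

  pow≡^ : ∀ a n → pow a n ≡ a F.^ n
  pow≡^ a zero    = ≡.refl
  pow≡^ a (suc n) = ≡.cong (a F.*_) (pow≡^ a n)

  Order : F.Carrier → ℕ → Set ℓ
  Order θ d = 1 ≤ d × θ F.^ d F.≈ F.1# × (∀ j → 1 ≤ j → j < d → ¬ θ F.^ j F.≈ F.1#)

  HasMultOrder⇒Order : ∀ {θ d} → HasMultOrder θ d → Order θ d
  HasMultOrder⇒Order {θ} {d} (1≤d , e , minimal) = 1≤d , F.trans (F.reflexive (≡.sym (pow≡^ θ d))) e ,
    λ j 1≤j j<d e′ → minimal j 1≤j j<d (F.trans (F.reflexive (pow≡^ θ j)) e′)

  Order⇒∣ : ∀ {θ d} → Order θ d → ∀ j → θ F.^ j F.≈ F.1# → d ∣ j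
  Order⇒∣ {θ} {d} (1≤d , θ^d≈1 , minimal) j θ^j≈1 = m%n≡0⇒n∣m j d (none (j % d) θ^rem≈1 (m%n<n j d))
    where
    instance
      d≢0 : ℕ.NonZero d
      d≢0 = ℕ.>-nonZero 1≤d
    open import Relation.Binary.Reasoning.Setoid F.setoid
    θ^rem≈1 : θ F.^ (j % d) F.≈ F.1#
    θ^rem≈1 = begin
      θ F.^ (j % d)  ≈⟨ F.*-identityʳ _ ⟨
      θ F.^ (j % d) F.* F.1#  ≈⟨ F.*-congˡ (F.trans (F.^-congˡ (j / d) θ^d≈1) (F.1^n≈1 (j / d))) ⟨
      θ F.^ (j % d) F.* (θ F.^ d) F.^ (j / d)    ≈⟨ F.*-congˡ (F.trans (F.^-assocʳ θ d (j / d)) (F.^-congʳ θ (ℕP.*-comm d (j / d)))) ⟩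
      θ F.^ (j % d) F.* θ F.^ (j / d ℕ.* d)      ≈⟨ F.^-homo-* θ (j % d) _ ⟨
      θ F.^ (j % d ℕ.+ j / d ℕ.* d)  ≈⟨ F.^-congʳ θ (m≡m%n+[m/n]*n j d) ⟨
      θ F.^ j  ≈⟨ θ^j≈1 ⟩
      F.1#  ∎
    none : ∀ s → θ F.^ s F.≈ F.1# → s < d → s ≡ 0
    none zero    _ _ = ≡.refl
    none (suc s) e s<d = ⊥-elim (minimal (suc s) (s≤s z≤n) s<d e)

  -1#^even : ∀ h → (F.- F.1#) F.^ (h ℕ.+ h) F.≈ F.1#
  -1#^even h = F.trans (F.^-homo-* _ h h) (F.trans (F.sym (F.^-distrib-* _ _ h)) (F.trans (F.^-congˡ h
    (F.solve 0 (F.:- F.con (ℤ.+ 1) F.:* F.:- F.con (ℤ.+ 1) F.:= F.con (ℤ.+ 1)) F.refl)) (F.1^n≈1 h)))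

  prod-powers : ∀ ω n → F.prod n (λ j → ω F.^ j) F.≈ ω F.^ triangle n
  prod-powers ω zero    = F.refl
  prod-powers ω (suc n) = F.trans (F.*-congʳ (prod-powers ω n)) (F.sym (F.^-homo-* ω (triangle n) (suc n)))

  -- Euler's criterion: raising to the power W = (q - 1)/p sends every nonzero p-th power to 1.
  cancel-power : ∀ {p W x z v} → 1 ≤ p → p ℕ.* W ≡ q ∸ 1 → ¬ z F.≈ F.0# → x F.^ p F.* v F.≈ z F.^ p → v F.^ W F.≈ F.1#
  cancel-power {p} {W} {x} {z} {v} 1≤p pW≡q-1 z≉0 eq = begin
    v F.^ W  ≈⟨ F.*-identityˡ _ ⟨
    F.1# F.* v F.^ W  ≈⟨ F.*-congʳ (fermat x x≉0) ⟨
    (x F.^ p) F.^ W F.* v F.^ W        ≈⟨ F.^-distrib-* _ _ W ⟨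
    (x F.^ p F.* v) F.^ W  ≈⟨ F.^-congˡ W eq ⟩
    (z F.^ p) F.^ W  ≈⟨ fermat z z≉0 ⟩
    F.1#  ∎
    where
    open import Relation.Binary.Reasoning.Setoid F.setoid
    fermat : ∀ x → ¬ x F.≈ F.0# → (x F.^ p) F.^ W F.≈ F.1#
    fermat x x≉0 = F.trans (F.^-assocʳ x p W) (F.trans (F.^-congʳ x pW≡q-1) (F-fermat x x≉0))
    x≉0 : ¬ x F.≈ F.0#
    x≉0 x≈0 = ^-≉0 p z≉0 (F.trans (F.sym eq) (F.trans (F.*-congʳ (F.x≈0⇒x^n≈0 1≤p x≈0)) (F.zeroˡ v)))

  module _ {e k n d m r : ℕ} (params : Parameters q e k n d m r) {θ : F.Carrier} (θ-order : Order θ d) where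
    open Parameters params

    -- The product of the p-th roots of unity is (−1)^(p−1), so only p = 2 with s even is a problem;
    -- there 4 ∣ d gives a square root of −1.
    sign-isPower : ∀ {p d′} s → Prime p → p ℕ.* s ∣ m → d ≡ d′ ℕ.* p →
      ∃[ b ] b F.^ p F.≈ F.prod p (λ j → (θ F.^ d′) F.^ j) F.^ s F.* (F.- F.1#)
    sign-isPower {p} {d′} s pr ps∣m d≡d′p = case prime-2⊎odd pr of λ
      { (inj₂ (h , eq)) → F.- F.1# , odd h eq
      ; (inj₁ eq) → two eq }
      where
      open import Relation.Binary.Reasoning.Setoid F.setoid
      ω = θ F.^ d′
      σ = F.prod p (λ j → ω F.^ j)
      ω^p≈1 : ω F.^ p F.≈ F.1#
      ω^p≈1 = F.trans (F.^-assocʳ θ d′ p) (F.trans (F.^-congʳ θ (≡.sym d≡d′p)) (proj₁ (proj₂ θ-order)))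
      odd : ∀ h → p ≡ suc (h ℕ.+ h) → (F.- F.1#) F.^ p F.≈ σ F.^ s F.* (F.- F.1#)
      odd h ≡.refl = begin
        (F.- F.1#) F.* (F.- F.1#) F.^ (h ℕ.+ h)  ≈⟨ F.*-congˡ (-1#^even h) ⟩
        (F.- F.1#) F.* F.1#  ≈⟨ F.*-comm _ _ ⟩
        F.1# F.* (F.- F.1#)  ≈⟨ F.*-congʳ (F.trans (F.^-congˡ s σ≈1) (F.1^n≈1 s)) ⟨
        σ F.^ s F.* (F.- F.1#)  ∎
        where
        σ≈1 : σ F.≈ F.1#
        σ≈1 = F.trans (prod-powers ω p) (F.trans (F.^-congʳ ω (triangle-odd h)) (F.trans (F.sym (F.^-assocʳ ω p (suc h))) (F.trans (F.^-congˡ (suc h) ω^p≈1) (F.1^n≈1 (suc h)))))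
      two : p ≡ 2 → ∃[ b ] b F.^ p F.≈ σ F.^ s F.* (F.- F.1#)
      two ≡.refl = case even⊎odd s of λ
        { (inj₂ (h , ≡.refl)) → F.1# , (begin
            F.1# F.^ 2  ≈⟨ F.1^n≈1 2 ⟩
            F.1#  ≈⟨ F.trans (-1#^even (suc h)) F.refl ⟨
            (F.- F.1#) F.^ (suc h ℕ.+ suc h)  ≈⟨ F.^-congʳ _ (≡.cong suc (ℕP.+-suc h h)) ⟩
            (F.- F.1#) F.* (F.- F.1#) F.^ suc (h ℕ.+ h) ≈⟨ F.*-comm _ _ ⟩
            (F.- F.1#) F.^ suc (h ℕ.+ h) F.* (F.- F.1#) ≈⟨ F.*-congʳ (F.^-congˡ (suc (h ℕ.+ h)) σ≈-1) ⟨
            σ F.^ suc (h ℕ.+ h) F.* (F.- F.1#)  ∎)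
        ; (inj₁ (h , ≡.refl)) → case 4∣m⇒4∣d (∣-trans (divides h (four h)) ps∣m) of λ { (divides d″ d≡d″4) → θ F.^ d″ , (begin
            (θ F.^ d″) F.^ 2  ≈⟨ F.^-assocʳ θ d″ 2 ⟩
            θ F.^ (d″ ℕ.* 2)  ≈⟨ F.^-congʳ θ (ℕP.*-cancelʳ-≡ (d″ ℕ.* 2) d′ 2 (≡.trans (ℕP.*-assoc d″ 2 2) (≡.trans (≡.sym d≡d″4) d≡d′p))) ⟩
            ω  ≈⟨ ω≈-1 ⟩
            F.- F.1#  ≈⟨ F.*-identityˡ _ ⟨
            F.1# F.* (F.- F.1#)  ≈⟨ F.*-congʳ (F.trans (F.^-congˡ (h ℕ.+ h) σ≈-1) (-1#^even h)) ⟨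
            σ F.^ (h ℕ.+ h) F.* (F.- F.1#)  ∎) } }
        where
        four : ∀ h → 2 ℕ.* (h ℕ.+ h) ≡ h ℕ.* 4
        four = solve-∀
        ω≉1 : ¬ ω F.≈ F.1#
        ω≉1 e = ℕP.<⇒≱ (ℕP.m<m*n d′ 2 {{ℕ.>-nonZero 1≤d′}} (s≤s (s≤s z≤n))) (≡.subst (ℕ._≤ d′) d≡d′p (∣⇒≤ {{ℕ.>-nonZero 1≤d′}} (Order⇒∣ θ-order d′ e)))
          where
          1≤d′ : 1 ≤ d′
          1≤d′ = ℕP.n≢0⇒n>0 λ { ≡.refl → ℕP.<⇒≢ 1≤d (≡.sym d≡d′p) }
        ω≈-1 : ω F.≈ F.- F.1#
        ω≈-1 = case F-noZeroDivisors {ω F.- F.1#} {ω F.- (F.- F.1#)}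
          (F.trans (F.solve 1 (λ w → (w F.:- F.con (ℤ.+ 1)) F.:* (w F.:- F.:- F.con (ℤ.+ 1)) F.:= w F.:* (w F.:* F.con (ℤ.+ 1)) F.:- F.con (ℤ.+ 1)) F.refl ω) (F.x≈y⇒x-y≈0 ω^p≈1)) of λ
          { (inj₁ z) → ⊥-elim (ω≉1 (F.x-y≈0⇒x≈y z))
          ; (inj₂ z) → F.x-y≈0⇒x≈y z }
        σ≈-1 : σ F.≈ F.- F.1#
        σ≈-1 = F.trans (F.*-cong (F.trans (F.*-identityˡ _) (F.x^1≈x ω)) ω^p≈1) (F.trans (F.*-identityʳ ω) ω≈-1)

    -- Raise a putative equation to the power e. The hypothesis turns f₀^e into (-1)^(De), which
    -- together with the sign σ^(Dse) is the power De of σ^s · (-1), a p-th power by `sign-isPower`.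
    -- What remains says that θ^(uDie) times a p-th power is a nonzero p-th power; Euler's criterion
    -- and the order of θ then force p to divide u D i e r.
    dilated-normNotPower : ∀ {p s u D f₀} → Prime p → p ℕ.* s ∣ m → ¬ p ∣ u → D ∣ k → f₀ F.^ e F.≈ ((F.- F.1#) F.^ e) F.^ D →
      NormNotPower p (D ℕ.* s) (F.1# F.* (θ F.^ u) F.^ D) f₀
    dilated-normNotPower {p} {s} {u} {D} {f₀} pr ps∣m p∤u D∣k f₀^e = use (p∣d p pr p∣m)
      where
      open import Relation.Binary.Reasoning.Setoid F.setoid
      p∣m = ∣-trans (m∣m*n s) ps∣m
      p∣n = ≡.subst (p ∣_) (≡.sym n≡dm) (∣n⇒∣m*n d p∣m)
      1≤p = ℕP.<⇒≤ (2≤prime pr)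
      use : p ∣ d → NormNotPower p (D ℕ.* s) (F.1# F.* (θ F.^ u) F.^ D) f₀
      use (divides d′ d≡d′p) = record { ω = ω ; ω^p≈1 = ω^p≈1 ; order = order ; notPower = notPower }
        where
        ω = θ F.^ d′
        σ = F.prod p (λ j → ω F.^ j)
        1≤d′ : 1 ≤ d′
        1≤d′ = ℕP.n≢0⇒n>0 λ { ≡.refl → ℕP.<⇒≢ 1≤d (≡.sym d≡d′p) }
        ω^p≈1 : ω F.^ p F.≈ F.1#
        ω^p≈1 = F.trans (F.^-assocʳ θ d′ p) (F.trans (F.^-congʳ θ (≡.sym d≡d′p)) (proj₁ (proj₂ θ-order)))
        order : ∀ i → ω F.^ i F.≈ F.1# → p ∣ i
        order i e = *-cancelˡ-∣ d′ {{ℕ.>-nonZero 1≤d′}} (≡.subst (_∣ d′ ℕ.* i) d≡d′p (Order⇒∣ θ-order (d′ ℕ.* i) (F.trans (F.sym (F.^-assocʳ θ d′ i)) e)))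
        -- This is (q - 1)/p, because q - 1 = r d and d = d′ p.
        W = r ℕ.* d′
        l = F.1# F.* (θ F.^ u) F.^ D
        notPower : ∀ i x y → 1 ≤ i → i < p → ¬ y F.≈ F.0# → ¬ x F.^ p F.* l F.^ i F.≈ y F.^ p F.* (σ F.^ (D ℕ.* s) F.* f₀) F.^ i
        notPower i x y 1≤i i<p y≉0 eq = contradiction′ (Order⇒∣ θ-order _ θ^≈1)
          where
          sign = sign-isPower {p} {d′} s pr ps∣m d≡d′p
          b = proj₁ sign
          b^p≈ = proj₂ sign
          b≉0 : ¬ b F.≈ F.0#
          b≉0 b≈0 = *-≉0 (^-≉0 s (F-prod-≉0 p λ j → ^-≉0 j (^-≉0 d′ θ≉0))) (λ z → 1≉0 (F.trans (F.sym (F.-‿involutive F.1#)) (F.trans (F.-‿cong z) F.-0#≈0#)))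
              (F.trans (F.sym b^p≈) (F.x≈0⇒x^n≈0 1≤p b≈0))
            where
            θ≉0 : ¬ θ F.≈ F.0#
            θ≉0 z = 1≉0 (F.trans (F.sym (proj₁ (proj₂ θ-order))) (F.x≈0⇒x^n≈0 1≤d z))
            F-prod-≉0 : ∀ n {g} → (∀ j → ¬ g j F.≈ F.0#) → ¬ F.prod n g F.≈ F.0#
            F-prod-≉0 zero    h = 1≉0
            F-prod-≉0 (suc n) h = *-≉0 (F-prod-≉0 n h) (h (suc n))
          -- The p-th root of the right-hand side after raising to the power e.
          z = y F.^ e F.* b F.^ (D ℕ.* e ℕ.* i)
          norm^e : (σ F.^ (D ℕ.* s) F.* f₀) F.^ e F.≈ (b F.^ (D ℕ.* e)) F.^ p
          norm^e = begin
            (σ F.^ (D ℕ.* s) F.* f₀) F.^ e  ≈⟨ F.^-distrib-* _ _ e ⟩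
            (σ F.^ (D ℕ.* s)) F.^ e F.* f₀ F.^ e  ≈⟨ F.*-cong (F.trans (F.^-assocʳ σ (D ℕ.* s) e) (F.trans (F.^-congʳ σ (swap D s e)) (F.sym (F.^-assocʳ σ s (D ℕ.* e)))))
                                                                                     (F.trans f₀^e (F.trans (F.^-assocʳ _ e D) (F.^-congʳ _ (ℕP.*-comm e D)))) ⟩
            (σ F.^ s) F.^ (D ℕ.* e) F.* (F.- F.1#) F.^ (D ℕ.* e)  ≈⟨ F.^-distrib-* _ _ (D ℕ.* e) ⟨
            (σ F.^ s F.* (F.- F.1#)) F.^ (D ℕ.* e)  ≈⟨ F.^-congˡ (D ℕ.* e) b^p≈ ⟨
            (b F.^ p) F.^ (D ℕ.* e)  ≈⟨ F.^-comm b p (D ℕ.* e) ⟩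
            (b F.^ (D ℕ.* e)) F.^ p  ∎
            where
            swap : ∀ D s e → D ℕ.* s ℕ.* e ≡ s ℕ.* (D ℕ.* e)
            swap = solve-∀
          eq^e : (x F.^ e) F.^ p F.* l F.^ (i ℕ.* e) F.≈ z F.^ p
          eq^e = begin
            (x F.^ e) F.^ p F.* l F.^ (i ℕ.* e)  ≈⟨ F.*-cong (F.^-comm x e p) (F.sym (F.^-assocʳ l i e)) ⟩
            (x F.^ p) F.^ e F.* (l F.^ i) F.^ e  ≈⟨ F.^-distrib-* _ _ e ⟨
            (x F.^ p F.* l F.^ i) F.^ e  ≈⟨ F.^-congˡ e eq ⟩
            (y F.^ p F.* (σ F.^ (D ℕ.* s) F.* f₀) F.^ i) F.^ e  ≈⟨ F.^-distrib-* _ _ e ⟩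
            (y F.^ p) F.^ e F.* ((σ F.^ (D ℕ.* s) F.* f₀) F.^ i) F.^ e    ≈⟨ F.*-cong (F.^-comm y p e) (F.trans (F.^-comm _ i e) (F.^-congˡ i norm^e)) ⟩
            (y F.^ e) F.^ p F.* ((b F.^ (D ℕ.* e)) F.^ p) F.^ i  ≈⟨ F.*-congˡ (F.trans (F.^-comm _ p i) (F.^-congˡ p (F.^-assocʳ b (D ℕ.* e) i))) ⟩
            (y F.^ e) F.^ p F.* (b F.^ (D ℕ.* e ℕ.* i)) F.^ p  ≈⟨ F.^-distrib-* _ _ p ⟨
            z F.^ p  ∎
          pW≡q-1 : p ℕ.* W ≡ q ∸ 1
          pW≡q-1 = ≡.trans (rearrange p r d′) (≡.trans (≡.cong (r ℕ.*_) (≡.sym d≡d′p)) (≡.sym q-1≡rd))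
            where
            rearrange : ∀ p r d′ → p ℕ.* (r ℕ.* d′) ≡ r ℕ.* (d′ ℕ.* p)
            rearrange = solve-∀
          -- Chosen so that d′ N is the exponent of θ in (l^(ie))^W. Since d = d′ p divides it, p
          -- divides N.
          N = u ℕ.* D ℕ.* (i ℕ.* e) ℕ.* r
          θ^≈1 : θ F.^ (d′ ℕ.* N) F.≈ F.1#
          θ^≈1 = begin
            θ F.^ (d′ ℕ.* N)  ≈⟨ F.^-congʳ θ (rearrange d′ u D (i ℕ.* e) r) ⟩
            θ F.^ (u ℕ.* D ℕ.* (i ℕ.* e) ℕ.* W)  ≈⟨ F.^-assocʳ θ (u ℕ.* D ℕ.* (i ℕ.* e)) W ⟨
            (θ F.^ (u ℕ.* D ℕ.* (i ℕ.* e))) F.^ W  ≈⟨ F.^-congˡ W (F.trans (F.^-congˡ (i ℕ.* e) (F.trans (F.*-identityˡ _) (F.^-assocʳ θ u D))) (F.^-assocʳ θ (u ℕ.* D) (i ℕ.* e))) ⟨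
            (l F.^ (i ℕ.* e)) F.^ W  ≈⟨ cancel-power {p} {W} 1≤p pW≡q-1 (*-≉0 (^-≉0 e y≉0) (^-≉0 (D ℕ.* e ℕ.* i) b≉0)) eq^e ⟩
            F.1#  ∎
            where
            rearrange : ∀ d′ u D x r → d′ ℕ.* (u ℕ.* D ℕ.* x ℕ.* r) ≡ u ℕ.* D ℕ.* x ℕ.* (r ℕ.* d′)
            rearrange = solve-∀
          contradiction′ : d ∣ d′ ℕ.* N → ⊥
          contradiction′ d∣ with euclidsLemma (u ℕ.* D ℕ.* (i ℕ.* e)) r pr (*-cancelˡ-∣ d′ {{ℕ.>-nonZero 1≤d′}} (≡.subst (_∣ d′ ℕ.* N) d≡d′p d∣))
          ... | inj₂ p∣r = p∤r p pr p∣m p∣r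
          ... | inj₁ p∣uDie with euclidsLemma (u ℕ.* D) (i ℕ.* e) pr p∣uDie
          ...   | inj₁ p∣uD with euclidsLemma u D pr p∣uD
          ...     | inj₁ p∣u = p∤u p∣u
          ...     | inj₂ p∣D = p∤k p pr p∣m (∣-trans p∣D D∣k)
          contradiction′ d∣ | inj₁ p∣uDie | inj₂ p∣ie with euclidsLemma i e pr p∣ie
          ...     | inj₁ p∣i = ℕP.<⇒≱ i<p (∣⇒≤ {{ℕ.>-nonZero 1≤i}} p∣i)
          ...     | inj₂ p∣e = ¬prime[1] (≡.subst Prime (coprime (p∣n , p∣e)) pr)

-- Divisors and cyclotomic polynomials

∈-oneTo⁻ : ∀ {n i} → i ∈ oneTo n → 1 ≤ i × i ≤ n
∈-oneTo⁻ {n} i∈ with ∈-map⁻ suc i∈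
... | j , j∈ , ≡.refl = s≤s z≤n , ∈-upTo⁻ j∈

∈-oneTo⁺ : ∀ {n i} → 1 ≤ i → i ≤ n → i ∈ oneTo n
∈-oneTo⁺ {n} {suc i} _ i<n = ∈-map⁺ suc (∈-upTo⁺ i<n)

oneTo-suc : ∀ n → oneTo (suc n) ≡ oneTo n ++ [ suc n ]
oneTo-suc n = ≡.trans (≡.cong (map suc) (≡.sym (ListP.upTo-∷ʳ n))) (ListP.map-++ suc (upTo n) [ n ])

∈-divisors⁻ : ∀ {n i} → i ∈ divisors n → 1 ≤ i × i ∣ n
∈-divisors⁻ {n} i∈ = proj₁ (∈-oneTo⁻ (proj₁ (∈-filter⁻ (_∣? n) {xs = oneTo n} i∈))) , proj₂ (∈-filter⁻ (_∣? n) {xs = oneTo n} i∈)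

properDivisors : ℕ → List ℕ
properDivisors n = filter (_∣? n) (oneTo (n ∸ 1))

∈-properDivisors⁻ : ∀ {n i} → i ∈ properDivisors n → 1 ≤ i × i ∣ n × i ≤ n ∸ 1
∈-properDivisors⁻ {n} i∈ = let i∈oneTo , i∣n = ∈-filter⁻ (_∣? n) {xs = oneTo (n ∸ 1)} i∈ in
  proj₁ (∈-oneTo⁻ i∈oneTo) , i∣n , proj₂ (∈-oneTo⁻ i∈oneTo)

divisors-snoc : ∀ n → 1 ≤ n → divisors n ≡ properDivisors n ++ [ n ]
divisors-snoc (suc n) _ = ≡.trans (≡.cong (filter (_∣? suc n)) (oneTo-suc n))
  (≡.trans (ListP.filter-++ (_∣? suc n) (oneTo n) [ suc n ]) (≡.cong (properDivisors (suc n) ++_) (ListP.filter-accept (_∣? suc n) ∣-refl)))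

module Factorisation {c ℓ} (F : Field c ℓ) (q : ℕ) (card : HasCardinality F q) where
  open IrreducibleFactors F q card public
  open BinomialFactorisation polynomialRing noZeroDivisors public using (when; HasOrder; x^dM-1)

  ∏ : ∀ {a} {I : Set a} → List I → (I → Pol) → Pol
  ∏ is g = foldr _*_ oneP (map g is)

  module _ {a} {I : Set a} where

    ∏-cong : ∀ (is : List I) {g h : I → Pol} → (∀ {i} → i ∈ is → g i ≋ h i) → ∏ is g ≋ ∏ is h
    ∏-cong []       eq = refl
    ∏-cong (i ∷ is) eq = *-cong (eq (here ≡.refl)) (∏-cong is λ i∈ → eq (there i∈))

    ∏-* : ∀ (is : List I) (g h : I → Pol) → ∏ is (λ i → g i * h i) ≋ ∏ is g * ∏ is h
    ∏-* []       g h = sym (*-identityˡ _)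
    ∏-* (i ∷ is) g h = trans (*-congˡ (∏-* is g h)) (*-interchange _ _ _ _)

    ∏-1 : ∀ (is : List I) {g : I → Pol} → (∀ i → g i ≋ oneP) → ∏ is g ≋ oneP
    ∏-1 []       eq = refl
    ∏-1 (i ∷ is) eq = trans (*-cong (eq i) (∏-1 is eq)) (*-identityˡ _)

    ∏-++ : ∀ (is js : List I) g → ∏ (is ++ js) g ≋ ∏ is g * ∏ js g
    ∏-++ []       js g = sym (*-identityˡ _)
    ∏-++ (i ∷ is) js g = trans (*-congˡ (∏-++ is js g)) (sym (*-assoc _ _ _))

    ∏-snoc : ∀ (is : List I) j g → ∏ (is ++ [ j ]) g ≋ ∏ is g * g j
    ∏-snoc is j g = trans (∏-++ is [ j ] g) (*-congˡ (*-identityʳ (g j)))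

    comp-∏ : ∀ (is : List I) g y → comp (∏ is g) y ≋ ∏ is (λ i → comp (g i) y)
    comp-∏ []       g y = comp-const F.1# y
    comp-∏ (i ∷ is) g y = trans (comp-* (g i) (∏ is g) y) (*-congˡ (comp-∏ is g y))

    ∣ₚ-∏ : ∀ (is : List I) {g : I → Pol} {f i} → i ∈ is → f ∣ₚ g i → f ∣ₚ ∏ is g
    ∣ₚ-∏ (i ∷ is) {g} {f} (here ≡.refl) (k , e) = k * ∏ is g ,
      trans (*-congʳ e) (solve 3 (λ k f r → k :* f :* r := k :* r :* f) refl k f (∏ is g))
    ∣ₚ-∏ (i ∷ is) {g} {f} (there i∈) f∣ = case ∣ₚ-∏ is {g} i∈ f∣ of λ { (k , e) → g i * k , trans (*-congˡ e) (sym (*-assoc (g i) k f)) }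

    prime-∣ₚ-∏ : ∀ {f} → Irreducible f → ∀ (is : List I) {g : I → Pol} → f ∣ₚ ∏ is g → ∃[ i ] i ∈ is × f ∣ₚ g i
    prime-∣ₚ-∏ {f} irr [] (k , e) = case lead? f of λ
      { (inj₁ z) → ⊥-elim (proj₁ irr (at z))
      ; (inj₂ (n , l , L)) → case irreducible-degree irr L of λ { (_ , ≡.refl) → ⊥-elim (ℕP.<⇒≱ (s≤s z≤n) (Lead-∣ₚ L Lead-1 (k , e))) } }
    prime-∣ₚ-∏ irr (i ∷ is) {g} f∣ = case irreducible⇒prime irr (g i) (∏ is g) f∣ of λ
      { (inj₁ f∣gi) → i , here ≡.refl , f∣gi
      ; (inj₂ f∣∏)  → case prime-∣ₚ-∏ irr is f∣∏ of λ { (j , j∈ , f∣gj) → j , there j∈ , f∣gj } }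

    Lead-∏ : ∀ (is : List I) {g : I → Pol} {n : I → ℕ} → (∀ {i} → i ∈ is → Lead (g i) (n i) F.1#) → Lead (∏ is g) (sum (map n is)) F.1#
    Lead-∏ []       h = Lead-1
    Lead-∏ (i ∷ is) h = Lead-≈ (F.*-identityˡ F.1#) (Lead-* (h (here ≡.refl)) (Lead-∏ is λ i∈ → h (there i∈)))

  prodₚ≋∏ : ∀ fs → prodₚ fs ≋ ∏ fs (λ f → f)
  prodₚ≋∏ []       = refl
  prodₚ≋∏ (f ∷ fs) = trans (reflexive (≡.sym (⊗≡*ₚ f (prodₚ fs)))) (*-congˡ (prodₚ≋∏ fs))

  prodₚ-map : ∀ {a} {I : Set a} (is : List I) g → prodₚ (map g is) ≋ ∏ is g
  prodₚ-map []       g = refl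
  prodₚ-map (i ∷ is) g = trans (reflexive (≡.sym (⊗≡*ₚ (g i) _))) (*-congˡ (prodₚ-map is g))

  prodₚ-concatMap : ∀ {a} {I : Set a} (is : List I) g → prodₚ (concatMap g is) ≋ ∏ is (λ i → prodₚ (g i))
  prodₚ-concatMap []       g = refl
  prodₚ-concatMap (i ∷ is) g = begin
    prodₚ (g i ++ concatMap g is)  ≈⟨ prodₚ≋∏ (g i ++ concatMap g is) ⟩
    ∏ (g i ++ concatMap g is) (λ f → f)  ≈⟨ ∏-++ (g i) (concatMap g is) (λ f → f) ⟩
    ∏ (g i) (λ f → f) * ∏ (concatMap g is) (λ f → f)      ≈⟨ *-cong (prodₚ≋∏ (g i)) (prodₚ≋∏ (concatMap g is)) ⟨
    prodₚ (g i) * prodₚ (concatMap g is)  ≈⟨ *-congˡ (prodₚ-concatMap is g) ⟩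
    prodₚ (g i) * ∏ is (λ i → prodₚ (g i))  ∎
    where open ≋-Reasoning

  ∏-filter : ∀ {a} {P : ℕ → Set a} (P? : ∀ i → Dec (P i)) N g → ∏ (filter P? (oneTo N)) g ≋ prod N (λ i → when (P? i) (g i))
  ∏-filter P? zero    g = refl
  ∏-filter P? (suc N) g = begin
    ∏ (filter P? (oneTo (suc N))) g  ≡⟨ ≡.cong (λ is → ∏ is g) (≡.trans (≡.cong (filter P?) (oneTo-suc N)) (ListP.filter-++ P? (oneTo N) [ suc N ])) ⟩
    ∏ (filter P? (oneTo N) ++ filter P? [ suc N ]) g  ≈⟨ ∏-++ (filter P? (oneTo N)) (filter P? [ suc N ]) g ⟩
    ∏ (filter P? (oneTo N)) g * ∏ (filter P? [ suc N ]) g      ≈⟨ *-cong (∏-filter P? N g) last ⟩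
    prod N (λ i → when (P? i) (g i)) * when (P? (suc N)) (g (suc N)) ∎
    where
    open ≋-Reasoning
    last : ∏ (filter P? [ suc N ]) g ≋ when (P? (suc N)) (g (suc N))
    last with P? (suc N)
    ... | yes _ = *-identityʳ _
    ... | no  _ = refl

  strip-zero : ∀ p → p ≋ [] → strip p ≡ []
  strip-zero []      e = ≡.refl
  strip-zero (a ∷ p) e with strip p | strip-zero p (mk λ i → at e (suc i))
  ... | [] | _ with a ≈? F.0#
  ...   | yes _ = ≡.refl
  ...   | no  h = ⊥-elim (h (at e 0))

  length-strip : ∀ p {n l} → Lead p n l → length (strip p) ≡ suc n
  length-strip [] L = ⊥-elim (Lead⇒≉0 L ≋-refl)
  length-strip (a ∷ p) {suc n} L with strip p | length-strip p {n} (record { leading = leading L ; nonzero = nonzero L ; above = λ i lt → above L (suc i) (s≤s lt) })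
  ... | b ∷ r | eq = ≡.cong suc eq
  length-strip (a ∷ p) {zero} L with strip p | strip-zero p (mk λ i → above L (suc i) (s≤s z≤n))
  ... | [] | _ with a ≈? F.0#
  ...   | yes z = ⊥-elim (nonzero L (F.trans (F.sym (leading L)) z))
  ...   | no  _ = ≡.refl

  deg-Lead : ∀ {p n l} → Lead p n l → deg p ≡ n
  deg-Lead {p} L = ≡.cong (ℕ._∸ 1) (length-strip p L)

  Monic⇒Lead : ∀ {p} → Monic p → Lead p (deg p) F.1#
  Monic⇒Lead {p} (n , e , above-n) = ≡.subst (λ n → Lead p n F.1#) (≡.sym (deg-Lead L)) L
    where
    L : Lead p n F.1#
    L = record { leading = e ; nonzero = 1≉0 ; above = above-n }

  X^_−1 : ℕ → Pol
  X^ n −1 = X ^ n + [ F.- F.1# ]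

  Lead-X^-1 : ∀ e → 1 ≤ e → Lead (X^ e −1) e F.1#
  Lead-X^-1 e 1≤e = Lead-cong (+-comm _ _) (Lead-+ˡ (λ i e≤i → coeff-bound [ F.- F.1# ] i (ℕP.≤-trans 1≤e e≤i)) (Lead-X^ e))

  [-1]≋ : [ F.- F.1# ] ≋ RingKit.-_ polynomialRing oneP
  [-1]≋ = sym (mk λ { zero → coeff-⊝ oneP 0 ; (suc i) → F.trans (coeff-⊝ oneP (suc i)) F.-0#≈0# })

  ∣ₚ-trans : ∀ {f g h} → f ∣ₚ g → g ∣ₚ h → f ∣ₚ h
  ∣ₚ-trans {f} (k , e) (k′ , e′) = k′ * k , trans e′ (trans (*-congˡ e) (sym (*-assoc k′ k f)))

  module _ (f : Pol) where
    open PrincipalQuotient polynomialRing f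
    private module K = RingKit quotientRing

    ∣ₚX^-1⇒∼ : ∀ e → f ∣ₚ X^ e −1 → X ^ e ∼ oneP
    ∣ₚX^-1⇒∼ e (k , eq) = mod k (trans (trans (solve 2 (λ x o → x := o :+ (x :- o)) refl (X ^ e) oneP) (+-congˡ (+-congˡ (sym [-1]≋)))) (+-congˡ eq))

    ∼⇒∣ₚX^-1 : ∀ e → X ^ e ∼ oneP → f ∣ₚ X^ e −1
    ∼⇒∣ₚX^-1 e (mod k eq) = k , trans (+-cong eq [-1]≋) (solve 3 (λ o k f → (o :+ k :* f) :- o := k :* f) refl oneP k f)

  -- f^Q = f(X^Q) ≡ f modulo f^2, for Q = q^k.
  squarefree : ∀ {f D l} e k → Lead f (suc D) l → 1 ≤ k → e ∣ q ℕ.^ k ∸ 1 → ¬ f * f ∣ₚ X^ e −1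
  squarefree {f} {D} e k L 1≤k e∣ f²∣ = case ∼0⇒multiple f∼0[f²] of λ
    { (h , eq) → ℕP.<⇒≱ (ℕP.m<m+n (suc D) (s≤s z≤n)) (Lead-∣ₚ (Lead-* L L) L (h , eq)) }
    where
    open PrincipalQuotient polynomialRing (f * f)
    module K = RingKit quotientRing
    f^∼0[f²] : ∀ {Q} → 2 ≤ Q → f ^ Q ∼ []
    f^∼0[f²] {suc (suc Q)} (s≤s (s≤s _)) = multiple⇒∼0 (f ^ Q) (solve 2 (λ f P → f :* (f :* P) := P :* (f :* f)) refl f (f ^ Q))
    2≤q^k : 2 ≤ q ℕ.^ k
    2≤q^k = ℕP.≤-trans 2≤q (ℕP.≤-trans (ℕP.≤-reflexive (≡.sym (ℕP.^-identityʳ q))) (ℕP.^-monoʳ-≤ q {{ℕ.>-nonZero (ℕP.<⇒≤ 2≤q)}} 1≤k))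
    f∼0[f²] : f ∼ []
    f∼0[f²] = K.trans (K.sym (Modulo.fixes-all (f * f) {k} (Modulo.^∼1⇒fixes (f * f) {e} {k} (∣ₚX^-1⇒∼ (f * f) e f²∣) e∣) f)) (f^∼0[f²] 2≤q^k)

  module _ (Φ : ℕ → Pol) (cyclotomic : IsCyclotomicFamily Φ) where

    X^-1≋∏Φ : ∀ e → 1 ≤ e → X^ e −1 ≋ ∏ (divisors e) Φ
    X^-1≋∏Φ e 1≤e = trans (sym (xPowMinusOne≋ e)) (trans (asEq _ _ (proj₂ cyclotomic e 1≤e)) (prodₚ-map (divisors e) Φ))

    X^-1≋properΦ*Φ : ∀ e → 1 ≤ e → X^ e −1 ≋ ∏ (properDivisors e) Φ * Φ e
    X^-1≋properΦ*Φ e 1≤e = trans (X^-1≋∏Φ e 1≤e) (trans (reflexive (≡.cong (λ is → ∏ is Φ) (divisors-snoc e 1≤e))) (∏-snoc (properDivisors e) e Φ))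

  module _ {e k : ℕ} (1≤e : 1 ≤ e) (order-q : IsMultOrderMod e q k) where
    private
      1≤k = proj₁ order-q
      e∣q^k-1 = proj₁ (proj₂ order-q)
      k-minimal = proj₂ (proj₂ order-q)

    factor-conjugates : ∀ {f D} → (irr : Irreducible f) (L : Lead f D F.1#) → f ∣ₚ X^ e −1 → Conjugates irr L k
    factor-conjugates {f} irr L f∣ = conjugates irr L k 1≤k (Modulo.^∼1⇒fixes f {e} {k} (∣ₚX^-1⇒∼ f e f∣) e∣q^k-1)

    module _ (Φ : ℕ → Pol) (cyclotomic : IsCyclotomicFamily Φ) where

      Φ∣X^-1 : Φ e ∣ₚ X^ e −1
      Φ∣X^-1 = ∏ (properDivisors e) Φ , X^-1≋properΦ*Φ Φ cyclotomic e 1≤e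

      -- If f divided X^j - 1, it would divide Φ_i for some i ∣ j, a proper divisor of e. Together
      -- with its occurrence in Φ_e this puts f² into X^e - 1, which is squarefree.
      Φ-factor-primitive : ∀ {f D l} → Irreducible f → Lead f D l → f ∣ₚ Φ e → ∀ j → j ∣ e → 1 ≤ j → j < e → ¬ f ∣ₚ X^ j −1
      Φ-factor-primitive {f} irr L f∣Φe j j∣e 1≤j j<e f∣ =
        case prime-∣ₚ-∏ irr (divisors j) (∣ₚ-cong (X^-1≋∏Φ Φ cyclotomic j 1≤j) f∣) of λ
        { (i , i∈ , f∣Φi) → case irreducible-degree irr L of λ { (_ , ≡.refl) → squarefree e k L 1≤k e∣q^k-1
            (combine f∣Φe (∣ₚ-∏ (properDivisors e) {Φ} (proper i∈) f∣Φi)) } }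
        where
        ∣ₚ-cong : ∀ {a b} → a ≋ b → f ∣ₚ a → f ∣ₚ b
        ∣ₚ-cong a≋b (h , eq) = h , trans (sym a≋b) eq
        proper : ∀ {i} → i ∈ divisors j → i ∈ properDivisors e
        proper i∈ = let 1≤i , i∣j = ∈-divisors⁻ i∈ in ∈-filter⁺ (_∣? e)
          (∈-oneTo⁺ 1≤i (ℕP.∸-monoˡ-≤ 1 (ℕP.≤-<-trans (∣⇒≤ {{ℕ.>-nonZero 1≤j}} i∣j) j<e))) (∣-trans i∣j j∣e)
        combine : f ∣ₚ Φ e → f ∣ₚ ∏ (properDivisors e) Φ → f * f ∣ₚ X^ e −1
        combine (h , eq) (h′ , eq′) = h′ * h , trans (X^-1≋properΦ*Φ Φ cyclotomic e 1≤e) (trans (*-cong eq′ eq) (*-interchange h′ f h f))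

      -- One inequality is D ∣ k. For the other, X^e and X^(q^D - 1) are both 1 modulo f, hence so
      -- is X^g for g = gcd(e, q^D - 1). Primitivity forces g = e, so e ∣ q^D - 1, and the
      -- minimality of k gives k ≤ D.
      Φ-factor-degree : ∀ {f D} → Irreducible f → Lead f D F.1# → f ∣ₚ Φ e → D ≡ k
      Φ-factor-degree {f} {D} irr L f∣Φe = ℕP.≤-antisym (∣⇒≤ {{ℕ.>-nonZero 1≤k}} (Conjugates.degree∣ conj)) k≤D
        where
        f∣X^e-1 = ∣ₚ-trans f∣Φe Φ∣X^-1
        conj = factor-conjugates irr L f∣X^e-1
        g = gcd e (q ℕ.^ D ∸ 1)
        X^e∼1 = ∣ₚX^-1⇒∼ f e f∣X^e-1
        f∣X^g-1 : f ∣ₚ X^ g −1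
        f∣X^g-1 = ∼⇒∣ₚX^-1 f g (Modulo.^∼1-gcd f {e} {q ℕ.^ D ∸ 1} X^e∼1 (Modulo.fixes⇒^∼1 f {e} {D} 1≤e X^e∼1 (Conjugates.fixed conj)))
        1≤g : 1 ≤ g
        1≤g = ℕP.n≢0⇒n>0 λ z → ℕP.<⇒≢ 1≤e (≡.sym (gcd[m,n]≡0⇒m≡0 {e} z))
        g∣e = gcd[m,n]∣m e (q ℕ.^ D ∸ 1)
        g≡e : g ≡ e
        g≡e = case ℕP.m≤n⇒m<n∨m≡n (∣⇒≤ {{ℕ.>-nonZero 1≤e}} g∣e) of λ
          { (inj₂ eq) → eq ; (inj₁ g<e) → ⊥-elim (Φ-factor-primitive irr L f∣Φe g g∣e 1≤g g<e f∣X^g-1) }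
        k≤D : k ≤ D
        k≤D = case k ℕ.≤? D of λ
          { (yes le) → le
          ; (no gt) → ⊥-elim (k-minimal D (1≤D irr L) (ℕP.≰⇒> gt) (≡.subst (_∣ q ℕ.^ D ∸ 1) g≡e (gcd[m,n]∣n e (q ℕ.^ D ∸ 1)))) }

-- The lifted factors

module LiftedFactors {c ℓ} (F : Field c ℓ) (q : ℕ) (card : HasCardinality F q)
  {e k n d m r : ℕ} (1≤e : 1 ≤ e) (order-q : IsMultOrderMod e q k) (params : Parameters q e k n d m r)
  {θ : Field.Carrier F} (θ-multOrder : Poly.HasMultOrder F q card θ d) where
  open Factorisation F q card
  open Parameters params

  θ-order : Order θ d
  θ-order = HasMultOrder⇒Order θ-multOrder

  θ^d≈1 : θ F.^ d F.≈ F.1#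
  θ^d≈1 = proj₁ (proj₂ θ-order)

  -- The inverse of θ, written as a power of θ so that negative exponents obey the laws of natural
  -- ones.
  η : F.Carrier
  η = θ F.^ (d ∸ 1)

  θη≈1 : θ F.* η F.≈ F.1#
  θη≈1 = F.trans (F.^-congʳ θ (ℕP.m+[n∸m]≡n 1≤d)) θ^d≈1

  θ^η^≈1 : ∀ j → θ F.^ j F.* η F.^ j F.≈ F.1#
  θ^η^≈1 j = F.trans (F.sym (F.^-distrib-* θ η j)) (F.trans (F.^-congˡ j θη≈1) (F.1^n≈1 j))

  θ^≉0 : ∀ j → ¬ θ F.^ j F.≈ F.0#
  θ^≉0 j z = 1≉0 (F.trans (F.sym (θ^η^≈1 j)) (F.trans (F.*-congʳ z) (F.zeroˡ _)))

  pow⁻¹≈η^ : ∀ j → pow θ j ⁻¹ F.≈ η F.^ j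
  pow⁻¹≈η^ j = begin
    pow θ j ⁻¹  ≈⟨ F.*-identityʳ _ ⟨
    pow θ j ⁻¹ F.* F.1#  ≈⟨ F.*-congˡ (θ^η^≈1 j) ⟨
    pow θ j ⁻¹ F.* (θ F.^ j F.* η F.^ j)    ≈⟨ F.*-assoc _ _ _ ⟨
    pow θ j ⁻¹ F.* θ F.^ j F.* η F.^ j      ≈⟨ F.*-congʳ (F.trans (F.*-comm _ _) (F.trans (F.*-congʳ (F.reflexive (≡.sym (pow≡^ θ j)))) (⁻¹-inverse (pow θ j) pow≉0))) ⟩
    F.1# F.* η F.^ j  ≈⟨ F.*-identityˡ _ ⟩
    η F.^ j  ∎
    where
    open import Relation.Binary.Reasoning.Setoid F.setoid
    pow≉0 : ¬ pow θ j F.≈ F.0#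
    pow≉0 z = θ^≉0 j (F.trans (F.reflexive (≡.sym (pow≡^ θ j))) z)

  η^≉0 : ∀ j → ¬ η F.^ j F.≈ F.0#
  η^≉0 j z = 1≉0 (F.trans (F.sym (θ^η^≈1 j)) (F.trans (F.*-congˡ z) (F.zeroʳ _)))

  -- The inverse of θ has the same order d, and the exponent e is prime to d because it is prime to
  -- n.
  η^-order : ∀ {e} → Coprime n e → HasOrder [ η F.^ e ] d
  η^-order {e} n⊥e = 1≤d , trans (constP-^ _ d) (constP-cong (F.trans (F.^-assocʳ η e d) (F.trans (F.^-congʳ η (ℕP.*-comm e d)) (F.trans (F.sym (F.^-assocʳ η d e)) (F.trans (F.^-congˡ e η^d≈1) (F.1^n≈1 e)))))) ,
    λ j 1≤j j<d eq → ℕP.<⇒≱ j<d (∣⇒≤ {{ℕ.>-nonZero 1≤j}} (coprime-divisor d⊥e (Order⇒∣ θ-order (e ℕ.* j) (θ^≈1 (e ℕ.* j)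
      (F.trans (F.sym (F.^-assocʳ η e j)) (at (trans (sym (constP-^ _ j)) eq) 0))))))
    where
    η^d≈1 : η F.^ d F.≈ F.1#
    η^d≈1 = F.trans (F.^-comm θ (d ∸ 1) d) (F.trans (F.^-congˡ (d ∸ 1) θ^d≈1) (F.1^n≈1 (d ∸ 1)))
    θ^≈1 : ∀ j → η F.^ j F.≈ F.1# → θ F.^ j F.≈ F.1#
    θ^≈1 j eq = F.trans (F.sym (F.*-identityʳ _)) (F.trans (F.*-congˡ (F.sym eq)) (θ^η^≈1 j))
    d⊥e : Coprime d e
    d⊥e (c∣d , c∣e) = n⊥e (≡.subst (_ ∣_) (≡.sym n≡dm) (∣m⇒∣m*n m c∣d) , c∣e)

  -- The weight `w` is an argument of its own instead of `deg p`, so that weights add under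
  -- multiplication without any computation of degrees.
  factor : ℕ → Pol → ℕ → ℕ → Pol
  factor w p t u = [ η F.^ (u ℕ.* w) ] * comp p ([ θ F.^ u ] * X ^ t)

  -- The substitution in the theorem, as a multiplicative function of a polynomial p of degree w.
  lift : ℕ → Pol → Pol
  lift w p = ∏ (divisors m) (λ t → ∏ (coprimeUpTo d t) (factor w p t))

  lift-cong : ∀ {w p p′} → p ≋ p′ → lift w p ≋ lift w p′
  lift-cong eq = ∏-cong (divisors m) λ {t} _ → ∏-cong (coprimeUpTo d t) λ _ → *-congˡ (comp-congˡ _ eq)

  lift-* : ∀ w w′ p p′ → lift (w ℕ.+ w′) (p * p′) ≋ lift w p * lift w′ p′
  lift-* w w′ p p′ = trans (∏-cong (divisors m) λ {t} _ → trans (∏-cong (coprimeUpTo d t) λ {u} _ → multiplicative t u) (∏-* (coprimeUpTo d t) (factor w p t) (factor w′ p′ t)))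
    (∏-* (divisors m) _ _)
    where
    multiplicative : ∀ t u → factor (w ℕ.+ w′) (p * p′) t u ≋ factor w p t u * factor w′ p′ t u
    multiplicative t u = trans (*-cong (trans (constP-cong (F.trans (F.^-congʳ η (ℕP.*-distribˡ-+ u w w′)) (F.^-homo-* η (u ℕ.* w) (u ℕ.* w′)))) (sym (constP-* _ _))) (comp-* p p′ _))
      (*-interchange _ _ _ _)

  lift-1 : lift 0 oneP ≋ oneP
  lift-1 = ∏-1 (divisors m) λ t → ∏-1 (coprimeUpTo d t) λ u →
    trans (*-cong (constP-cong (F.^-congʳ η (ℕP.*-zeroʳ u))) (comp-const F.1# _)) (*-identityˡ oneP)

  lift-∏ : ∀ {a} {I : Set a} (is : List I) (w : I → ℕ) g → lift (sum (map w is)) (∏ is g) ≋ ∏ is (λ i → lift (w i) (g i))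
  lift-∏ []       w g = lift-1
  lift-∏ (i ∷ is) w g = trans (lift-* (w i) (sum (map w is)) (g i) (∏ is g)) (*-congˡ (lift-∏ is w g))

  prodₚ-liftFactors : ∀ (w : Pol → ℕ) fs → prodₚ (liftFactors w θ d m fs) ≋ lift (sum (map w fs)) (∏ fs (λ f → f))
  prodₚ-liftFactors w fs = trans (prodₚ-concatMap fs _) (trans (∏-cong fs λ {f} _ → trans (prodₚ-concatMap (divisors m) _)
    (∏-cong (divisors m) λ {t} _ → trans (prodₚ-map (coprimeUpTo d t) _) (∏-cong (coprimeUpTo d t) λ {u} _ → element f t u)))
    (sym (lift-∏ fs w (λ f → f))))
    where
    element : ∀ f t u → scale (pow θ (u ℕ.* w f) ⁻¹) (substMono (pow θ u) t f) ≋ factor (w f) f t u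
    element f t u = trans (sym ([ pow θ (u ℕ.* w f) ⁻¹ ]⊗ _)) (*-cong (constP-cong (pow⁻¹≈η^ (u ℕ.* w f)))
      (trans (substMono≋comp (pow θ u) t f) (comp-congʳ f (*-congʳ (constP-cong (F.reflexive (pow≡^ θ u)))))))

  -- The factor at (t, u) is θ^(-ue) (θ^(ue) x^(te) - 1) = (x^e)^t - (θ^(-e))^u, so the binomial
  -- identity applies with y = x^e and the element θ^(-e), which has order d.
  lift-X^-1 : ∀ e → Coprime n e → lift e (X^ e −1) ≋ X^ e ℕ.* n −1
  lift-X^-1 e n⊥e = begin
    lift e (X^ e −1)  ≈⟨ ∏-cong (divisors m) (λ {t} _ → ∏-cong (coprimeUpTo d t) λ {u} _ → binomial t u) ⟩
    ∏ (divisors m) (λ t → ∏ (coprimeUpTo d t) (term t))     ≈⟨ ∏-cong (divisors m) (λ {t} _ → ∏-filter (λ u → gcd u t ℕ.≟ 1) d (term t)) ⟩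
    ∏ (divisors m) (λ t → prod d (λ u → when (gcd u t ℕ.≟ 1) (term t u))) ≈⟨ ∏-filter (_∣? m) m _ ⟩
    prod m (λ t → when (t ∣? m) (prod d (λ u → when (gcd u t ℕ.≟ 1) (term t u)))) ≈⟨ x^dM-1 m 1≤m [ η F.^ e ] d (X ^ e) (η^-order n⊥e) p∣d ⟩
    (X ^ e) ^ (d ℕ.* m) P.- oneP  ≈⟨ +-cong (trans (^-assocʳ X e (d ℕ.* m)) (^-congʳ X (≡.cong (e ℕ.*_) (≡.sym n≡dm)))) (sym [-1]≋) ⟩
    X^ e ℕ.* n −1  ∎
    where
    open ≋-Reasoning
    module P = RingKit polynomialRing
    term : ℕ → ℕ → Pol
    term t u = (X ^ e) ^ t P.- [ η F.^ e ] ^ u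
    binomial : ∀ t u → factor e (X^ e −1) t u ≋ term t u
    binomial t u = begin
      [ η F.^ (u ℕ.* e) ] * comp (X ^ e + [ F.- F.1# ]) y
        ≈⟨ *-congˡ (trans (comp-+ (X ^ e) _ y) (+-cong (trans (comp-X^ e y) (^-distrib-* _ _ e)) (trans (comp-const _ y) [-1]≋))) ⟩
      [ η F.^ (u ℕ.* e) ] * ([ θ F.^ u ] ^ e * (X ^ t) ^ e + P.- oneP)
        ≈⟨ solve 3 (λ a b x → a :* (b :* x :+ :- con (ℤ.+ 1)) := (b :* a) :* x :- a) refl [ η F.^ (u ℕ.* e) ] ([ θ F.^ u ] ^ e) ((X ^ t) ^ e) ⟩
      ([ θ F.^ u ] ^ e * [ η F.^ (u ℕ.* e) ]) * (X ^ t) ^ e P.- [ η F.^ (u ℕ.* e) ]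
        ≈⟨ +-cong (trans (*-congʳ unit) (trans (*-identityˡ _) (^-comm X t e))) (-‿cong (trans (constP-cong (F.trans (F.^-congʳ η (ℕP.*-comm u e)) (F.sym (F.^-assocʳ η e u)))) (sym (constP-^ _ u)))) ⟩
      term t u ∎
      where
      y = [ θ F.^ u ] * X ^ t
      unit : [ θ F.^ u ] ^ e * [ η F.^ (u ℕ.* e) ] ≋ oneP
      unit = trans (*-congʳ (trans (constP-^ _ e) (constP-cong (F.^-assocʳ θ u e)))) (trans (constP-* _ _) (constP-cong (θ^η^≈1 (u ℕ.* e))))

  module _ (Φ : ℕ → Pol) (cyclotomic : IsCyclotomicFamily Φ) where

    Lead-Φ : ∀ {j} → 1 ≤ j → Lead (Φ j) (deg (Φ j)) F.1#
    Lead-Φ 1≤j = Monic⇒Lead (proj₁ cyclotomic _ 1≤j)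

    1≤n : 1 ≤ n
    1≤n = ≡.subst (1 ℕ.≤_) (≡.sym n≡dm) (ℕP.*-mono-≤ 1≤d 1≤m)

    Lead-comp-X^n : ∀ {p w} → Lead p w F.1# → ∃[ N ] Lead (comp p (X ^ n)) N F.1#
    Lead-comp-X^n {p} {w} L = _ , Lead-≈ (F.trans (F.*-identityˡ _) (F.1^n≈1 w))
      (Lead-comp L (≡.subst (λ s → Lead (X ^ n) s F.1#) (≡.sym (ℕP.m+[n∸m]≡n 1≤n)) (Lead-X^ n)))

    -- Both sides multiply up, over the divisors of e, to X^(en) − 1; cancel the proper divisors.
    Φ-lift : ∀ e → 1 ≤ e → Coprime n e → comp (Φ e) (X ^ n) ≋ lift (deg (Φ e)) (Φ e)
    Φ-lift = <-rec _ step
      where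
      step : ∀ e → (∀ {j} → j < e → 1 ≤ j → Coprime n j → comp (Φ j) (X ^ n) ≋ lift (deg (Φ j)) (Φ j)) →
        1 ≤ e → Coprime n e → comp (Φ e) (X ^ n) ≋ lift (deg (Φ e)) (Φ e)
      step e rec 1≤e n⊥e = *-cancelʳ (comp Π (X ^ n)) (Lead⇒≉0 (proj₂ (Lead-comp-X^n Lead-Π))) (begin
        comp (Φ e) (X ^ n) * comp Π (X ^ n)  ≈⟨ trans (*-comm _ _) (sym (comp-* Π (Φ e) (X ^ n))) ⟩
        comp (Π * Φ e) (X ^ n)  ≈⟨ comp-congˡ (X ^ n) (sym X^e-1≋) ⟩
        comp (X^ e −1) (X ^ n)  ≈⟨ trans (comp-+ (X ^ e) _ _) (+-cong (trans (comp-X^ e _) (trans (^-assocʳ X n e) (^-congʳ X (ℕP.*-comm n e)))) (comp-const _ _)) ⟩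
        X^ e ℕ.* n −1  ≈⟨ lift-X^-1 e n⊥e ⟨
        lift e (X^ e −1)  ≈⟨ lift-cong X^e-1≋ ⟩
        lift e (Π * Φ e)  ≈⟨ reflexive (≡.cong (λ w → lift w (Π * Φ e)) (proj₁ (Lead-unique X^e-1≋ (Lead-X^-1 e 1≤e) (Lead-* Lead-Π (Lead-Φ 1≤e))))) ⟩
        lift (W ℕ.+ deg (Φ e)) (Π * Φ e)  ≈⟨ lift-* W (deg (Φ e)) Π (Φ e) ⟩
        lift W Π * lift (deg (Φ e)) (Φ e)  ≈⟨ *-congʳ (lift-∏ ds (λ j → deg (Φ j)) Φ) ⟩
        ∏ ds (λ j → lift (deg (Φ j)) (Φ j)) * lift (deg (Φ e)) (Φ e) ≈⟨ *-congʳ (∏-cong ds λ j∈ → let 1≤j , j∣e , j≤ = ∈-properDivisors⁻ {e} j∈ in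
                                                                            sym (rec (ℕP.≤-<-trans j≤ (ℕP.∸-monoʳ-< (s≤s z≤n) 1≤e)) 1≤j (coprime-∣ʳ j∣e n⊥e))) ⟩
        ∏ ds (λ j → comp (Φ j) (X ^ n)) * lift (deg (Φ e)) (Φ e) ≈⟨ trans (*-comm _ _) (*-congˡ (sym (comp-∏ ds Φ (X ^ n)))) ⟩
        lift (deg (Φ e)) (Φ e) * comp Π (X ^ n)       ∎)
        where
        open ≋-Reasoning
        ds = properDivisors e
        Π = ∏ ds Φ
        W = sum (map (λ j → deg (Φ j)) ds)
        Lead-Π : Lead Π W F.1#
        Lead-Π = Lead-∏ ds λ j∈ → Lead-Φ (proj₁ (∈-properDivisors⁻ {e} j∈))
        X^e-1≋ : X^ e −1 ≋ Π * Φ e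
        X^e-1≋ = X^-1≋properΦ*Φ Φ cyclotomic e 1≤e

  -- Up to the constant `c` the polynomial is g(X^t) with g(x) = f(θ^u x), whose end coefficients
  -- are θ^(u deg f) and f(0). A prime divisor of t divides m, and it does not divide u because
  -- gcd(u, t) = 1.
  lifted-irreducible : ∀ {f} c → ¬ c F.≈ F.0# → Monic f → Irreducible f → f ∣ₚ X^ e −1 →
    ∀ t u → t ∣ m → gcd u t ≡ 1 → Irreducible (scale c (substMono (pow θ u) t f))
  lifted-irreducible {f} c c≉0 monic irr f∣ t u t∣m u⊥t =
    Irreducible-cong (trans ([ c ]⊗ _) (scale-cong F.refl (sym (trans (substMono≋comp (pow θ u) t f) (trans (comp-congʳ f y≋) (sym (comp-comp f _ _)))))))
      (Irreducible-scale c c≉0 L-gX^t (irreducible-substitution (factorise t {{ℕ.>-nonZero 1≤t}})))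
    where
    1≤t : 1 ≤ t
    1≤t = ℕP.n≢0⇒n>0 λ { ≡.refl → ℕP.<⇒≢ 1≤m (≡.sym (0∣⇒≡0 t∣m)) }
    L : Lead f (deg f) F.1#
    L = Monic⇒Lead monic
    g = dilate (θ F.^ u) f
    L-g = Lead-dilate (θ F.^ u) (θ^≉0 u) L
    conj = factor-conjugates 1≤e order-q irr L f∣
    y≋ : [ pow θ u ] * X ^ t ≋ comp ([ θ F.^ u ] * X) (X ^ t)
    y≋ = trans (*-congʳ (constP-cong (F.reflexive (pow≡^ θ u)))) (sym (comp-[]*X _ _))
    L-gX^t = Lead-comp L-g (≡.subst (λ s → Lead (X ^ t) s F.1#) (≡.sym (ℕP.m+[n∸m]≡n 1≤t)) (Lead-X^ t))
    irreducible-substitution : PrimeFactorisation t → Irreducible (comp g (X ^ t))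
    irreducible-substitution record { factors = ps ; isFactorisation = t≡ ; factorsPrime = primes } =
      ≡.subst (λ t → Irreducible (comp g (X ^ t))) (≡.sym t≡)
        (irreducible-comp-X^ (Irreducible-dilate (θ F.^ u) (θ^≉0 u) L irr) L-g ps primes λ p s pr ps∣t → NormNotPower-cong
          (F.sym (comp-0 f (F.trans (coeff-*-0′ [ θ F.^ u ] X) (F.zeroʳ _))))
          (dilated-normNotPower params θ-order {p} {s} {u} pr (∣-trans ps∣t (≡.subst (_∣ m) t≡ t∣m))
            (λ p∣u → ¬prime[1] (≡.subst Prime (gcd≡1⇒coprime {u} {t} u⊥t (p∣u , ≡.subst (p ∣_) (≡.sym t≡) (∣-trans (m∣m*n s) ps∣t))) pr))
            (Conjugates.degree∣ conj) (Conjugates.constant^ conj e (∣ₚX^-1⇒∼ f e f∣))))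

  liftFactors-irreducible : ∀ fs → All MonicIrreducible fs → (∀ {f} → f ∈ fs → f ∣ₚ X^ e −1) → All Irreducible (liftFactors deg θ d m fs)
  liftFactors-irreducible fs irrs f∣ = AllP.concat⁺ (AllP.map⁺ (All.tabulate λ {f} f∈ → AllP.concat⁺ (AllP.map⁺ (All.tabulate λ {t} t∈ → AllP.map⁺ (All.tabulate λ {u} u∈ →
    let monic , irr = All.lookup irrs f∈ in
    lifted-irreducible (pow θ (u ℕ.* deg f) ⁻¹) (λ z → η^≉0 (u ℕ.* deg f) (F.trans (F.sym (pow⁻¹≈η^ (u ℕ.* deg f))) z)) monic irr (f∣ f∈) t u
      (proj₂ (∈-divisors⁻ t∈)) (proj₂ (∈-filter⁻ (λ u → gcd u t ℕ.≟ 1) {xs = oneTo d} u∈)))))))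

  -- Reconciles the exponent -uk of the cyclotomic statement with the exponent -u deg f: all
  -- irreducible factors of Φ_e have degree k.
  liftFactors-weight : ∀ w fs → (∀ {f} → f ∈ fs → deg f ≡ w) → liftFactors (λ _ → w) θ d m fs ≡ liftFactors deg θ d m fs
  liftFactors-weight w []       eq = ≡.refl
  liftFactors-weight w (f ∷ fs) eq = ≡.cong₂ _++_
    (≡.cong (λ w → concatMap (λ t → map (λ u → scale (pow θ (u ℕ.* w) ⁻¹) (substMono (pow θ u) t f)) (coprimeUpTo d t)) (divisors m)) (≡.sym (eq (here ≡.refl))))
    (liftFactors-weight w fs (λ f∈ → eq (there f∈)))

  Lead-product : ∀ fs → All MonicIrreducible fs → Lead (∏ fs (λ f → f)) (sum (map deg fs)) F.1#
  Lead-product fs irrs = Lead-∏ fs λ f∈ → Monic⇒Lead (proj₁ (All.lookup irrs f∈))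

  prodₚ-liftFactors-deg : ∀ {p w} fs → All MonicIrreducible fs → p ≋ ∏ fs (λ f → f) → Lead p w F.1# → prodₚ (liftFactors deg θ d m fs) ≋ lift w p
  prodₚ-liftFactors-deg {p} fs irrs eq L = trans (prodₚ-liftFactors deg fs)
    (trans (reflexive (≡.cong (λ w → lift w (∏ fs (λ f → f))) (≡.sym (proj₁ (Lead-unique eq L (Lead-product fs irrs)))))) (lift-cong (sym eq)))

  member-∣ₚ : ∀ {p} fs → p ≋ ∏ fs (λ f → f) → ∀ {f} → f ∈ fs → f ∣ₚ p
  member-∣ₚ fs eq {f} f∈ = case ∣ₚ-∏ fs f∈ (oneP , sym (*-identityˡ f)) of λ { (h , eq′) → h , trans eq eq′ }

  module _ (Φ : ℕ → Pol) (cyclotomic : IsCyclotomicFamily Φ) where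

    Φ-factorisation : ∀ fs → All MonicIrreducible fs → Φ e ≈ₚ prodₚ fs →
      All Irreducible (liftFactors (λ _ → k) θ d m fs) × substPow n (Φ e) ≈ₚ prodₚ (liftFactors (λ _ → k) θ d m fs)
    Φ-factorisation fs irrs eq = ≡.subst (λ gs → All Irreducible gs × substPow n (Φ e) ≈ₚ prodₚ gs) (≡.sym (liftFactors-weight k fs degree))
      ( liftFactors-irreducible fs irrs (λ f∈ → ∣ₚ-trans (member-∣ₚ fs Φ≋ f∈) (Φ∣X^-1 1≤e order-q Φ cyclotomic))
      , at (trans (substPow≋comp n (Φ e)) (trans (Φ-lift Φ cyclotomic e 1≤e coprime) (sym (prodₚ-liftFactors-deg fs irrs Φ≋ (Lead-Φ Φ cyclotomic 1≤e))))))
      where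
      Φ≋ : Φ e ≋ ∏ fs (λ f → f)
      Φ≋ = trans (asEq _ _ eq) (prodₚ≋∏ fs)
      degree : ∀ {f} → f ∈ fs → deg f ≡ k
      degree f∈ = let monic , irr = All.lookup irrs f∈ in
        Φ-factor-degree 1≤e order-q Φ cyclotomic irr (Monic⇒Lead monic) (member-∣ₚ fs Φ≋ f∈)

  X^-1-factorisation : ∀ fs → All MonicIrreducible fs → xPowMinusOne e ≈ₚ prodₚ fs →
    All Irreducible (liftFactors deg θ d m fs) × xPowMinusOne (e ℕ.* n) ≈ₚ prodₚ (liftFactors deg θ d m fs)
  X^-1-factorisation fs irrs eq =
      liftFactors-irreducible fs irrs (member-∣ₚ fs X^e-1≋)
    , at (trans (xPowMinusOne≋ (e ℕ.* n)) (trans (sym (lift-X^-1 e coprime)) (sym (prodₚ-liftFactors-deg fs irrs X^e-1≋ (Lead-X^-1 e 1≤e)))))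
    where
    X^e-1≋ : X^ e −1 ≋ ∏ fs (λ f → f)
    X^e-1≋ = trans (sym (xPowMinusOne≋ e)) (trans (asEq _ _ eq) (prodₚ≋∏ fs))

open import Data.Nat using (_*_)

theorem2p7 :
    ∀ {c ℓ : Level} (F : Field c ℓ) (q : ℕ) (card : HasCardinality F q) →
    IsPrimePower q →
    (e : ℕ) → 1 ≤ e → gcd e q ≡ 1 →
    (k : ℕ) → IsMultOrderMod e q k →
    (n : ℕ) → 1 ≤ n →
    (∀ p → Prime p → p ∣ n → p ∣ (q ∸ 1)) →
    gcd n (k * e) ≡ 1 →
    (8 ∣ n → 4 ∣ (q ∸ 1)) →
    (d : ℕ) → d ≡ gcd n (q ∸ 1) →
    (m : ℕ) → n ≡ d * m →
    let open Field F using (Carrier)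
        open Poly F q card
    in
    (θ : Carrier) → HasMultOrder θ d →
    (Φ : ℕ → Pol) → IsCyclotomicFamily Φ →
    (∀ (fs : List Pol) → All MonicIrreducible fs → Φ e ≈ₚ prodₚ fs →
       All Irreducible (liftFactors (λ _ → k) θ d m fs) ×
       substPow n (Φ e) ≈ₚ prodₚ (liftFactors (λ _ → k) θ d m fs)) ×
    (∀ (Fs : List Pol) → All MonicIrreducible Fs → xPowMinusOne e ≈ₚ prodₚ Fs →
       All Irreducible (liftFactors deg θ d m Fs) ×
       xPowMinusOne (e * n) ≈ₚ prodₚ (liftFactors deg θ d m Fs))
theorem2p7 F q card _ e 1≤e _ k order-q n 1≤n rad cop eight d d≡ m n≡dm θ θ-order Φ cyclotomic =
  let r , params = getParameters q e k n d m 1≤n rad cop eight d≡ n≡dm (proj₁ θ-order)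
      open LiftedFactors F q card 1≤e order-q params {θ} θ-order
  in Φ-factorisation Φ cyclotomic , X^-1-factorisation
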